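{- Let $q$ be a prime power, $\mathbb{F}_q$ the finite field with $q$ elements, and let $B(\cdot,\cdot)$ be a non-degenerate bilinear form on $\mathbb{F}_q^2$. There exist constants $C, c > 0$, independent of $q$, such that for every prime power $q$ and every set $E \subset \mathbb{F}_q^2$ with $|E| \geq C q^{5/3}$, \[ \left|\{(B(x,y), B(y,z), B(z,x)) : x, y, z \in E\}\right| \geq c\, q^3 . \]
   Context: The notation $X \gg Y$ in the paper means $X \geq CY$ for a positive constant $C$ independent of $q$; the hypothesis "$|E| \gg q^{5/3}$" and the conclusion "$\gg q^3$" have been written out accordingly. -}

module Defs where

open import Level using (0ℓ)
open import Data.Nat using (ℕ; suc; _^_)
open import Data.Nat.Primality using (Prime)
open import Data.Bool using (Bool; T)
open import Data.Fin using (Fin)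
open import Data.Fin.Properties as FinP using ()
open import Data.List using (List; map; length; filter; allFin; cartesianProduct)
open import Data.List.Relation.Unary.Any as Any using (Any)
open import Data.Product using (_×_; _,_; ∃; ∃-syntax)
open import Data.Product.Properties using (≡-dec)
open import Function.Bundles using (_↔_; Inverse)
open import Algebra.Core using (Op₁; Op₂)
open import Algebra.Structures using (IsCommutativeRing)
open import Relation.Nullary using (¬_; Dec; yes; no)
open import Relation.Nullary.Decidable using (map′)
open import Relation.Binary.PropositionalEquality using (_≡_; refl; cong)
open import Relation.Binary.Definitions using (DecidableEquality)

IsPrimePower : ℕ → Set
IsPrimePower q = ∃[ p ] ∃[ k ] (Prime p × q ≡ p ^ suc k)

record FiniteField : Set₁ where
  infixl 6 _+_
  infixl 7 _*_
  field
    Carrier : Set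
    _+_ _*_ : Op₂ Carrier
    -_      : Op₁ Carrier
    0# 1#   : Carrier
    isCommutativeRing : IsCommutativeRing _≡_ _+_ _*_ -_ 0# 1#
    0≢1     : ¬ (0# ≡ 1#)
    inverse : ∀ x → ¬ (x ≡ 0#) → ∃[ y ] (x * y ≡ 1#)
    size    : ℕ
    enum    : Fin size ↔ Carrier

  _≟_ : DecidableEquality Carrier
  x ≟ y = map′ (λ e → trans′ e) (cong from) (Inverse.from enum x FinP.≟ Inverse.from enum y)
    where
      open Inverse enum using (from; strictlyInverseˡ)
      open import Relation.Binary.PropositionalEquality using (trans; sym)
      trans′ : from x ≡ from y → x ≡ y
      trans′ e = trans (sym (Inverse.inverseˡ enum refl))
                   (trans (cong (Inverse.to enum) e) (Inverse.inverseˡ enum refl))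

  elems : List Carrier
  elems = map (Inverse.to enum) (allFin size)

module _ (F : FiniteField) where
  open FiniteField F

  V : Set
  V = Carrier × Carrier

  0V : V
  0V = 0# , 0#

  _+V_ : V → V → V
  (a , b) +V (c , d) = (a + c) , (b + d)

  _·V_ : Carrier → V → V
  s ·V (a , b) = (s * a) , (s * b)

  allPoints : List V
  allPoints = cartesianProduct elems elems

  record IsBilinear (B : V → V → Carrier) : Set where
    field
      addˡ : ∀ u v w → B (u +V v) w ≡ B u w + B v w
      addʳ : ∀ u v w → B u (v +V w) ≡ B u v + B u w
      smulˡ : ∀ s u w → B (s ·V u) w ≡ s * B u w
      smulʳ : ∀ s u w → B u (s ·V w) ≡ s * B u w

  record IsNondegenerate (B : V → V → Carrier) : Set where
    field
      leftRad  : ∀ x → (∀ y → B x y ≡ 0#) → x ≡ 0V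
      rightRad : ∀ y → (∀ x → B x y ≡ 0#) → y ≡ 0V

  Subset² : Set
  Subset² = V → Bool

  elemsOf : Subset² → List V
  elemsOf E = filter (λ x → Data.Bool.T? (E x)) allPoints
    where import Data.Bool

  card : Subset² → ℕ
  card E = length (elemsOf E)

  Triple : Set
  Triple = Carrier × Carrier × Carrier

  _≟T_ : DecidableEquality Triple
  _≟T_ = ≡-dec _≟_ (≡-dec _≟_ _≟_)

  allTriples : List Triple
  allTriples = cartesianProduct elems (cartesianProduct elems elems)

  distanceTriples : (B : V → V → Carrier) → Subset² → ℕ
  distanceTriples B E = length (filter attained allTriples)
    where
      Es = elemsOf E
      attained : (t : Triple) → Dec (Any (λ x → Any (λ y → Any (λ z →
                   t ≡ (B x y , B y z , B z x)) Es) Es) Es)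
      attained t = Any.any? (λ x → Any.any? (λ y → Any.any? (λ z →
                     t ≟T (B x y , B y z , B z x)) Es) Es) Es

{-# OPTIONS --safe #-}
module Submission where

-- Let N = |E ∖ 0|.  Fix a direction u, put h = #{t : t u ∈ E}, and only use third vertices z = t u.  A
-- triple (x, y, t) is then sent to (B x y, t B(y,u), t B(u,x)); let ν(a,b,c) count its preimages.
-- By Cauchy–Schwarz the number of attained values is at least (∑ ν)² / ∑ ν², where the sums range over
-- a ≠ 0, so ∑ ν² must be bounded.
-- Subtracting from ν its mean over a ≠ 0 leaves a deviation whose square sum is at most 2 q³ N² h.  To see
-- this, write x = r v with v a direction and separate, in the square, the quadruple sum over
-- (v, r, t, y), (v′, r′, t′, y′) into a product K(v,v′) K(v′,v), where K(v,v′) involves the scalars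
-- attached to v′ but the functional B v of the other direction; 2 K(v,v′) K(v′,v) ≤ K(v,v′)² + K(v′,v)²,
-- and in K(v,v′)² the sum over all v ∈ F² is a correlation that is ≤ 0 unless y and y₁ are in the ratio
-- r : r₁, which also forces r₁ = ± r.
-- The mean itself is controlled by the numbers of pairs in E on a common line B(·,u) = const or
-- B(u,·) = const.  Averaging over u gives a direction for which h ≥ N / 2q while these numbers are at most
-- 3 N² / q, and then N³ ≥ 125 q⁵ makes ∑ ν² comparable to (∑ ν)² / q³.

open import Defs
open import Relation.Nullary using (¬_; Dec; yes; no)

-- The obstacle is that x = r v must lie in E, so v cannot be summed freely and orthogonality
-- between the functionals B v is out of reach. A collision, however, depends only on equalities of
-- products such as r B(v,y) = r′ B(v′,y′); read as equalities of quotients, these let the two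
-- directions trade their scalars. Of the two directions, E then constrains only v′ in K(v,v′), and
-- v may range over the whole plane. Keeping z on one line makes the other two coordinates a scalar
-- times a linear functional of a single vertex, which this trade requires; a ≠ 0 is imposed because
-- scaling is transitive only on nonzero values. Orthogonality itself is a count of zeros of linear
-- functionals. The exponent: ∑ ν is about h N², and the deviation adds about q N² h to ∑ ν². This
-- is harmless against (h N²)² / q³ once h N² exceeds a multiple of q⁴, which for h about N / q
-- means N³ ≥ C q⁵. All means are cleared of their denominators q and q - 1, so integers suffice.

module FiniteSums where
  open import Data.Integer hiding (suc)
  open import Data.Integer.Properties
  open import Data.Integer.Tactic.RingSolver using (solve-∀)
  open import Data.List using (List; []; _∷_; _++_; map; filter; length; cartesianProduct)
  open import Data.Nat using (z≤n)
  open import Data.Product using (_×_; _,_; ∃-syntax)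
  open import Data.Empty using (⊥-elim)
  open import Relation.Nullary.Decidable using (_×-dec_)
  open import Relation.Unary using (Decidable)
  open import Relation.Binary.PropositionalEquality
  open import Function using (_∘_)

  private variable
    A C : Set
    P R : Set

  -- Algebra of finite integer sums.

  ∑ : List A → (A → ℤ) → ℤ
  ∑ []       f = 0ℤ
  ∑ (x ∷ xs) f = f x + ∑ xs f

  syntax ∑ xs (λ x → e) = ∑[ x ∈ xs ] e
  infix 5 ∑

  ∑-cong : (xs : List A) {f g : A → ℤ} → (∀ x → f x ≡ g x) → ∑ xs f ≡ ∑ xs g
  ∑-cong []       e = refl
  ∑-cong (x ∷ xs) e = cong₂ _+_ (e x) (∑-cong xs e)

  ∑-zero : (xs : List A) → ∑ xs (λ _ → 0ℤ) ≡ 0ℤ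
  ∑-zero []       = refl
  ∑-zero (x ∷ xs) = trans (+-identityˡ _) (∑-zero xs)

  ∑-+ : (xs : List A) (f g : A → ℤ) → ∑ xs (λ x → f x + g x) ≡ ∑ xs f + ∑ xs g
  ∑-+ []       f g = refl
  ∑-+ (x ∷ xs) f g rewrite ∑-+ xs f g = interchange (f x) (g x) (∑ xs f) (∑ xs g)
    where
    interchange : ∀ a b c d → (a + b) + (c + d) ≡ (a + c) + (b + d)
    interchange = solve-∀

  ∑-*ˡ : (xs : List A) (c : ℤ) (f : A → ℤ) → ∑ xs (λ x → c * f x) ≡ c * ∑ xs f
  ∑-*ˡ []       c f = sym (*-zeroʳ c)
  ∑-*ˡ (x ∷ xs) c f rewrite ∑-*ˡ xs c f = sym (*-distribˡ-+ c (f x) (∑ xs f))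

  ∑-*ʳ : (xs : List A) (c : ℤ) (f : A → ℤ) → ∑ xs (λ x → f x * c) ≡ ∑ xs f * c
  ∑-*ʳ xs c f = trans (∑-cong xs (λ x → *-comm (f x) c)) (trans (∑-*ˡ xs c f) (*-comm c _))

  ∑-neg : (xs : List A) (f : A → ℤ) → ∑ xs (λ x → - f x) ≡ - ∑ xs f
  ∑-neg []       f = refl
  ∑-neg (x ∷ xs) f rewrite ∑-neg xs f = sym (neg-distrib-+ (f x) (∑ xs f))

  ∑-- : (xs : List A) (f g : A → ℤ) → ∑ xs (λ x → f x - g x) ≡ ∑ xs f - ∑ xs g
  ∑-- xs f g = trans (∑-+ xs f (λ x → - g x)) (cong (_+_ (∑ xs f)) (∑-neg xs g))

  ∑-swap : (xs : List A) (ys : List C) (f : A → C → ℤ) →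
           ∑[ x ∈ xs ] ∑[ y ∈ ys ] f x y ≡ ∑[ y ∈ ys ] ∑[ x ∈ xs ] f x y
  ∑-swap []       ys f = sym (∑-zero ys)
  ∑-swap (x ∷ xs) ys f rewrite ∑-swap xs ys f = sym (∑-+ ys (f x) (λ y → ∑[ x ∈ xs ] f x y))

  ∑-* : (xs : List A) (ys : List C) (f : A → ℤ) (g : C → ℤ) →
        ∑[ x ∈ xs ] ∑[ y ∈ ys ] f x * g y ≡ ∑ xs f * ∑ ys g
  ∑-* xs ys f g = trans (∑-cong xs (λ x → ∑-*ˡ ys (f x) g)) (∑-*ʳ xs (∑ ys g) f)

  ∑-++ : (xs ys : List A) (f : A → ℤ) → ∑ (xs ++ ys) f ≡ ∑ xs f + ∑ ys f
  ∑-++ []       ys f = sym (+-identityˡ _)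
  ∑-++ (x ∷ xs) ys f rewrite ∑-++ xs ys f = sym (+-assoc (f x) _ _)

  ∑-map : (g : A → C) (xs : List A) (f : C → ℤ) → ∑ (map g xs) f ≡ ∑ xs (f ∘ g)
  ∑-map g []       f = refl
  ∑-map g (x ∷ xs) f = cong (_+_ (f (g x))) (∑-map g xs f)

  ∑-cartesianProduct : (xs : List A) (ys : List C) (f : A × C → ℤ) →
                       ∑ (cartesianProduct xs ys) f ≡ ∑[ x ∈ xs ] ∑[ y ∈ ys ] f (x , y)
  ∑-cartesianProduct []       ys f = refl
  ∑-cartesianProduct (x ∷ xs) ys f =
    trans (∑-++ (map (x ,_) ys) (cartesianProduct xs ys) f)
          (cong₂ _+_ (∑-map (x ,_) ys f) (∑-cartesianProduct xs ys f))

  -- Order and nonnegativity.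

  ∑-mono : (xs : List A) {f g : A → ℤ} → (∀ x → f x ≤ g x) → ∑ xs f ≤ ∑ xs g
  ∑-mono []       le = ≤-refl
  ∑-mono (x ∷ xs) le = +-mono-≤ (le x) (∑-mono xs le)

  ∑-nonneg : (xs : List A) {f : A → ℤ} → (∀ x → 0ℤ ≤ f x) → 0ℤ ≤ ∑ xs f
  ∑-nonneg xs {f} le = subst (_≤ ∑ xs f) (∑-zero xs) (∑-mono xs le)

  *-nonneg : ∀ {a b} → 0ℤ ≤ a → 0ℤ ≤ b → 0ℤ ≤ a * b
  *-nonneg {+ a} {+ b} _ _ = subst (0ℤ ≤_) (pos-* a b) (+≤+ z≤n)

  +-nonneg : ∀ {a b} → 0ℤ ≤ a → 0ℤ ≤ b → 0ℤ ≤ a + b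
  +-nonneg = +-mono-≤

  square-nonneg : ∀ a → 0ℤ ≤ a * a
  square-nonneg (+ a)      = *-nonneg {+ a} {+ a} (+≤+ z≤n) (+≤+ z≤n)
  square-nonneg (-[1+ a ]) = +≤+ z≤n

  *-mono-≤-nonnegˡ : ∀ {c a b} → 0ℤ ≤ c → a ≤ b → c * a ≤ c * b
  *-mono-≤-nonnegˡ {+ c} _ le = *-monoˡ-≤-nonNeg (+ c) le

  *-mono-≤-nonneg : ∀ {a b c d} → 0ℤ ≤ b → 0ℤ ≤ c → a ≤ b → c ≤ d → a * c ≤ b * d
  *-mono-≤-nonneg {a} {b} {c} {d} 0≤b 0≤c a≤b c≤d =
    ≤-trans (subst₂ _≤_ (*-comm c a) (*-comm c b) (*-mono-≤-nonnegˡ 0≤c a≤b))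
            (*-mono-≤-nonnegˡ 0≤b c≤d)

  ≤-by-difference : ∀ {a b} d → 0ℤ ≤ d → b ≡ a + d → a ≤ b
  ≤-by-difference {a} d 0≤d refl = subst (_≤ a + d) (+-identityʳ a) (+-monoʳ-≤ a 0≤d)

  difference-nonneg : ∀ {a b} → a ≤ b → 0ℤ ≤ b - a
  difference-nonneg = i≤j⇒0≤j-i

  -- Inequalities obtained from sums of squares.

  ∑-square : (xs : List A) (f : A → ℤ) → ∑ xs f * ∑ xs f ≡ ∑[ x ∈ xs ] ∑[ y ∈ xs ] f x * f y
  ∑-square xs f = sym (∑-* xs xs f f)

  ∑-square-∑ : (xs : List A) (ys : List C) (f : A → C → ℤ) →
    ∑[ x ∈ xs ] (∑[ y ∈ ys ] f x y) * (∑[ y ∈ ys ] f x y) ≡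
    ∑[ y ∈ ys ] ∑[ z ∈ ys ] ∑[ x ∈ xs ] f x y * f x z
  ∑-square-∑ xs ys f =
    trans (∑-cong xs (λ x → ∑-square ys (f x)))
   (trans (∑-swap xs ys _) (∑-cong ys (λ y → ∑-swap xs ys _)))

  -- Lagrange's identity: the difference of the two sides is half the sum of (f x g y - f y g x)².
  cauchy-schwarz : (xs : List A) (f g : A → ℤ) →
    (∑[ x ∈ xs ] f x * g x) * (∑[ x ∈ xs ] f x * g x) ≤
    (∑[ x ∈ xs ] f x * f x) * (∑[ x ∈ xs ] g x * g x)
  cauchy-schwarz xs f g = *-cancelˡ-≤-pos _ _ (+ 2) (≤-by-difference D D≥0 expand)
    where
    fg = ∑[ x ∈ xs ] f x * g x
    ff = ∑[ x ∈ xs ] f x * f x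
    gg = ∑[ x ∈ xs ] g x * g x
    D = ∑[ x ∈ xs ] ∑[ y ∈ xs ] (f x * g y - f y * g x) * (f x * g y - f y * g x)
    D≥0 : 0ℤ ≤ D
    D≥0 = ∑-nonneg xs (λ x → ∑-nonneg xs (λ y → square-nonneg (f x * g y - f y * g x)))
    pointwise : ∀ a b c d → (a * d - b * c) * (a * d - b * c) ≡
                (((a * a) * (d * d)) + ((c * c) * (b * b))) - + 2 * ((a * c) * (b * d))
    pointwise = solve-∀
    D≡ : D ≡ (ff * gg + gg * ff) - + 2 * (fg * fg)
    D≡ = begin
      D
        ≡⟨ ∑-cong xs (λ x → trans (∑-cong xs (λ y → pointwise (f x) (f y) (g x) (g y)))
             (trans (∑-- xs _ _)
             (cong₂ _-_ (∑-+ xs _ _) (∑-*ˡ xs (+ 2) _)))) ⟩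
      ∑[ x ∈ xs ] (((∑[ y ∈ xs ] (f x * f x) * (g y * g y)) + (∑[ y ∈ xs ] (g x * g x) * (f y * f y)))
                  - + 2 * (∑[ y ∈ xs ] (f x * g x) * (f y * g y)))
        ≡⟨ trans (∑-- xs _ _) (cong₂ _-_ (∑-+ xs _ _) (∑-*ˡ xs (+ 2) _)) ⟩
      ((∑[ x ∈ xs ] ∑[ y ∈ xs ] (f x * f x) * (g y * g y)) + (∑[ x ∈ xs ] ∑[ y ∈ xs ] (g x * g x) * (f y * f y)))
         - + 2 * (∑[ x ∈ xs ] ∑[ y ∈ xs ] (f x * g x) * (f y * g y))
        ≡⟨ cong₂ _-_ (cong₂ _+_ (∑-* xs xs _ _) (∑-* xs xs _ _)) (cong (_*_ (+ 2)) (∑-* xs xs _ _)) ⟩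
      (ff * gg + gg * ff) - + 2 * (fg * fg) ∎
      where open ≡-Reasoning
    rearrange : ∀ p r s → + 2 * (p * r) ≡ + 2 * (s * s) + ((p * r + r * p) - + 2 * (s * s))
    rearrange = solve-∀
    expand : + 2 * (ff * gg) ≡ + 2 * (fg * fg) + D
    expand = trans (rearrange ff gg fg) (cong (_+_ (+ 2 * (fg * fg))) (sym D≡))

  -- This is 2ab ≤ a² + b² with a = f x y and b = f y x, summed. Renaming x and y makes the two
  -- square sums equal, so no constant is lost.
  cross-terms-≤-squares : (xs : List A) (f : A → A → ℤ) →
    ∑[ x ∈ xs ] ∑[ y ∈ xs ] f x y * f y x ≤ ∑[ x ∈ xs ] ∑[ y ∈ xs ] f x y * f x y
  cross-terms-≤-squares xs f = *-cancelˡ-≤-pos _ _ (+ 2) (≤-by-difference D D≥0 expand)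
    where
    D = ∑[ x ∈ xs ] ∑[ y ∈ xs ] (f x y - f y x) * (f x y - f y x)
    D≥0 : 0ℤ ≤ D
    D≥0 = ∑-nonneg xs (λ x → ∑-nonneg xs (λ y → square-nonneg (f x y - f y x)))
    S = ∑[ x ∈ xs ] ∑[ y ∈ xs ] f x y * f x y
    C′ = ∑[ x ∈ xs ] ∑[ y ∈ xs ] f x y * f y x
    pointwise : ∀ a b → (a - b) * (a - b) ≡ (a * a + b * b) - + 2 * (a * b)
    pointwise = solve-∀
    D≡ : D ≡ (S + S) - + 2 * C′
    D≡ = begin
      D
        ≡⟨ ∑-cong xs (λ x → trans (∑-cong xs (λ y → pointwise (f x y) (f y x)))
             (trans (∑-- xs _ _) (cong₂ _-_ (∑-+ xs _ _) (∑-*ˡ xs (+ 2) _)))) ⟩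
      ∑[ x ∈ xs ] (((∑[ y ∈ xs ] f x y * f x y) + (∑[ y ∈ xs ] f y x * f y x))
                  - + 2 * (∑[ y ∈ xs ] f x y * f y x))
        ≡⟨ trans (∑-- xs _ _) (cong₂ _-_ (∑-+ xs _ _) (∑-*ˡ xs (+ 2) _)) ⟩
      (S + (∑[ x ∈ xs ] ∑[ y ∈ xs ] f y x * f y x)) - + 2 * C′
        ≡⟨ cong (λ s → (S + s) - + 2 * C′) (∑-swap xs xs (λ x y → f y x * f y x)) ⟩
      (S + S) - + 2 * C′ ∎
      where open ≡-Reasoning
    rearrange : ∀ s c → + 2 * s ≡ + 2 * c + ((s + s) - + 2 * c)
    rearrange = solve-∀
    expand : + 2 * S ≡ + 2 * C′ + D
    expand = trans (rearrange S C′) (cong (_+_ (+ 2 * C′)) (sym D≡))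

  -- Indicators of decidable propositions, and selection of a term.

  ⟦_⟧ : Dec P → ℤ
  ⟦ yes _ ⟧ = 1ℤ
  ⟦ no  _ ⟧ = 0ℤ

  ⟦⟧-cong : (d : Dec P) (e : Dec R) → (P → R) → (R → P) → ⟦ d ⟧ ≡ ⟦ e ⟧
  ⟦⟧-cong (yes p) (yes r) f g = refl
  ⟦⟧-cong (yes p) (no ¬r) f g = ⊥-elim (¬r (f p))
  ⟦⟧-cong (no ¬p) (yes r) f g = ⊥-elim (¬p (g r))
  ⟦⟧-cong (no ¬p) (no ¬r) f g = refl

  ⟦⟧-true : (d : Dec P) → P → ⟦ d ⟧ ≡ 1ℤ
  ⟦⟧-true (yes _) p = refl
  ⟦⟧-true (no ¬p) p = ⊥-elim (¬p p)

  ⟦⟧-false : (d : Dec P) → ¬ P → ⟦ d ⟧ ≡ 0ℤ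
  ⟦⟧-false (yes p) ¬p = ⊥-elim (¬p p)
  ⟦⟧-false (no _)  ¬p = refl

  ⟦⟧-nonneg : (d : Dec P) → 0ℤ ≤ ⟦ d ⟧
  ⟦⟧-nonneg (yes _) = +≤+ z≤n
  ⟦⟧-nonneg (no _)  = +≤+ z≤n

  ⟦⟧-≤1 : (d : Dec P) → ⟦ d ⟧ ≤ 1ℤ
  ⟦⟧-≤1 (yes _) = ≤-refl
  ⟦⟧-≤1 (no _)  = +≤+ z≤n

  ⟦⟧-idem : (d : Dec P) → ⟦ d ⟧ * ⟦ d ⟧ ≡ ⟦ d ⟧
  ⟦⟧-idem (yes _) = refl
  ⟦⟧-idem (no _)  = refl

  ⟦⟧-× : (d : Dec P) (e : Dec R) → ⟦ d ⟧ * ⟦ e ⟧ ≡ ⟦ d ×-dec e ⟧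
  ⟦⟧-× (yes _) (yes _) = refl
  ⟦⟧-× (yes _) (no _)  = refl
  ⟦⟧-× (no _)  (yes _) = refl
  ⟦⟧-× (no _)  (no _)  = refl

  length-filter : {P : A → Set} (P? : Decidable P) (xs : List A) →
                  + length (filter P? xs) ≡ ∑[ x ∈ xs ] ⟦ P? x ⟧
  length-filter P? []       = refl
  length-filter P? (x ∷ xs) with P? x
  ... | yes _ = cong (_+_ 1ℤ) (length-filter P? xs)
  ... | no  _ = trans (length-filter P? xs) (sym (+-identityˡ _))

  -- Dropping a negative head only raises the sum, so the search can move on to the tail. The
  -- separate head `x` keeps the list nonempty; an empty sum is nonnegative without offering a
  -- witness.
  ∑-pigeonhole : (x : A) (xs : List A) (f : A → ℤ) → 0ℤ ≤ ∑ (x ∷ xs) f → ∃[ y ] 0ℤ ≤ f y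
  ∑-pigeonhole x xs f 0≤∑ with 0ℤ ≤? f x
  ... | yes 0≤fx = x , 0≤fx
  ∑-pigeonhole x [] f 0≤∑ | no fx<0 = ⊥-elim (fx<0 (subst (0ℤ ≤_) (+-identityʳ (f x)) 0≤∑))
  ∑-pigeonhole x (y ∷ ys) f 0≤∑ | no fx<0 =
    ∑-pigeonhole y ys f (≤-trans 0≤∑ (subst (∑ (x ∷ y ∷ ys) f ≤_) (+-identityˡ _)
      (+-monoˡ-≤ (∑ (y ∷ ys) f) (<⇒≤ (≰⇒> fx<0)))))

-- Lists containing every element exactly once.

module Enumerations where
  open FiniteSums
  open import Data.Integer using (ℤ; +_; 1ℤ; _+_; _*_)
  open import Data.Integer.Properties using (+-identityˡ; +-identityʳ; *-identityˡ; *-identityʳ;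
    *-assoc)
  open import Data.Nat using (zero; suc)
  open import Data.Fin using (Fin; zero; suc)
  import Data.Fin.Properties as Fin
  open import Data.List using (List; map; tabulate; allFin; cartesianProduct)
  open import Data.List.Properties using (map-tabulate)
  open import Data.Product using (_,_)
  open import Data.Product.Properties using (≡-dec)
  open import Function using (_∘_; id)
  open import Function.Bundles using (_↔_; Inverse)
  open import Relation.Nullary.Decidable using (_×-dec_)
  open import Relation.Binary.Definitions using (DecidableEquality)
  open import Relation.Binary.PropositionalEquality

  private variable
    A C : Set

  -- Completeness and absence of repetitions are encoded together as the sifting property of the
  -- Kronecker delta, so that changes of variable become computations with sums instead of
  -- permutations of lists.
  record Enumerates {A : Set} (xs : List A) : Set where
    field
      _≟_      : DecidableEquality A
      collapse : ∀ a (f : A → ℤ) → ∑[ x ∈ xs ] ⟦ x ≟ a ⟧ * f x ≡ f a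

    ∑-unique : {P : A → Set} (P? : ∀ x → Dec (P x)) (a : A) → (∀ x → P x → x ≡ a) → P a →
               (f : A → ℤ) → ∑[ x ∈ xs ] ⟦ P? x ⟧ * f x ≡ f a
    ∑-unique P? a uniq pa f = trans
      (∑-cong xs (λ x → cong (_* f x) (⟦⟧-cong (P? x) (x ≟ a) (uniq x) (λ { refl → pa }))))
      (collapse a f)

    ∑-unique₁ : {P : A → Set} (P? : ∀ x → Dec (P x)) (a : A) → (∀ x → P x → x ≡ a) → P a →
                ∑[ x ∈ xs ] ⟦ P? x ⟧ ≡ 1ℤ
    ∑-unique₁ P? a uniq pa =
      trans (∑-cong xs (λ x → sym (*-identityʳ ⟦ P? x ⟧))) (∑-unique P? a uniq pa (λ _ → 1ℤ))

    -- Write f (g x) as a delta sum over y and exchange the sums; for each y the only surviving x is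
    -- g⁻¹ y.
    reindex : (g g⁻¹ : A → A) → (∀ x → g⁻¹ (g x) ≡ x) → (∀ y → g (g⁻¹ y) ≡ y) →
              (f : A → ℤ) → ∑[ x ∈ xs ] f (g x) ≡ ∑ xs f
    reindex g g⁻¹ left right f = begin
      ∑[ x ∈ xs ] f (g x)                          ≡⟨ ∑-cong xs (λ x → sym (collapse (g x) f)) ⟩
      ∑[ x ∈ xs ] ∑[ y ∈ xs ] ⟦ y ≟ g x ⟧ * f y    ≡⟨ ∑-swap xs xs _ ⟩
      ∑[ y ∈ xs ] ∑[ x ∈ xs ] ⟦ y ≟ g x ⟧ * f y    ≡⟨ ∑-cong xs (λ y → ∑-unique (λ x → y ≟ g x) (g⁻¹ y)
                                                        (λ x e → trans (sym (left x)) (cong g⁻¹ (sym e)))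
                                                        (sym (right y)) (λ _ → f y)) ⟩
      ∑ xs f                                       ∎
      where open ≡-Reasoning

  allFin-enumerates : ∀ n → Enumerates (allFin n)
  allFin-enumerates n = record { _≟_ = Fin._≟_ ; collapse = go n }
    where
    go : ∀ n (k : Fin n) (f : Fin n → ℤ) → ∑[ i ∈ allFin n ] ⟦ i Fin.≟ k ⟧ * f i ≡ f k
    tail : ∀ n (g : Fin (suc n) → ℤ) → ∑ (tabulate suc) g ≡ ∑ (allFin n) (g ∘ suc)
    tail n g = trans (cong (λ xs → ∑ xs g) (sym (map-tabulate id suc))) (∑-map suc (allFin n) g)
    go (suc n) zero f =
      trans (cong₂ _+_ (*-identityˡ (f zero)) (trans (tail n (λ i → ⟦ i Fin.≟ zero ⟧ * f i)) (∑-zero (allFin n)))) (+-identityʳ (f zero))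
    go (suc n) (suc k) f =
      trans (+-identityˡ _) (trans (tail n (λ i → ⟦ i Fin.≟ suc k ⟧ * f i)) (trans
        (∑-cong (allFin n) (λ i → cong (_* f (suc i))
          (⟦⟧-cong (suc i Fin.≟ suc k) (i Fin.≟ k) Fin.suc-injective (cong suc))))
        (go n k (f ∘ suc))))

  map-enumerates : {xs : List C} (iso : C ↔ A) → DecidableEquality A →
                   Enumerates xs → Enumerates (map (Inverse.to iso) xs)
  map-enumerates {xs = xs} iso _≟_ e = record
    { _≟_ = _≟_
    ; collapse = λ a f → trans (∑-map to xs _)
        (trans (∑-unique (λ i → to i ≟ a) (from a)
                 (λ i eq → sym (inverseʳ (sym eq))) (inverseˡ refl) (f ∘ to))
               (cong f (inverseˡ refl)))
    }
    where
    open Inverse iso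
    open Enumerates e using (∑-unique)

  ×-enumerates : {xs : List A} {ys : List C} → Enumerates xs → Enumerates ys →
                 Enumerates (cartesianProduct xs ys)
  ×-enumerates {xs = xs} {ys} ex ey = record
    { _≟_ = ≡-dec X._≟_ Y._≟_
    ; collapse = λ { (a , b) f → trans (∑-cartesianProduct xs ys _) (trans
        (∑-cong xs (λ x → trans
          (∑-cong ys (λ y → trans
            (cong (_* f (x , y)) (trans
              (⟦⟧-cong (≡-dec X._≟_ Y._≟_ (x , y) (a , b)) ((x X.≟ a) ×-dec (y Y.≟ b))
                (λ { refl → refl , refl }) (λ { (refl , refl) → refl }))
              (sym (⟦⟧-× (x X.≟ a) (y Y.≟ b)))))
            (*-assoc ⟦ x X.≟ a ⟧ ⟦ y Y.≟ b ⟧ (f (x , y)))))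
          (trans (∑-*ˡ ys ⟦ x X.≟ a ⟧ _) (cong (⟦ x X.≟ a ⟧ *_) (Y.collapse b (λ y → f (x , y)))))))
        (X.collapse a (λ x → f (x , b)))) }
    }
    where
    module X = Enumerates ex
    module Y = Enumerates ey

-- Inverses, cancellation and square roots in the field.

module FieldAlgebra (F : FiniteField) where
  open import Level using (0ℓ)
  open import Algebra.Bundles using (CommutativeRing)
  open import Algebra.Structures using (IsCommutativeRing)
  open import Data.Product using (proj₁; proj₂)
  open import Data.Sum using (_⊎_; inj₁; inj₂)
  open import Data.Empty using (⊥-elim)
  open import Relation.Binary.PropositionalEquality
  open FiniteField F public
  open IsCommutativeRing isCommutativeRing public using (+-assoc; +-comm; *-assoc; *-comm; *-identityˡ;
    *-identityʳ; zeroˡ; zeroʳ; +-identityˡ; +-identityʳ; -‿inverseˡ; -‿inverseʳ; distribˡ; distribʳ)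

  commutativeRing : CommutativeRing 0ℓ 0ℓ
  commutativeRing = record { isCommutativeRing = isCommutativeRing }

  open import Algebra.Properties.Ring (CommutativeRing.ring commutativeRing) public using (-‿distribˡ-*;
    -‿distribʳ-*; +-inverseˡ-unique; -‿involutive)

  _⁻¹ : Carrier → Carrier
  x ⁻¹ with x ≟ 0#
  -- A placeholder that makes inversion total; the cancellation laws for `_⁻¹` all assume a nonzero
  -- argument.
  ... | yes _  = 0#
  ... | no x≢0 = proj₁ (inverse x x≢0)

  ⁻¹-inverseʳ : ∀ {x} → ¬ x ≡ 0# → x * x ⁻¹ ≡ 1#
  ⁻¹-inverseʳ {x} x≢0 with x ≟ 0#
  ... | yes x≡0 = ⊥-elim (x≢0 x≡0)
  ... | no x≢0′ = proj₂ (inverse x x≢0′)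

  ⁻¹-inverseˡ : ∀ {x} → ¬ x ≡ 0# → x ⁻¹ * x ≡ 1#
  ⁻¹-inverseˡ x≢0 = trans (*-comm _ _) (⁻¹-inverseʳ x≢0)

  ⁻¹-cancelˡ : ∀ {r} → ¬ r ≡ 0# → ∀ x → r ⁻¹ * (r * x) ≡ x
  ⁻¹-cancelˡ r≢0 x = trans (sym (*-assoc _ _ x)) (trans (cong (_* x) (⁻¹-inverseˡ r≢0)) (*-identityˡ x))

  ⁻¹-cancelʳ : ∀ {r} → ¬ r ≡ 0# → ∀ x → r * (r ⁻¹ * x) ≡ x
  ⁻¹-cancelʳ r≢0 x = trans (sym (*-assoc _ _ x)) (trans (cong (_* x) (⁻¹-inverseʳ r≢0)) (*-identityˡ x))

  *-cancelˡ : ∀ {r a b} → ¬ r ≡ 0# → r * a ≡ r * b → a ≡ b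
  *-cancelˡ {r} {a} {b} r≢0 e = trans (sym (⁻¹-cancelˡ r≢0 a)) (trans (cong (r ⁻¹ *_) e) (⁻¹-cancelˡ r≢0 b))

  *-zero⇒ : ∀ {r a} → ¬ r ≡ 0# → r * a ≡ 0# → a ≡ 0#
  *-zero⇒ {r} r≢0 e = *-cancelˡ r≢0 (trans e (sym (zeroʳ r)))

  *-nonzero : ∀ {r a} → ¬ r ≡ 0# → ¬ a ≡ 0# → ¬ r * a ≡ 0#
  *-nonzero r≢0 a≢0 e = a≢0 (*-zero⇒ r≢0 e)

  *-swapˡ : ∀ a b c → a * (b * c) ≡ b * (a * c)
  *-swapˡ a b c = trans (sym (*-assoc a b c)) (trans (cong (_* c) (*-comm a b)) (*-assoc b a c))

  difference-zero : ∀ a b → a + - b ≡ 0# → a ≡ b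
  difference-zero a b e = trans (+-inverseˡ-unique a (- b) e) (-‿involutive b)

  -- From (a - b)(a + b) = a² - b² = 0, where a nonzero first factor can be cancelled.
  -- Characteristic 2 is covered as well: there the two alternatives coincide.
  square-roots : ∀ a b → a * a ≡ b * b → a ≡ b ⊎ a ≡ - b
  square-roots a b a²≡b² with (a + - b) ≟ 0#
  ... | yes a-b≡0 = inj₁ (difference-zero a b a-b≡0)
  ... | no a-b≢0 = inj₂ (+-inverseˡ-unique a b (*-zero⇒ a-b≢0 (begin
    (a + - b) * (a + b)               ≡⟨ distribˡ (a + - b) a b ⟩
    (a + - b) * a + (a + - b) * b     ≡⟨ cong₂ _+_ (distribʳ a a (- b)) (distribʳ b a (- b)) ⟩
    (a * a + - b * a) + (a * b + - b * b)
      ≡⟨ cong₂ _+_ (cong₂ _+_ a²≡b² (trans (sym (-‿distribˡ-* b a)) (cong -_ (*-comm b a))))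
                   (cong (a * b +_) (sym (-‿distribˡ-* b b))) ⟩
    (b * b + - (a * b)) + (a * b + - (b * b)) ≡⟨ +-assoc _ _ _ ⟩
    b * b + (- (a * b) + (a * b + - (b * b))) ≡⟨ cong (b * b +_) (trans (sym (+-assoc _ _ _))
                                                  (trans (cong (_+ - (b * b)) (-‿inverseˡ (a * b))) (+-identityˡ _))) ⟩
    b * b + - (b * b)                 ≡⟨ -‿inverseʳ (b * b) ⟩
    0# ∎)))
    where open ≡-Reasoning

-- Sums over the field and over the plane.

module FieldSums (F : FiniteField) where
  open FiniteSums
  open Enumerations
  open FieldAlgebra F using (Carrier; elems; size; enum; _≟_; 0#; _⁻¹; ⁻¹-cancelˡ;
    ⁻¹-cancelʳ) renaming (_*_ to _·_)
  open import Data.Integer using (ℤ; +_; 1ℤ; _+_; _*_)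
  open import Data.Integer.Properties using (*-identityˡ)
  open import Data.List using (List; []; _∷_; length; allFin)
  open import Data.List.Properties using (length-map; length-tabulate)
  open import Data.Product using (_,_)
  open import Function using (id)
  open import Function.Bundles using (Inverse)
  open import Relation.Binary.PropositionalEquality

  Q : ℤ
  Q = + size

  elems-enumerates : Enumerates elems
  elems-enumerates = map-enumerates enum _≟_ (allFin-enumerates size)

  points-enumerates : Enumerates (allPoints F)
  points-enumerates = ×-enumerates elems-enumerates elems-enumerates

  module 𝔽 = Enumerates elems-enumerates
  module 𝕍 = Enumerates points-enumerates

  ∑F : (Carrier → ℤ) → ℤ
  ∑F = ∑ elems

  ∑V : (V F → ℤ) → ℤ
  ∑V = ∑ (allPoints F)

  ∑-one : {A : Set} (xs : List A) → ∑[ x ∈ xs ] 1ℤ ≡ + length xs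
  ∑-one []       = refl
  ∑-one (x ∷ xs) = cong (_+_ 1ℤ) (∑-one xs)

  ∑F-one : ∑F (λ _ → 1ℤ) ≡ Q
  ∑F-one = trans (∑-one elems)
    (cong +_ (trans (length-map (Inverse.to enum) (allFin size)) (length-tabulate {n = size} id)))

  ∑F-const : ∀ c → ∑F (λ _ → c) ≡ Q * c
  ∑F-const c = trans (∑-cong elems (λ _ → sym (*-identityˡ c)))
    (trans (∑-*ʳ elems c (λ _ → 1ℤ)) (cong (_* c) ∑F-one))

  ∑V-pairs : (f : V F → ℤ) → ∑V f ≡ ∑F (λ a → ∑F (λ b → f (a , b)))
  ∑V-pairs f = ∑-cartesianProduct elems elems f

  ∑V-one : ∑V (λ _ → 1ℤ) ≡ Q * Q
  ∑V-one = trans (∑V-pairs _) (trans (∑-cong elems (λ _ → ∑F-one)) (∑F-const Q))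

  ∑F-scale : ∀ {r} → ¬ r ≡ 0# → (f : Carrier → ℤ) → ∑F (λ a → f (r · a)) ≡ ∑F f
  ∑F-scale {r} r≢0 = 𝔽.reindex (r ·_) (r ⁻¹ ·_) (⁻¹-cancelˡ r≢0) (⁻¹-cancelʳ r≢0)

  infixr 7 _•_
  _•_ : Carrier → V F → V F
  _•_ = _·V_ F

  ∑V-scale : ∀ {r} → ¬ r ≡ 0# → (f : V F → ℤ) → ∑V (λ v → f (r • v)) ≡ ∑V f
  ∑V-scale {r} r≢0 = 𝕍.reindex (r •_) (r ⁻¹ •_)
    (λ { (a , b) → cong₂ _,_ (⁻¹-cancelˡ r≢0 a) (⁻¹-cancelˡ r≢0 b) })
    (λ { (a , b) → cong₂ _,_ (⁻¹-cancelʳ r≢0 a) (⁻¹-cancelʳ r≢0 b) })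

-- Coordinates and the size of a kernel.

module BilinearForms (F : FiniteField) (B : V F → V F → FiniteField.Carrier F) (bil : IsBilinear F B) where
  open FiniteSums
  open FieldSums F
  open FieldAlgebra F
  open IsBilinear bil
  open import Data.Integer as ℤ using (1ℤ)
  import Data.Integer.Properties as ℤ
  open import Data.Product using (_,_)
  open import Data.Empty using (⊥-elim)
  open import Relation.Binary.PropositionalEquality

  e₁ e₂ : V F
  e₁ = 1# , 0#
  e₂ = 0# , 1#

  coordinates : ∀ a b y → B (a , b) y ≡ a * B e₁ y + b * B e₂ y
  coordinates a b y = trans (cong (λ v → B v y) decompose)
    (trans (addˡ (_·V_ F a e₁) (_·V_ F b e₂) y) (cong₂ _+_ (smulˡ a e₁ y) (smulˡ b e₂ y)))
    where
    decompose : (a , b) ≡ _+V_ F (_·V_ F a e₁) (_·V_ F b e₂)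
    decompose = cong₂ _,_
      (sym (trans (cong₂ _+_ (*-identityʳ a) (zeroʳ b)) (+-identityʳ a)))
      (sym (trans (cong₂ _+_ (zeroʳ a) (*-identityʳ b)) (+-identityˡ b)))

  zero-left : ∀ y → B (0V F) y ≡ 0#
  zero-left y = trans (coordinates 0# 0# y) (trans (cong₂ _+_ (zeroˡ _) (zeroˡ _)) (+-identityˡ 0#))

  private
    solutions : ∀ {g} h → ¬ g ≡ 0# → ∑F (λ a → ⟦ (a * g + h) ≟ 0# ⟧) ≡ 1ℤ
    solutions {g} h g≢0 = 𝔽.∑-unique₁ (λ a → (a * g + h) ≟ 0#) (g ⁻¹ * - h)
      (λ a e → trans (sym (⁻¹-cancelˡ g≢0 a)) (cong (g ⁻¹ *_)
        (trans (*-comm g a) (+-inverseˡ-unique (a * g) h e))))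
      (trans (cong (_+ h) (trans (*-comm _ g) (⁻¹-cancelʳ g≢0 (- h)))) (-‿inverseˡ h))

  -- By `rightRad` the coefficients B e₁ y and B e₂ y are not both zero. The coordinate with a
  -- nonzero coefficient is determined by the other one, which stays free.
  kernel-card : (∀ y → (∀ x → B x y ≡ 0#) → y ≡ 0V F) → ∀ {y} → ¬ y ≡ 0V F →
                ∑V (λ v → ⟦ B v y ≟ 0# ⟧) ≡ Q
  kernel-card rightRad {y} y≢0 with B e₁ y ≟ 0# | B e₂ y ≟ 0#
  ... | no g≢0 | _ = begin
    ∑V (λ v → ⟦ B v y ≟ 0# ⟧)
      ≡⟨ trans (∑V-pairs _) (∑-swap elems elems _) ⟩
    ∑F (λ b → ∑F (λ a → ⟦ B (a , b) y ≟ 0# ⟧))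
      ≡⟨ ∑-cong elems (λ b → trans (∑-cong elems (λ a → cong (λ m → ⟦ m ≟ 0# ⟧) (coordinates a b y)))
                                   (solutions (b * B e₂ y) g≢0)) ⟩
    ∑F (λ b → 1ℤ)
      ≡⟨ ∑F-one ⟩
    Q ∎
    where open ≡-Reasoning
  ... | yes _ | no g≢0 = begin
    ∑V (λ v → ⟦ B v y ≟ 0# ⟧)
      ≡⟨ ∑V-pairs _ ⟩
    ∑F (λ a → ∑F (λ b → ⟦ B (a , b) y ≟ 0# ⟧))
      ≡⟨ ∑-cong elems (λ a → trans (∑-cong elems (λ b → cong (λ m → ⟦ m ≟ 0# ⟧)
                                       (trans (coordinates a b y) (+-comm _ _))))
                                   (solutions (a * B e₁ y) g≢0)) ⟩
    ∑F (λ a → 1ℤ)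
      ≡⟨ ∑F-one ⟩
    Q ∎
    where open ≡-Reasoning
  ... | yes g₁≡0 | yes g₂≡0 = ⊥-elim (y≢0 (rightRad y λ { (a , b) → begin
    B (a , b) y               ≡⟨ coordinates a b y ⟩
    a * B e₁ y + b * B e₂ y   ≡⟨ cong₂ _+_ (trans (cong (a *_) g₁≡0) (zeroʳ a)) (trans (cong (b *_) g₂≡0) (zeroʳ b)) ⟩
    0# + 0#                   ≡⟨ +-identityˡ 0# ⟩
    0#                        ∎ }))
    where open ≡-Reasoning

-- Centred indicators on the nonzero field elements and their correlations.

module CentredIndicators (F : FiniteField) where
  open FiniteSums
  open FieldSums F
  open FieldAlgebra F using (Carrier; elems; _≟_; 0#; 1#; _⁻¹; ⁻¹-cancelˡ; ⁻¹-cancelʳ; *-nonzero;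
    *-cancelˡ) renaming (_*_ to _·_; *-assoc to ·-assoc; *-identityʳ to ·-identityʳ;
    *-comm to ·-comm; zeroʳ to ·-zeroʳ)
  open import Data.Integer using (ℤ; +_; 0ℤ; 1ℤ; _+_; _*_; _-_; _≤_)
  open import Data.Integer.Tactic.RingSolver using (solve-∀)
  open import Relation.Nullary.Decidable using (¬?)
  open import Relation.Binary.PropositionalEquality

  Q₁ : ℤ
  Q₁ = Q - 1ℤ

  z nz : Carrier → ℤ
  z m = ⟦ m ≟ 0# ⟧
  nz m = ⟦ ¬? (m ≟ 0#) ⟧

  nz≡1-z : ∀ m → nz m ≡ 1ℤ - z m
  nz≡1-z m with m ≟ 0#
  ... | yes _ = refl
  ... | no  _ = refl

  nz-idem : ∀ m → nz m * nz m ≡ nz m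
  nz-idem m = ⟦⟧-idem (¬? (m ≟ 0#))

  nz-scale : ∀ {r} → ¬ r ≡ 0# → ∀ m → nz (r · m) ≡ nz m
  nz-scale r≢0 m = ⟦⟧-cong _ _ (λ rm≢0 m≡0 → rm≢0 (trans (cong (_ ·_) m≡0) (·-zeroʳ _))) (*-nonzero r≢0)

  ∑F-nz : ∑F nz ≡ Q₁
  ∑F-nz = trans (∑-cong elems nz≡1-z) (trans (∑-- elems _ _)
    (cong₂ _-_ ∑F-one (𝔽.∑-unique₁ (_≟ 0#) 0# (λ _ e → e) refl)))

  Q₁-nonneg : 0ℤ ≤ Q₁
  Q₁-nonneg = subst (0ℤ ≤_) ∑F-nz (∑-nonneg elems (λ a → ⟦⟧-nonneg (¬? (a ≟ 0#))))

  -- d m a is (q - 1) times the deviation of [m = a] from its mean over the nonzero a.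
  d : Carrier → Carrier → ℤ
  d m a = Q₁ * ⟦ m ≟ a ⟧ - nz m

  private
    guess : ∀ {r} → ¬ r ≡ 0# → ∀ m a → m ≡ a · r → a ≡ r ⁻¹ · m
    guess r≢0 m a e = trans (sym (⁻¹-cancelˡ r≢0 a)) (cong (_ ·_) (trans (·-comm _ a) (sym e)))

    guess-correct : ∀ {r} → ¬ r ≡ 0# → ∀ m → m ≡ (r ⁻¹ · m) · r
    guess-correct r≢0 m = sym (trans (·-comm _ _) (⁻¹-cancelʳ r≢0 m))

  ∑-multiple : ∀ {r} → ¬ r ≡ 0# → ∀ m (f : Carrier → ℤ) →
               ∑F (λ a → ⟦ m ≟ (a · r) ⟧ * f a) ≡ f (r ⁻¹ · m)
  ∑-multiple {r} r≢0 m = 𝔽.∑-unique (λ a → m ≟ (a · r)) (r ⁻¹ · m) (guess r≢0 m) (guess-correct r≢0 m)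

  inverse-nonzero : ∀ {r} → ¬ r ≡ 0# → ¬ r ⁻¹ ≡ 0#
  inverse-nonzero {r} r≢0 e = r≢0 (trans (sym (·-identityʳ r))
    (trans (sym (⁻¹-cancelˡ r≢0 (r · 1#))) (trans (cong (_· (r · (r · 1#))) e) (FieldAlgebra.zeroˡ F _))))

  -- Clears the inverse, so that a correlation is expressed by an equality of products, in which the
  -- two scalars can be regrouped.
  cross-multiply : ∀ {r} → ¬ r ≡ 0# → ∀ r₁ m m₁ →
                   ⟦ m₁ ≟ ((r ⁻¹ · m) · r₁) ⟧ ≡ ⟦ (r₁ · m) ≟ (r · m₁) ⟧
  cross-multiply {r} r≢0 r₁ m m₁ = ⟦⟧-cong _ _
    (λ e → sym (trans (cong (r ·_) e) key))
    (λ e → *-cancelˡ r≢0 (trans (sym e) (sym key)))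
    where
    key : r · ((r ⁻¹ · m) · r₁) ≡ r₁ · m
    key = trans (sym (·-assoc r _ r₁)) (trans (cong (_· r₁) (⁻¹-cancelʳ r≢0 m)) (·-comm m r₁))

  -- After multiplying out, only the product of the two indicators sees m and m₁ jointly: it is
  -- supported at a = m / r and asks whether m₁ / r₁ is the same. The other three terms all equal Q₁
  -- nz(m) nz(m₁) up to sign, and one negative copy remains.
  centred-correlation : ∀ {r r₁} → ¬ r ≡ 0# → ¬ r₁ ≡ 0# → ∀ m m₁ →
    ∑F (λ a → nz a * (d m (a · r) * d m₁ (a · r₁))) ≡
    Q₁ * (Q₁ * (nz m * ⟦ (r₁ · m) ≟ (r · m₁) ⟧) - nz m * nz m₁)
  centred-correlation {r} {r₁} r≢0 r₁≢0 m m₁ = begin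
    ∑F (λ a → nz a * (d m (a · r) * d m₁ (a · r₁)))
      ≡⟨ ∑-cong elems (λ a → pointwise (nz a) Q₁ (α a) (β a) (nz m) (nz m₁)) ⟩
    ∑F (λ a → ((Q₁ * Q₁) * (α a * (nz a * β a)) + (nz m * nz m₁) * nz a)
            - ((Q₁ * nz m₁) * (α a * nz a) + (Q₁ * nz m) * (β a * nz a)))
      ≡⟨ trans (∑-- elems _ _) (cong₂ _-_
           (trans (∑-+ elems _ _) (cong₂ _+_ (∑-*ˡ elems (Q₁ * Q₁) _) (∑-*ˡ elems (nz m * nz m₁) nz)))
           (trans (∑-+ elems _ _) (cong₂ _+_ (∑-*ˡ elems (Q₁ * nz m₁) _) (∑-*ˡ elems (Q₁ * nz m) _)))) ⟩
    ((Q₁ * Q₁) * ∑F (λ a → α a * (nz a * β a)) + (nz m * nz m₁) * ∑F nz)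
            - ((Q₁ * nz m₁) * ∑F (λ a → α a * nz a) + (Q₁ * nz m) * ∑F (λ a → β a * nz a))
      ≡⟨ cong₂ _-_
           (cong₂ _+_ (cong ((Q₁ * Q₁) *_) (trans (∑-multiple r≢0 m (λ a → nz a * β a))
                         (cong₂ _*_ (nz-scale (inverse-nonzero r≢0) m) (cross-multiply r≢0 r₁ m m₁))))
                      (cong ((nz m * nz m₁) *_) ∑F-nz))
           (cong₂ _+_ (cong ((Q₁ * nz m₁) *_) (trans (∑-multiple r≢0 m nz) (nz-scale (inverse-nonzero r≢0) m)))
                      (cong ((Q₁ * nz m) *_) (trans (∑-multiple r₁≢0 m₁ nz) (nz-scale (inverse-nonzero r₁≢0) m₁)))) ⟩
    ((Q₁ * Q₁) * (nz m * ε) + (nz m * nz m₁) * Q₁) - ((Q₁ * nz m₁) * nz m + (Q₁ * nz m) * nz m₁)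
      ≡⟨ collect Q₁ (nz m) (nz m₁) ε ⟩
    Q₁ * (Q₁ * (nz m * ε) - nz m * nz m₁) ∎
    where
    open ≡-Reasoning
    α β : Carrier → ℤ
    α a = ⟦ m ≟ (a · r) ⟧
    β a = ⟦ m₁ ≟ (a · r₁) ⟧
    ε : ℤ
    ε = ⟦ (r₁ · m) ≟ (r · m₁) ⟧
    pointwise : ∀ n q a b m m₁ → n * ((q * a - m) * (q * b - m₁)) ≡
      ((q * q) * (a * (n * b)) + (m * m₁) * n) - ((q * m₁) * (a * n) + (q * m) * (b * n))
    pointwise = solve-∀
    collect : ∀ q m m₁ e → ((q * q) * (m * e) + (m * m₁) * q) - ((q * m₁) * m + (q * m) * m₁) ≡
      q * (q * (m * e) - m * m₁)
    collect = solve-∀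

-- Summing a correlation over all functionals.

module VectorCorrelation (F : FiniteField) (B : V F → V F → FiniteField.Carrier F)
                         (bil : IsBilinear F B) (nd : IsNondegenerate F B) where
  open FiniteSums
  open FieldSums F
  open CentredIndicators F
  open BilinearForms F B bil
  open IsBilinear bil
  open IsNondegenerate nd
  open FieldAlgebra F using (Carrier; elems; _≟_; 0#; *-zero⇒; difference-zero;
    -‿distribˡ-*) renaming (_*_ to _·_; _+_ to _⊕_; -_ to ⊖_; -‿inverseʳ to ⊖-inverseʳ;
    zeroʳ to ·-zeroʳ)
  open import Data.Integer using (ℤ; +_; 0ℤ; 1ℤ; _+_; _*_; _-_; _≤_; +≤+)
  open import Data.Integer.Properties using (+-identityʳ; *-identityˡ; ≤-trans; ≤-reflexive)
  open import Data.Integer.Tactic.RingSolver using (solve-∀)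
  open import Data.Nat using (z≤n)
  open import Data.Product using (_,_; proj₁; proj₂)
  open import Relation.Binary.PropositionalEquality

  Q-nonneg : 0ℤ ≤ Q
  Q-nonneg = +≤+ z≤n

  infix 4 _≟V_
  _≟V_ : (x y : V F) → Dec (x ≡ y)
  _≟V_ = 𝕍._≟_

  combination-zero : ∀ v r y r₁ y₁ → B v (_+V_ F (r₁ • y) ((⊖ r) • y₁)) ≡ (r₁ · B v y) ⊕ (⊖ (r · B v y₁))
  combination-zero v r y r₁ y₁ = trans (addʳ v (r₁ • y) ((⊖ r) • y₁))
    (cong₂ _⊕_ (smulʳ r₁ v y) (trans (smulʳ (⊖ r) v y₁) (sym (-‿distribˡ-* r _))))

  module _ {r r₁} (r≢0 : ¬ r ≡ 0#) (r₁≢0 : ¬ r₁ ≡ 0#) {y y₁} (y≢0 : ¬ y ≡ 0V F) (y₁≢0 : ¬ y₁ ≡ 0V F) where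
    private
      ε : V F → ℤ
      ε v = ⟦ (r₁ · B v y) ≟ (r · B v y₁) ⟧
      zz : V F → ℤ
      zz v = z (B v y) * z (B v y₁)
      Z : ℤ
      Z = ∑V zz

      -- When r₁ m = r m₁ with nonzero scalars, m and m₁ vanish together; requiring m ≠ 0 therefore
      -- removes exactly the common zeros.
      nz-ε : ∀ v → nz (B v y) * ε v ≡ ε v - zz v
      nz-ε v with B v y ≟ 0# | B v y₁ ≟ 0#
      ... | yes m≡0 | yes m₁≡0 rewrite m≡0 | m₁≡0 =
            trans refl (cong (_- 1ℤ) (sym (⟦⟧-true ((r₁ · 0#) ≟ (r · 0#)) (trans (·-zeroʳ r₁) (sym (·-zeroʳ r))))))
      ... | yes m≡0 | no m₁≢0 rewrite m≡0 =
            sym (trans (+-identityʳ _) (⟦⟧-false ((r₁ · 0#) ≟ (r · B v y₁)) (λ e → m₁≢0 (*-zero⇒ r≢0 (trans (sym e) (·-zeroʳ r₁))))))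
      ... | no m≢0 | _ = trans (*-identityˡ _) (sym (+-identityʳ _))

      1≤Z : 1ℤ ≤ Z
      1≤Z = subst (_≤ Z) (𝕍.∑-unique₁ (_≟V 0V F) (0V F) (λ _ e → e) refl) (∑-mono (allPoints F) at-zero)
        where
        at-zero : ∀ v → ⟦ v ≟V 0V F ⟧ ≤ zz v
        at-zero v with v ≟V 0V F
        ... | yes refl = ≤-reflexive (sym (cong₂ _*_ (⟦⟧-true (B (0V F) y ≟ 0#) (zero-left y)) (⟦⟧-true (B (0V F) y₁ ≟ 0#) (zero-left y₁))))
        ... | no _ = *-nonneg (⟦⟧-nonneg (B v y ≟ 0#)) (⟦⟧-nonneg (B v y₁ ≟ 0#))

      -- By inclusion and exclusion, Q * Q - Q - Q + Z vectors v lie in neither of the two kernels.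
      ∑-correlation : ∑V (λ v → ∑F (λ a → nz a * (d (B v y) (a · r) * d (B v y₁) (a · r₁)))) ≡
                      Q₁ * (Q₁ * (∑V ε - Z) - (((Q * Q - Q) - Q) + Z))
      ∑-correlation = begin
        ∑V (λ v → ∑F (λ a → nz a * (d (B v y) (a · r) * d (B v y₁) (a · r₁))))
          ≡⟨ ∑-cong (allPoints F) (λ v → trans (centred-correlation r≢0 r₁≢0 (B v y) (B v y₁))
               (cong (Q₁ *_) (cong₂ _-_ (cong (Q₁ *_) (nz-ε v))
                 (trans (cong₂ _*_ (nz≡1-z (B v y)) (nz≡1-z (B v y₁))) (expand (z (B v y)) (z (B v y₁))))))) ⟩
        ∑V (λ v → Q₁ * (Q₁ * (ε v - zz v) - (((1ℤ - z (B v y)) - z (B v y₁)) + zz v)))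
          ≡⟨ trans (∑-*ˡ (allPoints F) Q₁ _) (cong (Q₁ *_) (trans (∑-- (allPoints F) _ _) (cong₂ _-_
               (trans (∑-*ˡ (allPoints F) Q₁ _) (cong (Q₁ *_) (∑-- (allPoints F) ε zz)))
               (trans (∑-+ (allPoints F) _ zz) (cong (_+ Z) (trans (∑-- (allPoints F) _ _) (cong₂ _-_
                 (trans (∑-- (allPoints F) _ _) (cong₂ _-_ ∑V-one (kernel-card rightRad y≢0)))
                 (kernel-card rightRad y₁≢0)))))))) ⟩
        Q₁ * (Q₁ * (∑V ε - Z) - (((Q * Q - Q) - Q) + Z)) ∎
        where
        open ≡-Reasoning
        expand : ∀ a b → (1ℤ - a) * (1ℤ - b) ≡ ((1ℤ - a) - b) + a * b
        expand = solve-∀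

      -- The vector r₁ y - r y₁: the ratio condition on v says that v lies in the kernel of B(·, D).
      D : V F
      D = _+V_ F (r₁ • y) ((⊖ r) • y₁)

    -- When r₁ y ≠ r y₁ the left-hand side is (q − 1) q (1 − Z), with Z ≥ 1 the number of common zeros of
    -- B(·,y) and B(·,y₁).
    correlation-bound : ∑V (λ v → ∑F (λ a → nz a * (d (B v y) (a · r) * d (B v y₁) (a · r₁)))) ≤
                        Q₁ * ((Q * (Q * Q)) * ⟦ (r₁ • y) ≟V (r • y₁) ⟧)
    correlation-bound = subst (_≤ Q₁ * ((Q * (Q * Q)) * ⟦ (r₁ • y) ≟V (r • y₁) ⟧)) (sym ∑-correlation) (*-mono-≤-nonnegˡ Q₁-nonneg bound)
      where
      bound : Q₁ * (∑V ε - Z) - (((Q * Q - Q) - Q) + Z) ≤ (Q * (Q * Q)) * ⟦ (r₁ • y) ≟V (r • y₁) ⟧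
      bound with (r₁ • y) ≟V (r • y₁)
      -- Here every v satisfies the ratio condition, so `∑V ε` is Q * Q, and the left side falls
      -- short of Q³ by 2 Q Q₁ + Q Z.
      ... | yes eq = ≤-by-difference ((Q * Q₁ + Q * Q₁) + Q * Z)
              (+-nonneg (+-nonneg (*-nonneg Q-nonneg Q₁-nonneg) (*-nonneg Q-nonneg Q₁-nonneg))
                        (*-nonneg Q-nonneg (≤-trans (+≤+ z≤n) 1≤Z)))
              (trans (identity Q Z) (cong (λ s → (Q₁ * (s - Z) - (((Q * Q - Q) - Q) + Z)) + ((Q * Q₁ + Q * Q₁) + Q * Z))
                (sym ∑ε)))
        where
        ∑ε : ∑V ε ≡ Q * Q
        ∑ε = trans (∑-cong (allPoints F) (λ v → ⟦⟧-true _
               (trans (sym (smulʳ r₁ v y)) (trans (cong (B v) eq) (smulʳ r v y₁))))) ∑V-one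
        identity : ∀ Q Z → (Q * (Q * Q)) * 1ℤ ≡
          ((Q - 1ℤ) * (Q * Q - Z) - (((Q * Q - Q) - Q) + Z)) + ((Q * (Q - 1ℤ) + Q * (Q - 1ℤ)) + Q * Z)
        identity = solve-∀
      ... | no neq = ≤-by-difference (Q * (Z - 1ℤ)) (*-nonneg Q-nonneg (difference-nonneg 1≤Z))
              (trans (identity Q Z) (cong (λ s → (Q₁ * (s - Z) - (((Q * Q - Q) - Q) + Z)) + Q * (Z - 1ℤ)) (sym ∑ε)))
        where
        D≢0 : ¬ D ≡ 0V F
        D≢0 e = neq (cong₂ _,_ (equal (cong proj₁ e)) (equal (cong proj₂ e)))
          where
          equal : ∀ {a b} → ((r₁ · a) ⊕ ((⊖ r) · b)) ≡ 0# → r₁ · a ≡ r · b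
          equal {a} {b} e = difference-zero (r₁ · a) (r · b) (trans (cong ((r₁ · a) ⊕_) (-‿distribˡ-* r b)) e)
        ∑ε : ∑V ε ≡ Q
        ∑ε = trans (∑-cong (allPoints F) (λ v → ⟦⟧-cong _ _
               (λ e → trans (combination-zero v r y r₁ y₁)
                        (trans (cong (_⊕ (⊖ (r · B v y₁))) e) (⊖-inverseʳ _)))
               (λ e → difference-zero _ _ (trans (sym (combination-zero v r y r₁ y₁)) e))))
             (kernel-card rightRad D≢0)
        identity : ∀ Q Z → (Q * (Q * Q)) * 0ℤ ≡
          ((Q - 1ℤ) * (Q - Z) - (((Q * Q - Q) - Q) + Z)) + Q * (Z - 1ℤ)
        identity = solve-∀

-- Rearrangement of multiple sums with weights.

module SumManipulations where
  open FiniteSums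
  open import Data.Integer using (ℤ; 0ℤ; 1ℤ; _*_; _≤_)
  open import Data.Integer.Properties
  open import Data.Integer.Tactic.RingSolver using (solve-∀)
  open import Data.List using (List; cartesianProduct)
  open import Data.Product using (_×_; _,_; proj₁; proj₂)
  open import Data.Empty using (⊥-elim)
  open import Relation.Binary.PropositionalEquality

  private variable
    A C D : Set
    P R : Set

  ∑-weighted-product : (xs : List A) (ys : List C) (zs : List D)
    (ω : C → ℤ) (f : C → A → ℤ) (ω′ : D → ℤ) (f′ : D → A → ℤ) →
    ∑[ x ∈ xs ] (∑[ y ∈ ys ] ω y * f y x) * (∑[ z ∈ zs ] ω′ z * f′ z x) ≡
    ∑[ y ∈ ys ] ∑[ z ∈ zs ] (ω y * ω′ z) * (∑[ x ∈ xs ] f y x * f′ z x)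
  ∑-weighted-product xs ys zs ω f ω′ f′ = begin
    ∑[ x ∈ xs ] (∑[ y ∈ ys ] ω y * f y x) * (∑[ z ∈ zs ] ω′ z * f′ z x)
      ≡⟨ ∑-cong xs (λ x → sym (∑-* ys zs (λ y → ω y * f y x) (λ z → ω′ z * f′ z x))) ⟩
    ∑[ x ∈ xs ] ∑[ y ∈ ys ] ∑[ z ∈ zs ] (ω y * f y x) * (ω′ z * f′ z x)
      ≡⟨ ∑-swap xs ys _ ⟩
    ∑[ y ∈ ys ] ∑[ x ∈ xs ] ∑[ z ∈ zs ] (ω y * f y x) * (ω′ z * f′ z x)
      ≡⟨ ∑-cong ys (λ y → trans (∑-swap xs zs _) (∑-cong zs (λ z → trans
           (∑-cong xs (λ x → interchange (ω y) (f y x) (ω′ z) (f′ z x)))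
           (∑-*ˡ xs (ω y * ω′ z) _)))) ⟩
    ∑[ y ∈ ys ] ∑[ z ∈ zs ] (ω y * ω′ z) * (∑[ x ∈ xs ] f y x * f′ z x) ∎
    where
    open ≡-Reasoning
    interchange : ∀ a b c d → (a * b) * (c * d) ≡ (a * c) * (b * d)
    interchange = solve-∀

  -- Both sides run over all (j, y, j′, y′), and j is transposed with j′. With j a pair of scalars
  -- (r , t), this is the trade of scalars between two directions.
  ∑-exchange : (js : List A) (ys : List C) (Φ : A × C → A × C → ℤ) →
    ∑[ i ∈ cartesianProduct js ys ] ∑[ i′ ∈ cartesianProduct js ys ] Φ i i′ ≡
    ∑[ i ∈ cartesianProduct js ys ] ∑[ i′ ∈ cartesianProduct js ys ]
      Φ (proj₁ i′ , proj₂ i) (proj₁ i , proj₂ i′)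
  ∑-exchange js ys Φ = begin
    ∑[ i ∈ cartesianProduct js ys ] ∑[ i′ ∈ cartesianProduct js ys ] Φ i i′
      ≡⟨ expand Φ ⟩
    ∑[ j ∈ js ] ∑[ y ∈ ys ] ∑[ j′ ∈ js ] ∑[ y′ ∈ ys ] Φ (j , y) (j′ , y′)
      ≡⟨ ∑-cong js (λ j → ∑-swap ys js _) ⟩
    ∑[ j ∈ js ] ∑[ j′ ∈ js ] ∑[ y ∈ ys ] ∑[ y′ ∈ ys ] Φ (j , y) (j′ , y′)
      ≡⟨ ∑-swap js js _ ⟩
    ∑[ j′ ∈ js ] ∑[ j ∈ js ] ∑[ y ∈ ys ] ∑[ y′ ∈ ys ] Φ (j , y) (j′ , y′)
      ≡⟨ ∑-cong js (λ j′ → ∑-swap js ys _) ⟩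
    ∑[ j′ ∈ js ] ∑[ y ∈ ys ] ∑[ j ∈ js ] ∑[ y′ ∈ ys ] Φ (j , y) (j′ , y′)
      ≡⟨ sym (expand (λ i i′ → Φ (proj₁ i′ , proj₂ i) (proj₁ i , proj₂ i′))) ⟩
    ∑[ i ∈ cartesianProduct js ys ] ∑[ i′ ∈ cartesianProduct js ys ]
      Φ (proj₁ i′ , proj₂ i) (proj₁ i , proj₂ i′) ∎
    where
    open ≡-Reasoning
    expand : (Ψ : _ → _ → ℤ) →
      ∑[ i ∈ cartesianProduct js ys ] ∑[ i′ ∈ cartesianProduct js ys ] Ψ i i′ ≡
      ∑[ j ∈ js ] ∑[ y ∈ ys ] ∑[ j′ ∈ js ] ∑[ y′ ∈ ys ] Ψ (j , y) (j′ , y′)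
    expand Ψ = trans (∑-cartesianProduct js ys _)
      (∑-cong js (λ j → ∑-cong ys (λ y → ∑-cartesianProduct js ys _)))

  -- Lets an identity be checked only on the support of the weights, where the scalars are known to
  -- be nonzero.
  guarded-≡ : (D : Dec P) (E : Dec R) → (P → R) → (R → P) → ∀ {a b} → (P → a ≡ b) →
              ⟦ D ⟧ * a ≡ ⟦ E ⟧ * b
  guarded-≡ (yes p) (yes _) f g eq = cong (1ℤ *_) (eq p)
  guarded-≡ (yes p) (no ¬r) f g eq = ⊥-elim (¬r (f p))
  guarded-≡ (no ¬p) (yes r) f g eq = ⊥-elim (¬p (g r))
  guarded-≡ (no _)  (no _)  f g eq = refl

  -- The second weight may be discarded because b ≥ 0; it still supplies its proof to the inequality
  -- a ≤ b.
  guarded-≤ : (D : Dec P) (E : Dec R) → ∀ {a b} → 0ℤ ≤ b → (P → R → a ≤ b) →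
              (⟦ D ⟧ * ⟦ E ⟧) * a ≤ ⟦ D ⟧ * b
  guarded-≤ (yes p) (yes r) {a} {b} 0≤b le = subst₂ _≤_ (sym (*-identityˡ a)) (sym (*-identityˡ b)) (le p r)
  guarded-≤ (yes p) (no _)  {a} {b} 0≤b le = subst (0ℤ ≤_) (sym (*-identityˡ b)) 0≤b
  guarded-≤ (no _)  _               0≤b le = ≤-refl

  ∑-factor₃ : (as : List A) (bs : List C) (cs : List D) (α α′ : A → ℤ) (β β′ : C → ℤ) (γ γ′ : D → ℤ) →
    ∑ (cartesianProduct as (cartesianProduct bs cs))
      (λ { (a , b , c) → (α a * (β b * γ c)) * (α′ a * (β′ b * γ′ c)) }) ≡
    (∑[ a ∈ as ] α a * α′ a) * ((∑[ b ∈ bs ] β b * β′ b) * (∑[ c ∈ cs ] γ c * γ′ c))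
  ∑-factor₃ as bs cs α α′ β β′ γ γ′ = begin
    _ ≡⟨ trans (∑-cartesianProduct as (cartesianProduct bs cs) _)
               (∑-cong as (λ a → ∑-cartesianProduct bs cs _)) ⟩
    ∑[ a ∈ as ] ∑[ b ∈ bs ] ∑[ c ∈ cs ] (α a * (β b * γ c)) * (α′ a * (β′ b * γ′ c))
      ≡⟨ ∑-cong as (λ a → trans
           (∑-cong bs (λ b → trans
             (∑-cong cs (λ c → rearrange (α a) (β b) (γ c) (α′ a) (β′ b) (γ′ c)))
             (∑-*ˡ cs (α a * α′ a) _)))
           (trans (∑-*ˡ bs (α a * α′ a) _) (cong ((α a * α′ a) *_) (∑-* bs cs _ _)))) ⟩
    ∑[ a ∈ as ] (α a * α′ a) * ((∑[ b ∈ bs ] β b * β′ b) * (∑[ c ∈ cs ] γ c * γ′ c))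
      ≡⟨ ∑-*ʳ as _ _ ⟩
    (∑[ a ∈ as ] α a * α′ a) * ((∑[ b ∈ bs ] β b * β′ b) * (∑[ c ∈ cs ] γ c * γ′ c)) ∎
    where
    open ≡-Reasoning
    rearrange : ∀ a b c a′ b′ c′ → (a * (b * c)) * (a′ * (b′ * c′)) ≡ (a * a′) * ((b * b′) * (c * c′))
    rearrange = solve-∀

-- The square sum of the deviation.

module Deviation (F : FiniteField) (B : V F → V F → FiniteField.Carrier F)
                 (bil : IsBilinear F B) (nd : IsNondegenerate F B)
                 where
  open FiniteSums
  open SumManipulations
  open FieldSums F
  open CentredIndicators F
  open IsBilinear bil
  open VectorCorrelation F B bil nd using (Q-nonneg; _≟V_; correlation-bound)
  open FieldAlgebra F using (Carrier; elems; _≟_; 0#; 1#; 0≢1; _⁻¹; ⁻¹-cancelˡ; ⁻¹-cancelʳ;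
    *-cancelˡ; *-nonzero; *-swapˡ; square-roots) renaming (_*_ to _·_; -_ to ⊖_; zeroʳ to ·-zeroʳ;
    zeroˡ to ·-zeroˡ; *-assoc to ·-assoc; *-comm to ·-comm; *-identityˡ to ·-identityˡ;
    *-identityʳ to ·-identityʳ)
  open import Data.Integer using (ℤ; +_; 0ℤ; 1ℤ; _+_; _*_; _-_; _≤_)
  open import Data.Integer.Properties using (+-comm; *-identityˡ; *-identityʳ; *-comm; *-zeroʳ;
    ≤-reflexive; module ≤-Reasoning)
  open import Data.Integer.Tactic.RingSolver using (solve-∀)
  open import Data.List using (List; cartesianProduct)
  open import Data.Product using (_×_; _,_; proj₁; proj₂)
  open import Data.Sum using (inj₁; inj₂)
  open import Relation.Nullary.Decidable using (¬?; _×-dec_)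
  open import Relation.Binary.PropositionalEquality

  0•v : ∀ v → 0# • v ≡ 0V F
  0•v (a , b) = cong₂ _,_ (·-zeroˡ a) (·-zeroˡ b)

  -- Every nonzero r permutes the plane, and r = 0 contributes only values G(0) = 0. All vectors v
  -- can thus stand in for representatives of lines, at the price of the factor Q₁.
  ∑-dilations : (G : V F → ℤ) → G (0V F) ≡ 0ℤ → ∑V (λ v → ∑F (λ r → G (r • v))) ≡ Q₁ * ∑V G
  ∑-dilations G G0 = begin
    ∑V (λ v → ∑F (λ r → G (r • v)))   ≡⟨ ∑-swap (allPoints F) elems _ ⟩
    ∑F (λ r → ∑V (λ v → G (r • v)))   ≡⟨ ∑-cong elems dilate ⟩
    ∑F (λ r → nz r * ∑V G)            ≡⟨ ∑-*ʳ elems (∑V G) nz ⟩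
    ∑F nz * ∑V G                      ≡⟨ cong (_* ∑V G) ∑F-nz ⟩
    Q₁ * ∑V G ∎
    where
    open ≡-Reasoning
    dilate : ∀ r → ∑V (λ v → G (r • v)) ≡ nz r * ∑V G
    dilate r with r ≟ 0#
    ... | yes refl = trans (∑-cong (allPoints F) (λ v → trans (cong G (0•v v)) G0)) (∑-zero (allPoints F))
    ... | no r≢0   = trans (∑V-scale r≢0 G) (sym (*-identityˡ _))

  module Slices (W : V F → Set) (W? : ∀ x → Dec (W x)) (0∉W : ¬ W (0V F)) (u : V F) where

    θ φ : V F → Carrier
    θ x = B u x
    φ y = B y u

    X? : ∀ x → Dec (W x × ¬ θ x ≡ 0#)
    X? x = W? x ×-dec ¬? (θ x ≟ 0#)

    Y? : ∀ y → Dec (W y × ¬ φ y ≡ 0#)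
    Y? y = W? y ×-dec ¬? (φ y ≟ 0#)

    Ω? : ∀ x t y → Dec (((W x × ¬ θ x ≡ 0#) × W (t • u)) × (W y × ¬ φ y ≡ 0#))
    Ω? x t y = (X? x ×-dec W? (t • u)) ×-dec Y? y

    wx wy : V F → ℤ
    wx x = ⟦ X? x ⟧
    wy y = ⟦ Y? y ⟧

    k : Carrier → ℤ
    k t = ⟦ W? (t • u) ⟧

    ω≡ : ∀ x t y → ⟦ Ω? x t y ⟧ ≡ (wx x * k t) * wy y
    ω≡ x t y = sym (trans (cong (_* wy y) (⟦⟧-× (X? x) (W? (t • u)))) (⟦⟧-× (X? x ×-dec W? (t • u)) (Y? y)))

    -- The third vertex of the triangle is z = t u, so B y z = t (φ y) and B z x = t (θ x).
    deviation : Triple F → ℤ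
    deviation (a , b , c) = ∑V (λ x → ∑F (λ t → ∑V (λ y →
      ⟦ Ω? x t y ⟧ * ((nz a * d (B x y) a) * (⟦ (t · φ y) ≟ b ⟧ * ⟦ (t · θ x) ≟ c ⟧)))))

    private
      Index : Set
      Index = (Carrier × Carrier) × V F

      pairs : List (Carrier × Carrier)
      pairs = cartesianProduct elems elems

      indices : List Index
      indices = cartesianProduct pairs (allPoints F)

      ∑-triples : (G : Triple F → ℤ) → ∑ (allTriples F) G ≡ ∑F (λ a → ∑F (λ b → ∑F (λ c → G (a , b , c))))
      ∑-triples G = trans (∑-cartesianProduct elems (cartesianProduct elems elems) G)
        (∑-cong elems (λ a → ∑-cartesianProduct elems elems (λ bc → G (a , bc))))

      ∑-indices : (G : Index → ℤ) → ∑ indices G ≡ ∑F (λ r → ∑F (λ t → ∑V (λ y → G ((r , t) , y))))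
      ∑-indices G = trans (∑-cartesianProduct pairs (allPoints F) G) (∑-cartesianProduct elems elems _)

      weight? : ∀ v (i : Index) → Dec _
      weight? v ((r , t) , y) = Ω? (r • v) t y

      ω : V F → Index → ℤ
      ω v i = ⟦ weight? v i ⟧

      f : V F → Index → Triple F → ℤ
      f v ((r , t) , y) (a , b , c) =
        (nz a * d (B (r • v) y) a) * (⟦ (t · φ y) ≟ b ⟧ * ⟦ (t · θ (r • v)) ≟ c ⟧)

      h : V F → Index → Triple F → ℤ
      h v ((r , t) , y) (a , b , γ) =
        (nz a * d (B v y) (a · r)) * (⟦ φ y ≟ (b · t) ⟧ * ⟦ (t · r) ≟ γ ⟧)

      -- The coordinate c = t r θ(v) is split between the two factors of a product as
      -- t r = γ θ(v′) and t′ r′ = γ θ(v).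
      hθ : V F → Index → Triple F → ℤ
      hθ v i (a , b , γ) = h v i (a , b , γ · θ v)

      -- `K` drops the scale θ v from the third coordinate. Then v enters only through `B v y`,
      -- while the weights depend on v′, so v can be summed over the whole plane.
      K Kθ : V F → V F → Triple F → ℤ
      K  v v′ s = ∑[ i ∈ indices ] ω v′ i * h v i s
      Kθ v v′ s = ∑[ i ∈ indices ] ω v′ i * hθ v i s

      dilated-deviation : ∀ s → ∑V (λ v → ∑[ i ∈ indices ] ω v i * f v i s) ≡ Q₁ * deviation s
      dilated-deviation (a , b , c) = trans
        (∑-cong (allPoints F) (λ v → ∑-indices (λ i → ω v i * f v i (a , b , c))))
        (∑-dilations G (trans (∑-cong elems (λ t → trans (∑-cong (allPoints F) (λ y →
            cong (_* ((nz a * d (B (0V F) y) a) * (⟦ (t · φ y) ≟ b ⟧ * ⟦ (t · θ (0V F)) ≟ c ⟧)))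
              (⟦⟧-false (Ω? (0V F) t y) (λ p → 0∉W (proj₁ (proj₁ (proj₁ p)))))))
            (∑-zero (allPoints F)))) (∑-zero elems)))
        where
        G : V F → ℤ
        G x = ∑F (λ t → ∑V (λ y →
          ⟦ Ω? x t y ⟧ * ((nz a * d (B x y) a) * (⟦ (t · φ y) ≟ b ⟧ * ⟦ (t · θ x) ≟ c ⟧))))

      θ-scale : ∀ r v → θ (r • v) ≡ r · θ v
      θ-scale r v = smulʳ r u v

      -- The support conditions in the form needed for cancellation: r = 0 or θ v = 0 would give θ
      -- (r • v) = 0, and t = 0 or y = 0 would put the origin in `W`.
      record Nonzero (v : V F) (i : Index) : Set where
        field
          r≢0 : ¬ proj₁ (proj₁ i) ≡ 0#
          t≢0 : ¬ proj₂ (proj₁ i) ≡ 0#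
          θ≢0 : ¬ θ v ≡ 0#
          φ≢0 : ¬ φ (proj₂ i) ≡ 0#
          y≢0 : ¬ proj₂ i ≡ 0V F

      nonzero : ∀ v r t y → ((W (r • v) × ¬ θ (r • v) ≡ 0#) × W (t • u)) × (W y × ¬ φ y ≡ 0#) →
                Nonzero v ((r , t) , y)
      nonzero v r t y (((_ , θ≢0) , Wtu) , (Wy , φ≢0)) = record
        { r≢0 = λ { refl → θ≢0 (trans (θ-scale 0# v) (·-zeroˡ _)) }
        ; t≢0 = λ { refl → 0∉W (subst W (0•v u) Wtu) }
        ; θ≢0 = λ e → θ≢0 (trans (θ-scale r v) (trans (cong (r ·_) e) (·-zeroʳ r)))
        ; φ≢0 = φ≢0
        ; y≢0 = λ { refl → 0∉W Wy }
        }

      nz-product : ∀ (p p′ : Carrier → ℤ) →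
        ∑F (λ a → (nz a * p a) * (nz a * p′ a)) ≡ ∑F (λ a → nz a * (p a * p′ a))
      nz-product p p′ = ∑-cong elems (λ a → trans (rearrange (nz a) (p a) (p′ a)) (cong (_* (p a * p′ a)) (nz-idem a)))
        where
        rearrange : ∀ n p p′ → (n * p) * (n * p′) ≡ (n * n) * (p * p′)
        rearrange = solve-∀

      ∑-point : ∀ m (g : Carrier → ℤ) → ∑F (λ b → ⟦ m ≟ b ⟧ * g b) ≡ g m
      ∑-point m = 𝔽.∑-unique (m ≟_) m (λ _ e → sym e) refl

      -- The three coordinate sums test r m = r′ m′, t φ(y) = t′ φ(y′) and t r θ(v) = t′ r′ θ(v′),
      -- the first together with the nonvanishing of m and m′. As equalities of quotients these pair
      -- m, φ(y) and θ(v) with the primed scalars, and the primed quantities with (r , t).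
      kernel-symmetry : ∀ v v′ r t r′ t′ y y′ →
        Nonzero v ((r , t) , y) → Nonzero v′ ((r′ , t′) , y′) →
        ∑[ s ∈ allTriples F ] f v ((r , t) , y) s * f v′ ((r′ , t′) , y′) s ≡
        ∑[ s ∈ allTriples F ] hθ v ((r′ , t′) , y) s * hθ v′ ((r , t) , y′) s
      kernel-symmetry v v′ r t r′ t′ y y′ n n′ = trans
        (∑-factor₃ elems elems elems
          (λ a → nz a * d (B (r • v) y) a) (λ a → nz a * d (B (r′ • v′) y′) a)
          (λ b → ⟦ (t · φ y) ≟ b ⟧) (λ b → ⟦ (t′ · φ y′) ≟ b ⟧)
          (λ c → ⟦ (t · θ (r • v)) ≟ c ⟧) (λ c → ⟦ (t′ · θ (r′ • v′)) ≟ c ⟧))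
        (trans (cong₂ _*_ a-part (cong₂ _*_ b-part c-part))
               (sym (∑-factor₃ elems elems elems
                 (λ a → nz a * d (B v y) (a · r′)) (λ a → nz a * d (B v′ y′) (a · r))
                 (λ b → ⟦ φ y ≟ (b · t′) ⟧) (λ b → ⟦ φ y′ ≟ (b · t) ⟧)
                 (λ γ → ⟦ (t′ · r′) ≟ (γ · θ v) ⟧) (λ γ → ⟦ (t · r) ≟ (γ · θ v′) ⟧))))
        where
        open Nonzero
        open ≡-Reasoning
        m = B v y
        m′ = B v′ y′
        a-part : ∑F (λ a → (nz a * d (B (r • v) y) a) * (nz a * d (B (r′ • v′) y′) a)) ≡
                 ∑F (λ a → (nz a * d m (a · r′)) * (nz a * d m′ (a · r)))
        a-part = begin
          ∑F (λ a → (nz a * d (B (r • v) y) a) * (nz a * d (B (r′ • v′) y′) a))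
            ≡⟨ nz-product (λ a → d (B (r • v) y) a) (λ a → d (B (r′ • v′) y′) a) ⟩
          ∑F (λ a → nz a * (d (B (r • v) y) a * d (B (r′ • v′) y′) a))
            ≡⟨ ∑-cong elems (λ a → cong (nz a *_) (cong₂ _*_
                 (cong₂ d (smulˡ r v y) (sym (·-identityʳ a))) (cong₂ d (smulˡ r′ v′ y′) (sym (·-identityʳ a))))) ⟩
          ∑F (λ a → nz a * (d (r · m) (a · 1#) * d (r′ · m′) (a · 1#)))
            ≡⟨ centred-correlation 1≢0 1≢0 (r · m) (r′ · m′) ⟩
          Q₁ * (Q₁ * (nz (r · m) * ⟦ (1# · (r · m)) ≟ (1# · (r′ · m′)) ⟧) - nz (r · m) * nz (r′ · m′))
            ≡⟨ cong (Q₁ *_) (cong₂ _-_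
                 (cong (Q₁ *_) (cong₂ _*_ (nz-scale (r≢0 n) m)
                   (cong₂ (λ p p′ → ⟦ p ≟ p′ ⟧) (·-identityˡ (r · m)) (·-identityˡ (r′ · m′)))))
                 (cong₂ _*_ (nz-scale (r≢0 n) m) (nz-scale (r≢0 n′) m′))) ⟩
          Q₁ * (Q₁ * (nz m * ⟦ (r · m) ≟ (r′ · m′) ⟧) - nz m * nz m′)
            ≡⟨ sym (centred-correlation (r≢0 n′) (r≢0 n) m m′) ⟩
          ∑F (λ a → nz a * (d m (a · r′) * d m′ (a · r)))
            ≡⟨ sym (nz-product (λ a → d m (a · r′)) (λ a → d m′ (a · r))) ⟩
          ∑F (λ a → (nz a * d m (a · r′)) * (nz a * d m′ (a · r))) ∎
          where
          1≢0 : ¬ 1# ≡ 0#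
          1≢0 e = 0≢1 (sym e)
        b-part : ∑F (λ b → ⟦ (t · φ y) ≟ b ⟧ * ⟦ (t′ · φ y′) ≟ b ⟧) ≡
                 ∑F (λ b → ⟦ φ y ≟ (b · t′) ⟧ * ⟦ φ y′ ≟ (b · t) ⟧)
        b-part = begin
          ∑F (λ b → ⟦ (t · φ y) ≟ b ⟧ * ⟦ (t′ · φ y′) ≟ b ⟧)
            ≡⟨ ∑-point (t · φ y) (λ b → ⟦ (t′ · φ y′) ≟ b ⟧) ⟩
          ⟦ (t′ · φ y′) ≟ (t · φ y) ⟧
            ≡⟨ ⟦⟧-cong ((t′ · φ y′) ≟ (t · φ y)) ((t · φ y) ≟ (t′ · φ y′)) sym sym ⟩
          ⟦ (t · φ y) ≟ (t′ · φ y′) ⟧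
            ≡⟨ sym (cross-multiply (t≢0 n′) t (φ y) (φ y′)) ⟩
          ⟦ φ y′ ≟ ((t′ ⁻¹ · φ y) · t) ⟧
            ≡⟨ sym (∑-multiple (t≢0 n′) (φ y) (λ b → ⟦ φ y′ ≟ (b · t) ⟧)) ⟩
          ∑F (λ b → ⟦ φ y ≟ (b · t′) ⟧ * ⟦ φ y′ ≟ (b · t) ⟧) ∎
        regroup : ∀ t r v → t · θ (r • v) ≡ θ v · (t · r)
        regroup t r v = trans (cong (t ·_) (θ-scale r v)) (trans (sym (·-assoc t r (θ v))) (·-comm (t · r) (θ v)))
        c-part : ∑F (λ c → ⟦ (t · θ (r • v)) ≟ c ⟧ * ⟦ (t′ · θ (r′ • v′)) ≟ c ⟧) ≡
                 ∑F (λ γ → ⟦ (t′ · r′) ≟ (γ · θ v) ⟧ * ⟦ (t · r) ≟ (γ · θ v′) ⟧)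
        c-part = begin
          ∑F (λ c → ⟦ (t · θ (r • v)) ≟ c ⟧ * ⟦ (t′ · θ (r′ • v′)) ≟ c ⟧)
            ≡⟨ ∑-point (t · θ (r • v)) (λ c → ⟦ (t′ · θ (r′ • v′)) ≟ c ⟧) ⟩
          ⟦ (t′ · θ (r′ • v′)) ≟ (t · θ (r • v)) ⟧
            ≡⟨ cong₂ (λ p p′ → ⟦ p ≟ p′ ⟧) (regroup t′ r′ v′) (regroup t r v) ⟩
          ⟦ (θ v′ · (t′ · r′)) ≟ (θ v · (t · r)) ⟧
            ≡⟨ sym (cross-multiply (θ≢0 n) (θ v′) (t′ · r′) (t · r)) ⟩
          ⟦ (t · r) ≟ ((θ v ⁻¹ · (t′ · r′)) · θ v′) ⟧
            ≡⟨ sym (∑-multiple (θ≢0 n) (t′ · r′) (λ γ → ⟦ (t · r) ≟ (γ · θ v′) ⟧)) ⟩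
          ∑F (λ γ → ⟦ (t′ · r′) ≟ (γ · θ v) ⟧ * ⟦ (t · r) ≟ (γ · θ v′) ⟧) ∎

      deviation-as-cross-terms :
        (Q₁ * Q₁) * (∑[ s ∈ allTriples F ] deviation s * deviation s) ≡
        ∑[ s ∈ allTriples F ] ∑V (λ v → ∑V (λ v′ → Kθ v v′ s * Kθ v′ v s))
      deviation-as-cross-terms = begin
        (Q₁ * Q₁) * (∑[ s ∈ allTriples F ] deviation s * deviation s)
          ≡⟨ trans (sym (∑-*ˡ (allTriples F) (Q₁ * Q₁) (λ s → deviation s * deviation s)))
               (∑-cong (allTriples F) (λ s → trans (interchange Q₁ (deviation s))
                 (cong₂ _*_ (sym (dilated-deviation s)) (sym (dilated-deviation s))))) ⟩
        ∑[ s ∈ allTriples F ] ∑V (λ v → A v s) * ∑V (λ v → A v s)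
          ≡⟨ ∑-square-∑ (allTriples F) (allPoints F) (λ s v → A v s) ⟩
        ∑V (λ v → ∑V (λ v′ → ∑[ s ∈ allTriples F ] A v s * A v′ s))
          ≡⟨ ∑-cong (allPoints F) (λ v → ∑-cong (allPoints F) (λ v′ → match v v′)) ⟩
        ∑V (λ v → ∑V (λ v′ → ∑[ s ∈ allTriples F ] Kθ v v′ s * Kθ v′ v s))
          ≡⟨ trans (∑-cong (allPoints F) (λ v → ∑-swap (allPoints F) (allTriples F) _))
                   (∑-swap (allPoints F) (allTriples F) _) ⟩
        ∑[ s ∈ allTriples F ] ∑V (λ v → ∑V (λ v′ → Kθ v v′ s * Kθ v′ v s)) ∎
        where
        open ≡-Reasoning
        A : V F → Triple F → ℤ
        A v s = ∑[ i ∈ indices ] ω v i * f v i s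
        interchange : ∀ q e → (q * q) * (e * e) ≡ (q * e) * (q * e)
        interchange = solve-∀
        match : ∀ v v′ → ∑[ s ∈ allTriples F ] A v s * A v′ s ≡
                         ∑[ s ∈ allTriples F ] Kθ v v′ s * Kθ v′ v s
        match v v′ = begin
          ∑[ s ∈ allTriples F ] A v s * A v′ s
            ≡⟨ ∑-weighted-product (allTriples F) indices indices (ω v) (f v) (ω v′) (f v′) ⟩
          ∑[ i ∈ indices ] ∑[ i′ ∈ indices ] (ω v i * ω v′ i′) * (∑[ s ∈ allTriples F ] f v i s * f v′ i′ s)
            ≡⟨ ∑-cong indices (λ i → ∑-cong indices (λ i′ → exchange i i′)) ⟩
          ∑[ i ∈ indices ] ∑[ i′ ∈ indices ] Φ (proj₁ i′ , proj₂ i) (proj₁ i , proj₂ i′)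
            ≡⟨ sym (∑-exchange pairs (allPoints F) Φ) ⟩
          ∑[ i ∈ indices ] ∑[ i′ ∈ indices ] Φ i i′
            ≡⟨ sym (∑-weighted-product (allTriples F) indices indices (ω v′) (hθ v) (ω v) (hθ v′)) ⟩
          ∑[ s ∈ allTriples F ] Kθ v v′ s * Kθ v′ v s ∎
          where
          Φ : Index → Index → ℤ
          Φ i i′ = (ω v′ i * ω v i′) * (∑[ s ∈ allTriples F ] hθ v i s * hθ v′ i′ s)
          exchange : ∀ i i′ → (ω v i * ω v′ i′) * (∑[ s ∈ allTriples F ] f v i s * f v′ i′ s) ≡
                              Φ (proj₁ i′ , proj₂ i) (proj₁ i , proj₂ i′)
          exchange ((r , t) , y) ((r′ , t′) , y′) = begin
            (⟦ Ω? (r • v) t y ⟧ * ⟦ Ω? (r′ • v′) t′ y′ ⟧) * L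
              ≡⟨ cong (_* L) (⟦⟧-× (Ω? (r • v) t y) (Ω? (r′ • v′) t′ y′)) ⟩
            ⟦ Ω? (r • v) t y ×-dec Ω? (r′ • v′) t′ y′ ⟧ * L
              -- The condition on y is separate from those on (r • v, t), so the joint support
              -- survives the exchange of (r , t) with (r′ , t′).
              ≡⟨ guarded-≡ (Ω? (r • v) t y ×-dec Ω? (r′ • v′) t′ y′)
                           (Ω? (r′ • v′) t′ y ×-dec Ω? (r • v) t y′)
                           (λ { ((p , q) , (p′ , q′)) → (p′ , q) , (p , q′) })
                           (λ { ((p′ , q) , (p , q′)) → (p , q) , (p′ , q′) })
                           (λ { (p , p′) → kernel-symmetry v v′ r t r′ t′ y y′
                                  (nonzero v r t y p) (nonzero v′ r′ t′ y′ p′) }) ⟩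
            ⟦ Ω? (r′ • v′) t′ y ×-dec Ω? (r • v) t y′ ⟧ * R
              ≡⟨ cong (_* R) (sym (⟦⟧-× (Ω? (r′ • v′) t′ y) (Ω? (r • v) t y′))) ⟩
            (⟦ Ω? (r′ • v′) t′ y ⟧ * ⟦ Ω? (r • v) t y′ ⟧) * R ∎
            where
            L R : ℤ
            L = ∑[ s ∈ allTriples F ] f v ((r , t) , y) s * f v′ ((r′ , t′) , y′) s
            R = ∑[ s ∈ allTriples F ] hθ v ((r′ , t′) , y) s * hθ v′ ((r , t) , y′) s

      -- For θ v ≠ 0 the substitution of γ θ v for γ permutes the field. For θ v = 0 the left side
      -- is zero, since it would require t r = 0 on the support.
      unscaled-square : ∀ v v′ →
        ∑[ s ∈ allTriples F ] Kθ v v′ s * Kθ v v′ s ≤ ∑[ s ∈ allTriples F ] K v v′ s * K v v′ s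
      unscaled-square v v′ with θ v ≟ 0#
      ... | no θ≢0 = ≤-reflexive (begin
        ∑[ s ∈ allTriples F ] Kθ v v′ s * Kθ v v′ s
          ≡⟨ ∑-triples (λ s → Kθ v v′ s * Kθ v v′ s) ⟩
        ∑F (λ a → ∑F (λ b → ∑F (λ γ → K v v′ (a , b , γ · θ v) * K v v′ (a , b , γ · θ v))))
          ≡⟨ ∑-cong elems (λ a → ∑-cong elems (λ b → trans
               (∑-cong elems (λ γ → cong (λ c → K v v′ (a , b , c) * K v v′ (a , b , c)) (·-comm γ (θ v))))
               (∑F-scale θ≢0 (λ c → K v v′ (a , b , c) * K v v′ (a , b , c))))) ⟩
        ∑F (λ a → ∑F (λ b → ∑F (λ γ → K v v′ (a , b , γ) * K v v′ (a , b , γ))))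
          ≡⟨ sym (∑-triples (λ s → K v v′ s * K v v′ s)) ⟩
        ∑[ s ∈ allTriples F ] K v v′ s * K v v′ s ∎)
        where
        open ≡-Reasoning
      ... | yes θ≡0 = ∑-mono (allTriples F) (λ s →
              subst (_≤ K v v′ s * K v v′ s) (sym (cong₂ _*_ (vanish s) (vanish s))) (square-nonneg (K v v′ s)))
        where
        vanish : ∀ s → Kθ v v′ s ≡ 0ℤ
        vanish (a , b , γ) = trans (∑-cong indices term) (∑-zero indices)
          where
          term : ∀ i → ω v′ i * hθ v i (a , b , γ) ≡ 0ℤ
          term ((r , t) , y) with Ω? (r • v′) t y
          ... | no _  = refl
          ... | yes p = trans (*-identityˡ _) (trans (cong (p₁ *_)
                  (trans (cong (p₂ *_) (⟦⟧-false ((t · r) ≟ (γ · θ v)) tr≢)) (*-zeroʳ p₂))) (*-zeroʳ p₁))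
            where
            p₁ p₂ : ℤ
            p₁ = nz a * d (B v y) (a · r)
            p₂ = ⟦ φ y ≟ (b · t) ⟧
            tr≢ : ¬ t · r ≡ γ · θ v
            tr≢ e = *-nonzero (Nonzero.t≢0 n) (Nonzero.r≢0 n) (trans e (trans (cong (γ ·_) θ≡0) (·-zeroʳ γ)))
              where
              n : Nonzero v′ ((r , t) , y)
              n = nonzero v′ r t y p

      -- Equal scaled values r₁ y = r y₁ together with equal products t₁ r₁ = t r force r₁² = r², so each
      -- index has at most two partners.
      matches : Index → Index → ℤ
      matches ((r , t) , y) ((r₁ , t₁) , y₁) =
        (⟦ r₁ ≟ r ⟧ + ⟦ r₁ ≟ (⊖ r) ⟧) * (⟦ t₁ ≟ ((r ⁻¹ · r₁) · t) ⟧ * ⟦ y₁ ≟V ((r ⁻¹ · r₁) • y) ⟧)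

      -- Given r₁, both t₁ and y₁ are determined. The roots r and - r are counted separately even
      -- when they coincide, so the total is 2 in every characteristic.
      ∑-matches : ∀ i → ∑ indices (matches i) ≡ + 2
      ∑-matches ((r , t) , y) = begin
        ∑ indices (matches ((r , t) , y))
          ≡⟨ ∑-indices (matches ((r , t) , y)) ⟩
        ∑F (λ r₁ → ∑F (λ t₁ → ∑V (λ y₁ → matches ((r , t) , y) ((r₁ , t₁) , y₁))))
          ≡⟨ ∑-cong elems (λ r₁ → trans (∑-cong elems (λ t₁ → trans (∑-*ˡ (allPoints F) (ρ r₁) _)
               (cong (ρ r₁ *_) (∑-*ˡ (allPoints F) ⟦ t₁ ≟ ((r ⁻¹ · r₁) · t) ⟧ (λ y₁ → ⟦ y₁ ≟V ((r ⁻¹ · r₁) • y) ⟧)))))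
               (trans (∑-*ˡ elems (ρ r₁) _) (trans (cong (ρ r₁ *_) (trans (∑-*ʳ elems _ (λ t₁ → ⟦ t₁ ≟ ((r ⁻¹ · r₁) · t) ⟧))
                 (cong₂ _*_ (𝔽.∑-unique₁ (_≟ ((r ⁻¹ · r₁) · t)) _ (λ _ e → e) refl)
                            (𝕍.∑-unique₁ (_≟V ((r ⁻¹ · r₁) • y)) _ (λ _ e → e) refl))))
               (*-identityʳ (ρ r₁))))) ⟩
        ∑F (λ r₁ → ⟦ r₁ ≟ r ⟧ + ⟦ r₁ ≟ (⊖ r) ⟧)
          ≡⟨ ∑-+ elems _ _ ⟩
        ∑F (λ r₁ → ⟦ r₁ ≟ r ⟧) + ∑F (λ r₁ → ⟦ r₁ ≟ (⊖ r) ⟧)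
          ≡⟨ cong₂ _+_ (𝔽.∑-unique₁ (_≟ r) r (λ _ e → e) refl) (𝔽.∑-unique₁ (_≟ (⊖ r)) (⊖ r) (λ _ e → e) refl) ⟩
        + 2 ∎
        where
        open ≡-Reasoning
        ρ : Carrier → ℤ
        ρ r₁ = ⟦ r₁ ≟ r ⟧ + ⟦ r₁ ≟ (⊖ r) ⟧

      matches-nonneg : ∀ i i₁ → 0ℤ ≤ matches i i₁
      matches-nonneg ((r , t) , y) ((r₁ , t₁) , y₁) = *-nonneg
        (+-nonneg (⟦⟧-nonneg (r₁ ≟ r)) (⟦⟧-nonneg (r₁ ≟ (⊖ r))))
        (*-nonneg (⟦⟧-nonneg (t₁ ≟ ((r ⁻¹ · r₁) · t))) (⟦⟧-nonneg (y₁ ≟V ((r ⁻¹ · r₁) • y))))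

      -- With σ = r₁ / r the equations become y₁ = σ y, then t₁ = σ t after cancelling φ(y), then
      -- r₁² = r² after cancelling t.
      coincidence≤matches : ∀ v′ r t y r₁ t₁ y₁ → Nonzero v′ ((r , t) , y) → Nonzero v′ ((r₁ , t₁) , y₁) →
        ⟦ (r₁ • y) ≟V (r • y₁) ⟧ * (⟦ (t₁ · φ y) ≟ (t · φ y₁) ⟧ * ⟦ (t₁ · r₁) ≟ (t · r) ⟧) ≤
        matches ((r , t) , y) ((r₁ , t₁) , y₁)
      coincidence≤matches v′ r t y r₁ t₁ y₁ n n₁
        with (r₁ • y) ≟V (r • y₁) | (t₁ · φ y) ≟ (t · φ y₁) | (t₁ · r₁) ≟ (t · r)
      ... | no _ | _ | _ = matches-nonneg ((r , t) , y) ((r₁ , t₁) , y₁)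
      ... | yes _ | no _ | _ = matches-nonneg ((r , t) , y) ((r₁ , t₁) , y₁)
      ... | yes _ | yes _ | no _ = matches-nonneg ((r , t) , y) ((r₁ , t₁) , y₁)
      ... | yes e₁ | yes e₂ | yes e₃ = subst (1ℤ ≤_)
              (sym (trans (cong₂ _*_ {x = ⟦ r₁ ≟ r ⟧ + ⟦ r₁ ≟ (⊖ r) ⟧} refl
                            (cong₂ _*_ (⟦⟧-true (t₁ ≟ ((r ⁻¹ · r₁) · t)) t₁≡) (⟦⟧-true (y₁ ≟V ((r ⁻¹ · r₁) • y)) y₁≡)))
                          (*-identityʳ _)))
              roots
        where
        open Nonzero
        open ≡-Reasoning
        σ = r ⁻¹ · r₁
        y₁≡ : y₁ ≡ σ • y
        y₁≡ = cong₂ _,_ (component (cong proj₁ e₁)) (component (cong proj₂ e₁))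
          where
          component : ∀ {p p₁} → r₁ · p ≡ r · p₁ → p₁ ≡ σ · p
          component {p} {p₁} e = trans (sym (⁻¹-cancelˡ (r≢0 n) p₁)) (trans (cong (r ⁻¹ ·_) (sym e)) (sym (·-assoc (r ⁻¹) r₁ p)))
        t₁≡ : t₁ ≡ σ · t
        t₁≡ = *-cancelˡ (φ≢0 n) (begin
          φ y · t₁         ≡⟨ ·-comm (φ y) t₁ ⟩
          t₁ · φ y         ≡⟨ e₂ ⟩
          t · φ y₁         ≡⟨ cong (λ x → t · φ x) y₁≡ ⟩
          t · φ (σ • y)    ≡⟨ cong (t ·_) (smulˡ σ y u) ⟩
          t · (σ · φ y)    ≡⟨ trans (sym (·-assoc t σ (φ y))) (trans (·-comm (t · σ) (φ y)) (cong (φ y ·_) (·-comm t σ))) ⟩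
          φ y · (σ · t) ∎)
        r₁²≡r² : r₁ · r₁ ≡ r · r
        r₁²≡r² = *-cancelˡ (t≢0 n) (begin
          t · (r₁ · r₁)         ≡⟨ cong (λ x → t · (x · r₁)) (sym (⁻¹-cancelʳ (r≢0 n) r₁)) ⟩
          t · ((r · σ) · r₁)    ≡⟨ trans (cong (t ·_) (·-assoc r σ r₁)) (*-swapˡ t r (σ · r₁)) ⟩
          r · (t · (σ · r₁))    ≡⟨ cong (r ·_) (trans (sym (·-assoc t σ r₁)) (cong (_· r₁) (·-comm t σ))) ⟩
          r · ((σ · t) · r₁)    ≡⟨ cong (λ x → r · (x · r₁)) (sym t₁≡) ⟩
          r · (t₁ · r₁)         ≡⟨ cong (r ·_) e₃ ⟩
          r · (t · r)           ≡⟨ *-swapˡ r t r ⟩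
          t · (r · r) ∎)
        roots : 1ℤ ≤ ⟦ r₁ ≟ r ⟧ + ⟦ r₁ ≟ (⊖ r) ⟧
        roots with square-roots r₁ r r₁²≡r²
        ... | inj₁ e = subst (λ s → 1ℤ ≤ s + ⟦ r₁ ≟ (⊖ r) ⟧) (sym (⟦⟧-true (r₁ ≟ r) e))
                         (≤-by-difference ⟦ r₁ ≟ (⊖ r) ⟧ (⟦⟧-nonneg (r₁ ≟ (⊖ r))) refl)
        ... | inj₂ e = subst (λ s → 1ℤ ≤ ⟦ r₁ ≟ r ⟧ + s) (sym (⟦⟧-true (r₁ ≟ (⊖ r)) e))
                         (≤-by-difference ⟦ r₁ ≟ r ⟧ (⟦⟧-nonneg (r₁ ≟ r)) (+-comm ⟦ r₁ ≟ r ⟧ 1ℤ))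

      -- The sums over b and γ do not involve v and come out as two indicators; the sum over v and a
      -- is left to `correlation-bound`.
      ∑-h-bound : ∀ v′ r t y r₁ t₁ y₁ → Nonzero v′ ((r , t) , y) → Nonzero v′ ((r₁ , t₁) , y₁) →
        ∑V (λ v → ∑[ s ∈ allTriples F ] h v ((r , t) , y) s * h v ((r₁ , t₁) , y₁) s) ≤
        (Q₁ * (Q * (Q * Q))) * matches ((r , t) , y) ((r₁ , t₁) , y₁)
      ∑-h-bound v′ r t y r₁ t₁ y₁ n n₁ = begin
        ∑V (λ v → ∑[ s ∈ allTriples F ] h v ((r , t) , y) s * h v ((r₁ , t₁) , y₁) s)
          ≡⟨ ∑-cong (allPoints F) (λ v → trans
               (∑-factor₃ elems elems elems
                 (λ a → nz a * d (B v y) (a · r)) (λ a → nz a * d (B v y₁) (a · r₁))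
                 (λ b → ⟦ φ y ≟ (b · t) ⟧) (λ b → ⟦ φ y₁ ≟ (b · t₁) ⟧)
                 (λ γ → ⟦ (t · r) ≟ γ ⟧) (λ γ → ⟦ (t₁ · r₁) ≟ γ ⟧))
               (cong₂ _*_ (nz-product (λ a → d (B v y) (a · r)) (λ a → d (B v y₁) (a · r₁))) (cong₂ _*_
                 (trans (∑-multiple (t≢0 n) (φ y) (λ b → ⟦ φ y₁ ≟ (b · t₁) ⟧)) (cross-multiply (t≢0 n) t₁ (φ y) (φ y₁)))
                 (∑-point (t · r) (λ γ → ⟦ (t₁ · r₁) ≟ γ ⟧))))) ⟩
        ∑V (λ v → correlation v * (β * γ))
          ≡⟨ ∑-*ʳ (allPoints F) (β * γ) correlation ⟩
        ∑V correlation * (β * γ)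
          ≡⟨ *-comm (∑V correlation) (β * γ) ⟩
        (β * γ) * ∑V correlation
          ≤⟨ *-mono-≤-nonnegˡ (*-nonneg (⟦⟧-nonneg ((t₁ · φ y) ≟ (t · φ y₁))) (⟦⟧-nonneg ((t₁ · r₁) ≟ (t · r))))
               (correlation-bound (r≢0 n) (r≢0 n₁) (y≢0 n) (y≢0 n₁)) ⟩
        (β * γ) * (Q₁ * ((Q * (Q * Q)) * α))
          ≡⟨ rearrange α β γ Q₁ (Q * (Q * Q)) ⟩
        (Q₁ * (Q * (Q * Q))) * (α * (β * γ))
          ≤⟨ *-mono-≤-nonnegˡ (*-nonneg Q₁-nonneg (*-nonneg Q-nonneg (*-nonneg Q-nonneg Q-nonneg)))
               (coincidence≤matches v′ r t y r₁ t₁ y₁ n n₁) ⟩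
        (Q₁ * (Q * (Q * Q))) * matches ((r , t) , y) ((r₁ , t₁) , y₁) ∎
        where
        open Nonzero
        open ≤-Reasoning
        correlation : V F → ℤ
        correlation v = ∑F (λ a → nz a * (d (B v y) (a · r) * d (B v y₁) (a · r₁)))
        α β γ : ℤ
        α = ⟦ (r₁ • y) ≟V (r • y₁) ⟧
        β = ⟦ (t₁ · φ y) ≟ (t · φ y₁) ⟧
        γ = ⟦ (t₁ · r₁) ≟ (t · r) ⟧
        rearrange : ∀ a b c q p → (b * c) * (q * (p * a)) ≡ (q * p) * (a * (b * c))
        rearrange = solve-∀

      ∑-ω : ∑V (λ v → ∑[ i ∈ indices ] ω v i) ≡ Q₁ * ((∑V wx * ∑F k) * ∑V wy)
      ∑-ω = begin
        ∑V (λ v → ∑[ i ∈ indices ] ω v i)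
          ≡⟨ ∑-cong (allPoints F) (λ v → trans (∑-indices (ω v)) (∑-cong elems (λ r → slice (r • v)))) ⟩
        ∑V (λ v → ∑F (λ r → (wx (r • v) * ∑F k) * ∑V wy))
          ≡⟨ ∑-dilations (λ x → (wx x * ∑F k) * ∑V wy)
               (cong (λ w → (w * ∑F k) * ∑V wy) (⟦⟧-false (X? (0V F)) (λ p → 0∉W (proj₁ p)))) ⟩
        Q₁ * ∑V (λ x → (wx x * ∑F k) * ∑V wy)
          ≡⟨ cong (Q₁ *_) (trans (∑-*ʳ (allPoints F) (∑V wy) (λ x → wx x * ∑F k))
               (cong (_* ∑V wy) (∑-*ʳ (allPoints F) (∑F k) wx))) ⟩
        Q₁ * ((∑V wx * ∑F k) * ∑V wy) ∎
        where
        open ≡-Reasoning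
        slice : ∀ x → ∑F (λ t → ∑V (λ y → ⟦ Ω? x t y ⟧)) ≡ (wx x * ∑F k) * ∑V wy
        slice x = trans (∑-cong elems (λ t → trans (∑-cong (allPoints F) (λ y → ω≡ x t y))
                     (∑-*ˡ (allPoints F) (wx x * k t) wy)))
                   (trans (∑-*ʳ elems (∑V wy) (λ t → wx x * k t)) (cong (_* ∑V wy) (∑-*ˡ elems (wx x) k)))

      M : ℤ
      M = Q₁ * (Q * (Q * Q))

      -- For fixed v′ the weights are independent of v, so the sum over v moves inside. One of the
      -- two weights is then dropped, because a row of `matches` sums to 2 anyway.
      K-squares-bound : ∑V (λ v → ∑V (λ v′ → ∑[ s ∈ allTriples F ] K v v′ s * K v v′ s)) ≤
                        (Q₁ * ((∑V wx * ∑F k) * ∑V wy)) * (M * + 2)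
      K-squares-bound = begin
        ∑V (λ v → ∑V (λ v′ → ∑[ s ∈ allTriples F ] K v v′ s * K v v′ s))
          ≡⟨ ∑-swap (allPoints F) (allPoints F) _ ⟩
        ∑V (λ v′ → ∑V (λ v → ∑[ s ∈ allTriples F ] K v v′ s * K v v′ s))
          ≡⟨ ∑-cong (allPoints F) (λ v′ → ∑-cong (allPoints F) (λ v →
               ∑-weighted-product (allTriples F) indices indices (ω v′) (h v) (ω v′) (h v))) ⟩
        ∑V (λ v′ → ∑V (λ v → ∑[ i ∈ indices ] ∑[ i₁ ∈ indices ]
          (ω v′ i * ω v′ i₁) * (∑[ s ∈ allTriples F ] h v i s * h v i₁ s)))
          ≡⟨ ∑-cong (allPoints F) (λ v′ → trans (∑-swap (allPoints F) indices _)
               (∑-cong indices (λ i → trans (∑-swap (allPoints F) indices _)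
                 (∑-cong indices (λ i₁ → ∑-*ˡ (allPoints F) (ω v′ i * ω v′ i₁) _))))) ⟩
        ∑V (λ v′ → ∑[ i ∈ indices ] ∑[ i₁ ∈ indices ]
          (ω v′ i * ω v′ i₁) * ∑V (λ v → ∑[ s ∈ allTriples F ] h v i s * h v i₁ s))
          ≤⟨ ∑-mono (allPoints F) (λ v′ → ∑-mono indices (λ i → ∑-mono indices (λ i₁ → bound v′ i i₁))) ⟩
        ∑V (λ v′ → ∑[ i ∈ indices ] ∑[ i₁ ∈ indices ] ω v′ i * (M * matches i i₁))
          ≡⟨ ∑-cong (allPoints F) (λ v′ → ∑-cong indices (λ i → trans (∑-*ˡ indices (ω v′ i) _)
               (cong (ω v′ i *_) (trans (∑-*ˡ indices M (matches i)) (cong (M *_) (∑-matches i)))))) ⟩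
        ∑V (λ v′ → ∑[ i ∈ indices ] ω v′ i * (M * + 2))
          ≡⟨ trans (∑-cong (allPoints F) (λ v′ → ∑-*ʳ indices (M * + 2) (ω v′)))
                   (∑-*ʳ (allPoints F) (M * + 2) (λ v′ → ∑ indices (ω v′))) ⟩
        ∑V (λ v′ → ∑ indices (ω v′)) * (M * + 2)
          ≡⟨ cong (_* (M * + 2)) ∑-ω ⟩
        (Q₁ * ((∑V wx * ∑F k) * ∑V wy)) * (M * + 2) ∎
        where
        open ≤-Reasoning
        bound : ∀ v′ i i₁ → (ω v′ i * ω v′ i₁) * ∑V (λ v → ∑[ s ∈ allTriples F ] h v i s * h v i₁ s) ≤
                            ω v′ i * (M * matches i i₁)
        bound v′ ((r , t) , y) ((r₁ , t₁) , y₁) = guarded-≤ (Ω? (r • v′) t y) (Ω? (r₁ • v′) t₁ y₁)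
          (*-nonneg (*-nonneg Q₁-nonneg (*-nonneg Q-nonneg (*-nonneg Q-nonneg Q-nonneg)))
                    (matches-nonneg ((r , t) , y) ((r₁ , t₁) , y₁)))
          (λ p p₁ → ∑-h-bound v′ r t y r₁ t₁ y₁ (nonzero v′ r t y p) (nonzero v′ r₁ t₁ y₁ p₁))

    -- The common factor comes from writing each of the two points x, x′ as a dilate in Q₁ ways; it
    -- is cancelled in `second-moment-bound`, where Q₁ is positive.
    deviation-bound : (Q₁ * Q₁) * (∑[ s ∈ allTriples F ] deviation s * deviation s) ≤
                      (Q₁ * Q₁) * ((+ 2 * (Q * (Q * Q))) * ((∑V wx * ∑F k) * ∑V wy))
    deviation-bound = begin
      (Q₁ * Q₁) * (∑[ s ∈ allTriples F ] deviation s * deviation s)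
        ≡⟨ deviation-as-cross-terms ⟩
      ∑[ s ∈ allTriples F ] ∑V (λ v → ∑V (λ v′ → Kθ v v′ s * Kθ v′ v s))
        ≤⟨ ∑-mono (allTriples F) (λ s → cross-terms-≤-squares (allPoints F) (λ v v′ → Kθ v v′ s)) ⟩
      ∑[ s ∈ allTriples F ] ∑V (λ v → ∑V (λ v′ → Kθ v v′ s * Kθ v v′ s))
        ≡⟨ trans (∑-swap (allTriples F) (allPoints F) _)
                 (∑-cong (allPoints F) (λ v → ∑-swap (allTriples F) (allPoints F) _)) ⟩
      ∑V (λ v → ∑V (λ v′ → ∑[ s ∈ allTriples F ] Kθ v v′ s * Kθ v v′ s))
        ≤⟨ ∑-mono (allPoints F) (λ v → ∑-mono (allPoints F) (λ v′ → unscaled-square v v′)) ⟩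
      ∑V (λ v → ∑V (λ v′ → ∑[ s ∈ allTriples F ] K v v′ s * K v v′ s))
        ≤⟨ K-squares-bound ⟩
      (Q₁ * ((∑V wx * ∑F k) * ∑V wy)) * ((Q₁ * (Q * (Q * Q))) * + 2)
        ≡⟨ rearrange Q₁ ((∑V wx * ∑F k) * ∑V wy) (Q * (Q * Q)) ⟩
      (Q₁ * Q₁) * ((+ 2 * (Q * (Q * Q))) * ((∑V wx * ∑F k) * ∑V wy)) ∎
      where
      open ≤-Reasoning
      rearrange : ∀ q n p → (q * n) * ((q * p) * + 2) ≡ (q * q) * ((+ 2 * p) * n)
      rearrange = solve-∀

-- Second moment of the counting function.

module SecondMoment (F : FiniteField) (B : V F → V F → FiniteField.Carrier F)
                    (bil : IsBilinear F B) (nd : IsNondegenerate F B)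
                    (W : V F → Set)
                    (W? : (x : V F) → Dec (W x)) (0∉W : ¬ W (0V F)) (u : V F) where
  open FiniteSums
  open SumManipulations
  open FieldSums F
  open CentredIndicators F
  open Deviation F B bil nd
  open Slices W W? 0∉W u
  open IsBilinear bil
  open IsNondegenerate nd
  open VectorCorrelation F B bil nd using (Q-nonneg)
  open BilinearForms F B bil using (kernel-card)
  open FieldAlgebra F using (Carrier; elems; _≟_; 0#; *-cancelˡ) renaming (_*_ to _·_)
  open import Data.Integer using (ℤ; +_; 0ℤ; 1ℤ; _+_; _*_; _-_; _≤_; +≤+; Positive)
  open import Data.Integer.Properties using (*-identityʳ; *-comm; *-assoc; ≤-trans; ≤-refl;
    ≤-reflexive; +-mono-≤; *-cancelˡ-≤-pos; module ≤-Reasoning)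
  open import Data.Integer.Tactic.RingSolver using (solve-∀)
  open import Data.List using (List; cartesianProduct)
  open import Data.Nat using (z≤n)
  open import Data.Product using (_×_; _,_)
  open import Relation.Nullary.Decidable using (¬?; _×-dec_)
  open import Relation.Binary.PropositionalEquality

  w : V F → ℤ
  w x = ⟦ W? x ⟧

  N h : ℤ
  N = ∑V w
  h = ∑F k

  flipped-bilinear : IsBilinear F (λ x y → B y x)
  flipped-bilinear = record
    { addˡ  = λ x y z → addʳ z x y
    ; addʳ  = λ x y z → addˡ y z x
    ; smulˡ = λ s x y → smulʳ s y x
    ; smulʳ = λ s x y → smulˡ s y x
    }

  left-kernel : ∀ {y} → ¬ y ≡ 0V F → ∑V (λ x → z (B x y)) ≡ Q
  left-kernel = kernel-card rightRad

  right-kernel : ∀ {x} → ¬ x ≡ 0V F → ∑V (λ y → z (B x y)) ≡ Q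
  right-kernel = BilinearForms.kernel-card F (λ x y → B y x) flipped-bilinear leftRad

  Item : Set
  Item = V F × (Carrier × V F)

  items : List Item
  items = cartesianProduct (allPoints F) (cartesianProduct elems (allPoints F))

  ∑-items : (G : Item → ℤ) → ∑ items G ≡ ∑V (λ x → ∑F (λ t → ∑V (λ y → G (x , (t , y)))))
  ∑-items G = trans (∑-cartesianProduct (allPoints F) (cartesianProduct elems (allPoints F)) G)
    (∑-cong (allPoints F) (λ x → ∑-cartesianProduct elems (allPoints F) (λ ty → G (x , ty))))

  ω : Item → ℤ
  ω (x , (t , y)) = ⟦ Ω? x t y ⟧

  value : Item → Carrier
  value (x , (t , y)) = B x y

  position : Item → Carrier → Carrier → ℤ
  position (x , (t , y)) b c = ⟦ (t · φ y) ≟ b ⟧ * ⟦ (t · θ x) ≟ c ⟧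

  ν : Carrier → Carrier → Carrier → ℤ
  ν a b c = ∑[ o ∈ items ] ω o * (⟦ value o ≟ a ⟧ * position o b c)

  -- The column total over nonzero a, hence Q₁ times the mean; see `∑-count`.
  ν̄ : Carrier → Carrier → ℤ
  ν̄ b c = ∑[ o ∈ items ] ω o * (nz (value o) * position o b c)

  count : Triple F → ℤ
  count (a , b , c) = nz a * ν a b c

  ∑-triples : (G : Triple F → ℤ) → ∑ (allTriples F) G ≡ ∑F (λ b → ∑F (λ c → ∑F (λ a → G (a , b , c))))
  ∑-triples G = trans (∑-cartesianProduct elems (cartesianProduct elems elems) G)
    (trans (∑-cong elems (λ a → ∑-cartesianProduct elems elems (λ bc → G (a , bc))))
    (trans (∑-swap elems elems _) (∑-cong elems (λ b → ∑-swap elems elems _))))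

  ∑-count : ∀ b c → ∑F (λ a → count (a , b , c)) ≡ ν̄ b c
  ∑-count b c = begin
    ∑F (λ a → nz a * ν a b c)
      ≡⟨ ∑-cong elems (λ a → sym (∑-*ˡ items (nz a) _)) ⟩
    ∑F (λ a → ∑[ o ∈ items ] nz a * (ω o * (⟦ value o ≟ a ⟧ * position o b c)))
      ≡⟨ ∑-swap elems items _ ⟩
    ∑[ o ∈ items ] ∑F (λ a → nz a * (ω o * (⟦ value o ≟ a ⟧ * position o b c)))
      ≡⟨ ∑-cong items (λ o → trans
           (∑-cong elems (λ a → rearrange (nz a) (ω o) ⟦ value o ≟ a ⟧ (position o b c)))
           (trans (𝔽.∑-unique (value o ≟_) (value o) (λ _ e → sym e) refl (λ a → nz a * (ω o * position o b c)))
                  (swap (nz (value o)) (ω o) (position o b c)))) ⟩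
    ν̄ b c ∎
    where
    open ≡-Reasoning
    rearrange : ∀ n o v p → n * (o * (v * p)) ≡ v * (n * (o * p))
    rearrange = solve-∀
    swap : ∀ n o p → n * (o * p) ≡ o * (n * p)
    swap = solve-∀

  deviation-of-count : ∀ a b c → deviation (a , b , c) ≡ Q₁ * count (a , b , c) - nz a * ν̄ b c
  deviation-of-count a b c = begin
    deviation (a , b , c)
      ≡⟨ sym (∑-items (λ o → ω o * ((nz a * d (value o) a) * position o b c))) ⟩
    ∑[ o ∈ items ] ω o * ((nz a * d (value o) a) * position o b c)
      ≡⟨ ∑-cong items (λ o → expand (ω o) (nz a) Q₁ ⟦ value o ≟ a ⟧ (nz (value o)) (position o b c)) ⟩
    ∑[ o ∈ items ] ((Q₁ * nz a) * (ω o * (⟦ value o ≟ a ⟧ * position o b c))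
                    - nz a * (ω o * (nz (value o) * position o b c)))
      ≡⟨ trans (∑-- items _ _) (cong₂ _-_ (trans (∑-*ˡ items (Q₁ * nz a) _) (*-assoc Q₁ (nz a) (ν a b c)))
                                          (∑-*ˡ items (nz a) _)) ⟩
    Q₁ * count (a , b , c) - nz a * ν̄ b c ∎
    where
    open ≡-Reasoning
    expand : ∀ o n q v m p → o * ((n * (q * v - m)) * p) ≡ (q * n) * (o * (v * p)) - n * (o * (m * p))
    expand = solve-∀

  nz-count : ∀ a b c → nz a * count (a , b , c) ≡ count (a , b , c)
  nz-count a b c = trans (sym (*-assoc (nz a) (nz a) _)) (cong (_* ν a b c) (nz-idem a))

  -- A variance decomposition in each column (b , c). There are Q₁ nonzero values of a and their
  -- counts add up to m = ν̄ b c, so the cross term -2 Q₁ m² and the constant term Q₁ m² combine to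
  -- -Q₁ m².
  second-moment : (Q₁ * Q₁) * (∑[ s ∈ allTriples F ] count s * count s) ≡
                  (∑[ s ∈ allTriples F ] deviation s * deviation s) + Q₁ * ∑F (λ b → ∑F (λ c → ν̄ b c * ν̄ b c))
  second-moment = begin
    (Q₁ * Q₁) * (∑[ s ∈ allTriples F ] count s * count s)
      ≡⟨ cong ((Q₁ * Q₁) *_) (∑-triples (λ s → count s * count s)) ⟩
    (Q₁ * Q₁) * ∑F (λ b → ∑F (λ c → ∑F (λ a → count (a , b , c) * count (a , b , c))))
      ≡⟨ trans (sym (∑-*ˡ elems (Q₁ * Q₁) _)) (∑-cong elems (λ b → trans (sym (∑-*ˡ elems (Q₁ * Q₁) _))
           (∑-cong elems (λ c → column b c)))) ⟩
    ∑F (λ b → ∑F (λ c → ∑F (λ a → deviation (a , b , c) * deviation (a , b , c)) + Q₁ * (ν̄ b c * ν̄ b c)))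
      ≡⟨ trans (∑-cong elems (λ b → trans (∑-+ elems _ _)
           (cong (_+_ (∑F (λ c → ∑F (λ a → deviation (a , b , c) * deviation (a , b , c))))) (∑-*ˡ elems Q₁ (λ c → ν̄ b c * ν̄ b c)))))
           (trans (∑-+ elems _ _) (cong (_+_ (∑F (λ b → ∑F (λ c → ∑F (λ a → deviation (a , b , c) * deviation (a , b , c)))))) (∑-*ˡ elems Q₁ (λ b → ∑F (λ c → ν̄ b c * ν̄ b c))))) ⟩
    ∑F (λ b → ∑F (λ c → ∑F (λ a → deviation (a , b , c) * deviation (a , b , c)))) + Q₁ * ∑F (λ b → ∑F (λ c → ν̄ b c * ν̄ b c))
      ≡⟨ cong (_+ Q₁ * ∑F (λ b → ∑F (λ c → ν̄ b c * ν̄ b c))) (sym (∑-triples (λ s → deviation s * deviation s))) ⟩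
    (∑[ s ∈ allTriples F ] deviation s * deviation s) + Q₁ * ∑F (λ b → ∑F (λ c → ν̄ b c * ν̄ b c)) ∎
    where
    open ≡-Reasoning
    expand : ∀ q n C m → (q * C - n * m) * (q * C - n * m) ≡
      (q * q) * (C * C) + ((n * n) * (m * m) - (+ 2 * (q * m)) * (n * C))
    expand = solve-∀
    collect : ∀ q S m → (q * q) * S ≡ ((q * q) * S + (q * (m * m) - (+ 2 * (q * m)) * m)) + q * (m * m)
    collect = solve-∀
    column : ∀ b c → (Q₁ * Q₁) * ∑F (λ a → count (a , b , c) * count (a , b , c)) ≡
             ∑F (λ a → deviation (a , b , c) * deviation (a , b , c)) + Q₁ * (ν̄ b c * ν̄ b c)
    column b c = trans (collect Q₁ S m) (cong (_+ Q₁ * (m * m)) (sym (begin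
      ∑F (λ a → deviation (a , b , c) * deviation (a , b , c))
        ≡⟨ ∑-cong elems (λ a → trans (cong₂ _*_ (deviation-of-count a b c) (deviation-of-count a b c))
             (trans (expand Q₁ (nz a) (count (a , b , c)) m)
               (cong (_+_ ((Q₁ * Q₁) * (count (a , b , c) * count (a , b , c))))
                 (cong₂ _-_ (cong (_* (m * m)) (nz-idem a)) (cong ((+ 2 * (Q₁ * m)) *_) (nz-count a b c)))))) ⟩
      ∑F (λ a → (Q₁ * Q₁) * (count (a , b , c) * count (a , b , c)) + (nz a * (m * m) - (+ 2 * (Q₁ * m)) * count (a , b , c)))
        ≡⟨ trans (∑-+ elems _ _) (cong₂ _+_ (∑-*ˡ elems (Q₁ * Q₁) _) (trans (∑-- elems _ _)
             (cong₂ _-_ (trans (∑-*ʳ elems (m * m) nz) (cong (_* (m * m)) ∑F-nz))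
                        (trans (∑-*ˡ elems (+ 2 * (Q₁ * m)) _) (cong ((+ 2 * (Q₁ * m)) *_) (∑-count b c)))))) ⟩
      (Q₁ * Q₁) * S + (Q₁ * (m * m) - (+ 2 * (Q₁ * m)) * m) ∎)))
      where
      m = ν̄ b c
      S = ∑F (λ a → count (a , b , c) * count (a , b , c))

  -- Square sum of the column totals.

  coincidences : (V F → Carrier) → ℤ
  coincidences f = ∑V (λ y → ∑V (λ y′ → (w y * w y′) * ⟦ f y ≟ f y′ ⟧))

  Sφ Sθ : ℤ
  Sφ = coincidences φ
  Sθ = coincidences θ

  w-nonneg : ∀ x → 0ℤ ≤ w x
  w-nonneg x = ⟦⟧-nonneg (W? x)

  conjunction-≤ : {P R : Set} (D : Dec P) (E : Dec R) → ⟦ D ×-dec E ⟧ ≤ ⟦ D ⟧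
  conjunction-≤ D E = subst₂ _≤_ (⟦⟧-× D E) (*-identityʳ ⟦ D ⟧) (*-mono-≤-nonnegˡ (⟦⟧-nonneg D) (⟦⟧-≤1 E))

  wx≤w : ∀ x → wx x ≤ w x
  wx≤w x = conjunction-≤ (W? x) (¬? (θ x ≟ 0#))

  wy≤w : ∀ y → wy y ≤ w y
  wy≤w y = conjunction-≤ (W? y) (¬? (φ y ≟ 0#))

  fibre : (V F → ℤ) → (V F → Carrier) → Carrier → Carrier → ℤ
  fibre ω f b t = ∑V (λ y → ω y * ⟦ (t · f y) ≟ b ⟧)

  -- Opening the square counts pairs with t f(y) = t f(y′). The nonzero t cancels, so one bound
  -- serves every slice t.
  ∑-fibre² : (ω : V F → ℤ) (f : V F → Carrier) → (∀ y → 0ℤ ≤ ω y) → (∀ y → ω y ≤ w y) → ∀ {t} → ¬ t ≡ 0# →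
             ∑F (λ b → fibre ω f b t * fibre ω f b t) ≤ coincidences f
  ∑-fibre² ω f 0≤ω ω≤w {t} t≢0 = begin
    ∑F (λ b → fibre ω f b t * fibre ω f b t)
      ≡⟨ ∑-weighted-product elems (allPoints F) (allPoints F) ω (λ y b → ⟦ (t · f y) ≟ b ⟧) ω (λ y b → ⟦ (t · f y) ≟ b ⟧) ⟩
    ∑V (λ y → ∑V (λ y′ → (ω y * ω y′) * ∑F (λ b → ⟦ (t · f y) ≟ b ⟧ * ⟦ (t · f y′) ≟ b ⟧)))
      ≡⟨ ∑-cong (allPoints F) (λ y → ∑-cong (allPoints F) (λ y′ → cong ((ω y * ω y′) *_)
           (trans (𝔽.∑-unique ((t · f y) ≟_) (t · f y) (λ _ e → sym e) refl (λ b → ⟦ (t · f y′) ≟ b ⟧))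
                  (⟦⟧-cong ((t · f y′) ≟ (t · f y)) (f y ≟ f y′)
                    (λ e → *-cancelˡ t≢0 (sym e)) (λ e → cong (t ·_) (sym e)))))) ⟩
    ∑V (λ y → ∑V (λ y′ → (ω y * ω y′) * ⟦ f y ≟ f y′ ⟧))
      ≤⟨ ∑-mono (allPoints F) (λ y → ∑-mono (allPoints F) (λ y′ → *-mono-≤-nonneg
           (*-nonneg (w-nonneg y) (w-nonneg y′)) (⟦⟧-nonneg (f y ≟ f y′))
           (*-mono-≤-nonneg (w-nonneg y) (0≤ω y′) (ω≤w y) (ω≤w y′)) ≤-refl)) ⟩
    coincidences f ∎
    where open ≤-Reasoning

  profile : Carrier → Carrier → Carrier → ℤ
  profile b c t = fibre wy φ b t * fibre wx θ c t

  wx-nonneg : ∀ x → 0ℤ ≤ wx x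
  wx-nonneg x = ⟦⟧-nonneg (X? x)

  wy-nonneg : ∀ y → 0ℤ ≤ wy y
  wy-nonneg y = ⟦⟧-nonneg (Y? y)

  ν̄-nonneg : ∀ b c → 0ℤ ≤ ν̄ b c
  ν̄-nonneg b c = ∑-nonneg items (λ { (x , (t , y)) → *-nonneg (⟦⟧-nonneg (Ω? x t y))
    (*-nonneg (⟦⟧-nonneg (¬? (B x y ≟ 0#))) (*-nonneg (⟦⟧-nonneg ((t · φ y) ≟ b)) (⟦⟧-nonneg ((t · θ x) ≟ c)))) })

  -- Forgetting B x y ≠ 0 decouples x from y: for fixed t the coordinate b concerns only y, and c
  -- only x.
  ν̄-≤ : ∀ b c → ν̄ b c ≤ ∑F (λ t → k t * profile b c t)
  ν̄-≤ b c = begin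
    ν̄ b c
      ≡⟨ ∑-items (λ o → ω o * (nz (value o) * position o b c)) ⟩
    ∑V (λ x → ∑F (λ t → ∑V (λ y → ⟦ Ω? x t y ⟧ * (nz (B x y) * (⟦ (t · φ y) ≟ b ⟧ * ⟦ (t · θ x) ≟ c ⟧)))))
      ≤⟨ ∑-mono (allPoints F) (λ x → ∑-mono elems (λ t → ∑-mono (allPoints F) (λ y → term x t y))) ⟩
    ∑V (λ x → ∑F (λ t → ∑V (λ y → (k t * (wx x * ⟦ (t · θ x) ≟ c ⟧)) * (wy y * ⟦ (t · φ y) ≟ b ⟧))))
      ≡⟨ ∑-swap (allPoints F) elems _ ⟩
    ∑F (λ t → ∑V (λ x → ∑V (λ y → (k t * (wx x * ⟦ (t · θ x) ≟ c ⟧)) * (wy y * ⟦ (t · φ y) ≟ b ⟧))))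
      ≡⟨ ∑-cong elems (λ t → trans (∑-* (allPoints F) (allPoints F) (λ x → k t * (wx x * ⟦ (t · θ x) ≟ c ⟧)) _)
           (trans (cong (_* fibre wy φ b t) (∑-*ˡ (allPoints F) (k t) _))
                  (trans (*-assoc (k t) (fibre wx θ c t) (fibre wy φ b t))
                         (cong (k t *_) (*-comm (fibre wx θ c t) (fibre wy φ b t)))))) ⟩
    ∑F (λ t → k t * profile b c t) ∎
    where
    open ≤-Reasoning
    rearrange : ∀ p q r s s′ → ((p * q) * r) * (1ℤ * (s * s′)) ≡ (q * (p * s′)) * (r * s)
    rearrange = solve-∀
    term : ∀ x t y → ⟦ Ω? x t y ⟧ * (nz (B x y) * (⟦ (t · φ y) ≟ b ⟧ * ⟦ (t · θ x) ≟ c ⟧)) ≤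
                     (k t * (wx x * ⟦ (t · θ x) ≟ c ⟧)) * (wy y * ⟦ (t · φ y) ≟ b ⟧)
    term x t y = ≤-trans
      (*-mono-≤-nonnegˡ (⟦⟧-nonneg (Ω? x t y))
        (*-mono-≤-nonneg {nz (B x y)} {1ℤ} (+≤+ z≤n)
          (*-nonneg (⟦⟧-nonneg ((t · φ y) ≟ b)) (⟦⟧-nonneg ((t · θ x) ≟ c)))
          (⟦⟧-≤1 (¬? (B x y ≟ 0#))) ≤-refl))
      (≤-reflexive (trans (cong (_* (1ℤ * (⟦ (t · φ y) ≟ b ⟧ * ⟦ (t · θ x) ≟ c ⟧))) (ω≡ x t y))
        (rearrange (wx x) (k t) (wy y) ⟦ (t · φ y) ≟ b ⟧ ⟦ (t · θ x) ≟ c ⟧)))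

  h-nonneg : 0ℤ ≤ h
  h-nonneg = ∑-nonneg elems (λ t → ⟦⟧-nonneg (W? (t • u)))

  k-idem : ∀ t → k t * k t ≡ k t
  k-idem t = ⟦⟧-idem (W? (t • u))

  ν̄²-≤ : ∀ b c → ν̄ b c * ν̄ b c ≤ h * ∑F (λ t → k t * (profile b c t * profile b c t))
  ν̄²-≤ b c = begin
    ν̄ b c * ν̄ b c
      ≤⟨ *-mono-≤-nonneg (≤-trans (ν̄-nonneg b c) (ν̄-≤ b c)) (ν̄-nonneg b c) (ν̄-≤ b c) (ν̄-≤ b c) ⟩
    ∑F (λ t → k t * profile b c t) * ∑F (λ t → k t * profile b c t)
      -- Since `k` takes the values 0 and 1, it can be duplicated; Cauchy-Schwarz then yields ∑ k² =
      -- h as first factor and keeps the restriction to t u in `W` in the second.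
      ≡⟨ cong₂ _*_ double double ⟩
    ∑F (λ t → k t * (k t * profile b c t)) * ∑F (λ t → k t * (k t * profile b c t))
      ≤⟨ cauchy-schwarz elems k (λ t → k t * profile b c t) ⟩
    ∑F (λ t → k t * k t) * ∑F (λ t → (k t * profile b c t) * (k t * profile b c t))
      ≡⟨ cong₂ _*_ (∑-cong elems k-idem) (∑-cong elems (λ t →
           trans (interchange (k t) (profile b c t)) (cong (_* (profile b c t * profile b c t)) (k-idem t)))) ⟩
    h * ∑F (λ t → k t * (profile b c t * profile b c t)) ∎
    where
    open ≤-Reasoning
    double : ∑F (λ t → k t * profile b c t) ≡ ∑F (λ t → k t * (k t * profile b c t))
    double = ∑-cong elems (λ t → trans (cong (_* profile b c t) (sym (k-idem t))) (*-assoc (k t) (k t) (profile b c t)))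
    interchange : ∀ a b → (a * b) * (a * b) ≡ (a * a) * (b * b)
    interchange = solve-∀

  coincidences-nonneg : ∀ f → 0ℤ ≤ coincidences f
  coincidences-nonneg f = ∑-nonneg (allPoints F) (λ y → ∑-nonneg (allPoints F) (λ y′ →
    *-nonneg (*-nonneg (w-nonneg y) (w-nonneg y′)) (⟦⟧-nonneg (f y ≟ f y′))))

  ∑-ν̄² : ∑F (λ b → ∑F (λ c → ν̄ b c * ν̄ b c)) ≤ (h * h) * (Sφ * Sθ)
  ∑-ν̄² = begin
    ∑F (λ b → ∑F (λ c → ν̄ b c * ν̄ b c))
      ≤⟨ ∑-mono elems (λ b → ∑-mono elems (λ c → ν̄²-≤ b c)) ⟩
    ∑F (λ b → ∑F (λ c → h * ∑F (λ t → k t * (profile b c t * profile b c t))))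
      ≡⟨ trans (∑-cong elems (λ b → ∑-*ˡ elems h _)) (∑-*ˡ elems h _) ⟩
    h * ∑F (λ b → ∑F (λ c → ∑F (λ t → k t * (profile b c t * profile b c t))))
      ≡⟨ cong (h *_) (trans (∑-cong elems (λ b → ∑-swap elems elems _)) (∑-swap elems elems _)) ⟩
    h * ∑F (λ t → ∑F (λ b → ∑F (λ c → k t * (profile b c t * profile b c t))))
      ≡⟨ cong (h *_) (∑-cong elems (λ t → trans
           (∑-cong elems (λ b → trans (∑-*ˡ elems (k t) _) (cong (k t *_)
             (∑-cong elems (λ c → interchange (fibre wy φ b t) (fibre wx θ c t))))))
           (trans (∑-*ˡ elems (k t) _) (cong (k t *_) (∑-* elems elems _ _))))) ⟩
    h * ∑F (λ t → k t * (∑F (λ b → fibre wy φ b t * fibre wy φ b t) * ∑F (λ c → fibre wx θ c t * fibre wx θ c t)))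
      ≤⟨ *-mono-≤-nonnegˡ h-nonneg (∑-mono elems slice) ⟩
    h * ∑F (λ t → k t * (Sφ * Sθ))
      ≡⟨ trans (cong (h *_) (∑-*ʳ elems (Sφ * Sθ) k)) (sym (*-assoc h h (Sφ * Sθ))) ⟩
    (h * h) * (Sφ * Sθ) ∎
    where
    open ≤-Reasoning
    interchange : ∀ a b → (a * b) * (a * b) ≡ (a * a) * (b * b)
    interchange = solve-∀
    slice : ∀ t → k t * (∑F (λ b → fibre wy φ b t * fibre wy φ b t) * ∑F (λ c → fibre wx θ c t * fibre wx θ c t)) ≤
                  k t * (Sφ * Sθ)
    slice t with W? (t • u)
    ... | no _ = ≤-refl
    ... | yes Wtu = *-mono-≤-nonnegˡ {1ℤ} (+≤+ z≤n) (*-mono-≤-nonneg (coincidences-nonneg φ)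
            (∑-nonneg elems (λ c → square-nonneg (fibre wx θ c t)))
            (∑-fibre² wy φ wy-nonneg wy≤w t≢0) (∑-fibre² wx θ wx-nonneg wx≤w t≢0))
      where
      t≢0 : ¬ t ≡ 0#
      t≢0 refl = 0∉W (subst W (0•v u) Wtu)

  N-nonneg : 0ℤ ≤ N
  N-nonneg = ∑-nonneg (allPoints F) w-nonneg

  second-moment-bound : Positive Q₁ →
    (Q₁ * Q₁) * (∑[ s ∈ allTriples F ] count s * count s) ≤
    (+ 2 * (Q * (Q * Q))) * ((N * h) * N) + Q₁ * ((h * h) * (Sφ * Sθ))
  second-moment-bound pos = begin
    (Q₁ * Q₁) * (∑[ s ∈ allTriples F ] count s * count s)
      ≡⟨ second-moment ⟩
    (∑[ s ∈ allTriples F ] deviation s * deviation s) + Q₁ * ∑F (λ b → ∑F (λ c → ν̄ b c * ν̄ b c))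
      ≤⟨ +-mono-≤ deviation-part (*-mono-≤-nonnegˡ Q₁-nonneg ∑-ν̄²) ⟩
    (+ 2 * (Q * (Q * Q))) * ((N * h) * N) + Q₁ * ((h * h) * (Sφ * Sθ)) ∎
    where
    open ≤-Reasoning
    deviation-part : (∑[ s ∈ allTriples F ] deviation s * deviation s) ≤ (+ 2 * (Q * (Q * Q))) * ((N * h) * N)
    deviation-part = ≤-trans
      (*-cancelˡ-≤-pos _ _ Q₁ {{pos}} (*-cancelˡ-≤-pos _ _ Q₁ {{pos}}
        (subst₂ _≤_ (*-assoc Q₁ Q₁ _) (*-assoc Q₁ Q₁ _) deviation-bound)))
      (*-mono-≤-nonnegˡ (*-nonneg {+ 2} (+≤+ z≤n) (*-nonneg Q-nonneg (*-nonneg Q-nonneg Q-nonneg)))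
        (*-mono-≤-nonneg (*-nonneg N-nonneg h-nonneg) (∑-nonneg (allPoints F) wy-nonneg)
          (*-mono-≤-nonneg N-nonneg h-nonneg (∑-mono (allPoints F) wx≤w) ≤-refl)
          (∑-mono (allPoints F) wy≤w)))

-- First moment, and the lower bound for the number of attained triples.

module AttainedTriples (F : FiniteField) (B : V F → V F → FiniteField.Carrier F)
                    (bil : IsBilinear F B) (nd : IsNondegenerate F B)
                    (W : V F → Set)
                    (W? : (x : V F) → Dec (W x)) (0∉W : ¬ W (0V F)) (u : V F) where
  open FiniteSums
  open SumManipulations
  open FieldSums F
  open CentredIndicators F
  open Deviation F B bil nd
  open Slices W W? 0∉W u
  open SecondMoment F B bil nd W W? 0∉W u
  open IsBilinear bil
  open FieldAlgebra F using (Carrier; elems; _≟_; 0#) renaming (_*_ to _·_)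
  open import Data.Integer using (ℤ; +_; 0ℤ; 1ℤ; _+_; _*_; _-_; -_; _≤_; +≤+; Positive; -≤+)
  open import Data.Integer.Properties using (*-identityˡ; *-identityʳ; *-zeroʳ; ≤-trans; ≤-refl;
    ≤-reflexive; +-mono-≤; neg-mono-≤; module ≤-Reasoning)
  open import Data.Integer.Tactic.RingSolver using (solve-∀)
  open import Data.Nat using (z≤n)
  open import Data.Empty using (⊥-elim)
  open import Data.Product using (_,_)
  open import Relation.Nullary.Decidable using (¬?; _×-dec_)
  open import Relation.Binary.PropositionalEquality

  ∑-position : ∀ o → ∑F (λ b → ∑F (λ c → position o b c)) ≡ 1ℤ
  ∑-position (x , (t , y)) = trans (∑-* elems elems _ _) (cong₂ _*_
    (𝔽.∑-unique₁ ((t · φ y) ≟_) (t · φ y) (λ _ e → sym e) refl)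
    (𝔽.∑-unique₁ ((t · θ x) ≟_) (t · θ x) (λ _ e → sym e) refl))

  -- Each admissible (x, t, y) with B x y ≠ 0 occupies exactly one triple, and t is independent of x
  -- and y, which splits off the factor h.
  total-count : ∑ (allTriples F) count ≡ h * ∑V (λ x → wx x * ∑V (λ y → wy y * nz (B x y)))
  total-count = begin
    ∑ (allTriples F) count
      ≡⟨ trans (∑-triples count) (∑-cong elems (λ b → ∑-cong elems (λ c → ∑-count b c))) ⟩
    ∑F (λ b → ∑F (λ c → ν̄ b c))
      ≡⟨ trans (∑-cong elems (λ b → ∑-swap elems items _)) (∑-swap elems items _) ⟩
    ∑[ o ∈ items ] ∑F (λ b → ∑F (λ c → ω o * (nz (value o) * position o b c)))
      ≡⟨ ∑-cong items (λ o → trans (∑-cong elems (λ b → trans (∑-*ˡ elems (ω o) _) (cong (ω o *_) (∑-*ˡ elems (nz (value o)) _))))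
           (trans (∑-*ˡ elems (ω o) _) (cong (ω o *_) (trans (∑-*ˡ elems (nz (value o)) _)
             (trans (cong (nz (value o) *_) (∑-position o)) (*-identityʳ _)))))) ⟩
    ∑[ o ∈ items ] ω o * nz (value o)
      ≡⟨ ∑-items _ ⟩
    ∑V (λ x → ∑F (λ t → ∑V (λ y → ⟦ Ω? x t y ⟧ * nz (B x y))))
      ≡⟨ ∑-swap (allPoints F) elems _ ⟩
    ∑F (λ t → ∑V (λ x → ∑V (λ y → ⟦ Ω? x t y ⟧ * nz (B x y))))
      ≡⟨ ∑-cong elems (λ t → trans (∑-cong (allPoints F) (λ x → trans
           (∑-cong (allPoints F) (λ y → trans (cong (_* nz (B x y)) (ω≡ x t y)) (rearrange (wx x) (k t) (wy y) (nz (B x y)))))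
           (trans (∑-*ˡ (allPoints F) (k t) _) (cong (k t *_) (∑-*ˡ (allPoints F) (wx x) _)))))
           (∑-*ˡ (allPoints F) (k t) _)) ⟩
    ∑F (λ t → k t * ∑V (λ x → wx x * ∑V (λ y → wy y * nz (B x y))))
      ≡⟨ ∑-*ʳ elems _ k ⟩
    h * ∑V (λ x → wx x * ∑V (λ y → wy y * nz (B x y))) ∎
    where
    open ≡-Reasoning
    rearrange : ∀ p q r n → ((p * q) * r) * n ≡ q * (p * (r * n))
    rearrange = solve-∀

  minus-mono : ∀ {a b c e} → a ≤ b → e ≤ c → a - c ≤ b - e
  minus-mono a≤b e≤c = +-mono-≤ a≤b (neg-mono-≤ e≤c)

  conjunction-≥ : {P R : Set} (D : Dec P) (E : Dec R) → ⟦ D ⟧ - ⟦ E ⟧ ≤ ⟦ D ×-dec ¬? E ⟧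
  conjunction-≥ (yes _) (yes _) = ≤-refl
  conjunction-≥ (yes _) (no _)  = ≤-refl
  conjunction-≥ (no _)  (yes _) = -≤+
  conjunction-≥ (no _)  (no _)  = ≤-refl

  module _ (u≢0 : ¬ u ≡ 0V F) where

    ∑wx-≥ : N - Q ≤ ∑V wx
    ∑wx-≥ = subst (_≤ ∑V wx) (trans (∑-- (allPoints F) w _) (cong (_-_ N) (right-kernel u≢0)))
      (∑-mono (allPoints F) (λ x → conjunction-≥ (W? x) (θ x ≟ 0#)))

    -- Two lines of Q points each are lost: φ(y) = 0, as u ≠ 0, and B x y = 0, as x ≠ 0. The factor
    -- `wx x` confines the claim to x in `W`, where the latter holds.
    row-≥ : ∀ x → wx x * ((N - Q) - Q) ≤ wx x * ∑V (λ y → wy y * nz (B x y))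
    row-≥ x with X? x
    ... | no _ = ≤-refl
    ... | yes (Wx , _) = *-mono-≤-nonnegˡ {1ℤ} (+≤+ z≤n)
          (subst (_≤ ∑V (λ y → wy y * nz (B x y))) ∑≡ (∑-mono (allPoints F) term))
      where
      x≢0 : ¬ x ≡ 0V F
      x≢0 refl = 0∉W Wx
      ∑≡ : ∑V (λ y → (w y - z (φ y)) - z (B x y)) ≡ (N - Q) - Q
      ∑≡ = trans (∑-- (allPoints F) _ _) (cong₂ _-_
             (trans (∑-- (allPoints F) w _) (cong (_-_ N) (left-kernel u≢0))) (right-kernel x≢0))
      term : ∀ y → (w y - z (φ y)) - z (B x y) ≤ wy y * nz (B x y)
      term y = ≤-trans (minus-mono (conjunction-≥ (W? y) (φ y ≟ 0#)) (≤-refl {z (B x y)}))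
        (≤-trans (conjunction-≥ (Y? y) (B x y ≟ 0#)) (≤-reflexive (sym (⟦⟧-× (Y? y) (¬? (B x y ≟ 0#))))))

    total-count-≥ : 0ℤ ≤ (N - Q) - Q → h * ((N - Q) * ((N - Q) - Q)) ≤ ∑ (allTriples F) count
    total-count-≥ 0≤N-2Q = begin
      h * ((N - Q) * ((N - Q) - Q))
        ≤⟨ *-mono-≤-nonnegˡ h-nonneg (*-mono-≤-nonneg (∑-nonneg (allPoints F) wx-nonneg) 0≤N-2Q ∑wx-≥ ≤-refl) ⟩
      h * (∑V wx * ((N - Q) - Q))
        ≡⟨ cong (h *_) (sym (∑-*ʳ (allPoints F) ((N - Q) - Q) wx)) ⟩
      h * ∑V (λ x → wx x * ((N - Q) - Q))
        ≤⟨ *-mono-≤-nonnegˡ h-nonneg (∑-mono (allPoints F) row-≥) ⟩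
      h * ∑V (λ x → wx x * ∑V (λ y → wy y * nz (B x y)))
        ≡⟨ sym total-count ⟩
      ∑ (allTriples F) count ∎
      where open ≤-Reasoning

  module _ {Attained : Triple F → Set} (attained? : ∀ s → Dec (Attained s))
           (attained : ∀ {x y z} → W x → W y → W z → Attained (B x y , B y z , B z x)) where

    T : ℤ
    T = ∑[ s ∈ allTriples F ] ⟦ attained? s ⟧

    count-supported : ∀ s → count s ≡ ⟦ attained? s ⟧ * count s
    count-supported (a , b , c) with attained? (a , b , c)
    ... | yes _ = sym (*-identityˡ _)
    ... | no ¬att = trans (cong (nz a *_) (trans (∑-cong items vanish) (∑-zero items))) (*-zeroʳ (nz a))
      where
      vanish : ∀ o → ω o * (⟦ value o ≟ a ⟧ * position o b c) ≡ 0ℤ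
      vanish (x , (t , y)) with Ω? x t y
      ... | no _ = refl
      ... | yes (((Wx , _) , Wtu) , (Wy , _)) with B x y ≟ a | (t · φ y) ≟ b | (t · θ x) ≟ c
      ...   | no _ | _ | _ = refl
      ...   | yes _ | no _ | _ = refl
      ...   | yes _ | yes _ | no _ = refl
      ...   | yes e₁ | yes e₂ | yes e₃ = ⊥-elim (¬att (subst Attained
                (cong₂ _,_ e₁ (cong₂ _,_ (trans (smulʳ t y u) e₂) (trans (smulˡ t u x) e₃)))
                (attained Wx Wy Wtu)))

    count-cauchy-schwarz : ∑ (allTriples F) count * ∑ (allTriples F) count ≤
                           T * (∑[ s ∈ allTriples F ] count s * count s)
    count-cauchy-schwarz = subst₂ _≤_
      (cong (λ n → n * n) (sym (∑-cong (allTriples F) count-supported)))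
      (cong (_* (∑[ s ∈ allTriples F ] count s * count s)) (∑-cong (allTriples F) (λ s → ⟦⟧-idem (attained? s))))
      (cauchy-schwarz (allTriples F) (λ s → ⟦ attained? s ⟧) count)

    attained-bound : Positive Q₁ →
      (Q₁ * Q₁) * (∑ (allTriples F) count * ∑ (allTriples F) count) ≤
      T * ((+ 2 * (Q * (Q * Q))) * ((N * h) * N) + Q₁ * ((h * h) * (Sφ * Sθ)))
    attained-bound pos = begin
      (Q₁ * Q₁) * (∑ (allTriples F) count * ∑ (allTriples F) count)
        ≤⟨ *-mono-≤-nonnegˡ (square-nonneg Q₁) count-cauchy-schwarz ⟩
      (Q₁ * Q₁) * (T * (∑[ s ∈ allTriples F ] count s * count s))
        ≡⟨ swap (Q₁ * Q₁) T _ ⟩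
      T * ((Q₁ * Q₁) * (∑[ s ∈ allTriples F ] count s * count s))
        ≤⟨ *-mono-≤-nonnegˡ (∑-nonneg (allTriples F) (λ s → ⟦⟧-nonneg (attained? s))) (second-moment-bound pos) ⟩
      T * ((+ 2 * (Q * (Q * Q))) * ((N * h) * N) + Q₁ * ((h * h) * (Sφ * Sθ))) ∎
      where
      open ≤-Reasoning
      swap : ∀ a b c → a * (b * c) ≡ b * (a * c)
      swap = solve-∀

-- Choice of the direction u by averaging.

module Selection (F : FiniteField) (B : V F → V F → FiniteField.Carrier F)
                 (bil : IsBilinear F B) (nd : IsNondegenerate F B)
                 (W : V F → Set) (W? : (x : V F) → Dec (W x)) (0∉W : ¬ W (0V F)) where
  open FiniteSums
  open SumManipulations
  open FieldSums F
  open CentredIndicators F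
  open Deviation F B bil nd using (∑-dilations)
  module At = SecondMoment F B bil nd W W? 0∉W
  open At (0V F) using (N; w; flipped-bilinear)
  open IsNondegenerate nd
  open VectorCorrelation F B bil nd using (_≟V_)
  open FieldAlgebra F using (Carrier; elems; _≟_; 0#; 1#; difference-zero; -‿inverseʳ;
    -‿distribˡ-*) renaming (_*_ to _·_; _+_ to _⊕_; -_ to ⊖_; *-identityˡ to ·-identityˡ)
  open import Data.Integer using (ℤ; +_; 0ℤ; 1ℤ; _+_; _*_; _-_; -_; _≤_; +≤+)
  open import Data.Integer.Properties using (*-identityˡ; *-identityʳ; ≤-reflexive;
    module ≤-Reasoning)
  open import Data.Integer.Tactic.RingSolver using (solve-∀)
  open import Data.List using (List; []; _∷_)
  open import Data.Product using (_,_; proj₁; proj₂; ∃-syntax)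
  open import Relation.Binary.PropositionalEquality

  module _ (B′ : V F → V F → Carrier) (bil′ : IsBilinear F B′)
           (rightRad′ : ∀ y → (∀ x → B′ x y ≡ 0#) → y ≡ 0V F) where
    private
      module Bil = IsBilinear bil′

    -- For y ≠ y′ agreement puts v in the kernel of B′(·, y - y′), a line of Q points. The form B′
    -- is a parameter because both B and its transpose are needed, for θ and φ respectively.
    agreement-card : ∀ y y′ → ∑V (λ v → ⟦ B′ v y ≟ B′ v y′ ⟧) ≡ Q + (Q * Q - Q) * ⟦ y ≟V y′ ⟧
    agreement-card y y′ with y ≟V y′
    ... | yes refl = trans (∑-cong (allPoints F) (λ v → ⟦⟧-true (B′ v y ≟ B′ v y) refl)) (trans ∑V-one (identity Q))
      where
      identity : ∀ Q → Q * Q ≡ Q + (Q * Q - Q) * 1ℤ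
      identity = solve-∀
    ... | no y≢y′ = trans
      (∑-cong (allPoints F) (λ v → ⟦⟧-cong (B′ v y ≟ B′ v y′) (B′ v D ≟ 0#)
        (λ e → trans (evaluate v) (trans (cong (_⊕ (⊖ B′ v y′)) e) (-‿inverseʳ _)))
        (λ e → difference-zero _ _ (trans (sym (evaluate v)) e))))
      (trans (BilinearForms.kernel-card F B′ bil′ rightRad′ D≢0) (identity Q))
      where
      D : V F
      D = _+V_ F y ((⊖ 1#) • y′)
      negate : ∀ a → (⊖ 1#) · a ≡ ⊖ a
      negate a = trans (sym (-‿distribˡ-* 1# a)) (cong ⊖_ (·-identityˡ a))
      evaluate : ∀ v → B′ v D ≡ B′ v y ⊕ (⊖ B′ v y′)
      evaluate v = trans (Bil.addʳ v y ((⊖ 1#) • y′)) (cong (B′ v y ⊕_) (trans (Bil.smulʳ (⊖ 1#) v y′) (negate _)))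
      D≢0 : ¬ D ≡ 0V F
      D≢0 e = y≢y′ (cong₂ _,_ (equal (cong proj₁ e)) (equal (cong proj₂ e)))
        where
        equal : ∀ {a b} → a ⊕ ((⊖ 1#) · b) ≡ 0# → a ≡ b
        equal {a} {b} e = difference-zero a b (trans (cong (a ⊕_) (sym (negate b))) e)
      identity : ∀ Q → Q ≡ Q + (Q * Q - Q) * 0ℤ
      identity = solve-∀

    ∑-coincidences : ∑V (λ v → ∑V (λ y → ∑V (λ y′ → (w y * w y′) * ⟦ B′ v y ≟ B′ v y′ ⟧))) ≡
                     Q * (N * N) + (Q * Q - Q) * N
    ∑-coincidences = begin
      ∑V (λ v → ∑V (λ y → ∑V (λ y′ → (w y * w y′) * ⟦ B′ v y ≟ B′ v y′ ⟧)))
        ≡⟨ trans (∑-swap P P _) (∑-cong P (λ y → trans (∑-swap P P _) (∑-cong P (λ y′ → trans (∑-*ˡ P (w y * w y′) _)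
             (trans (cong ((w y * w y′) *_) (agreement-card y y′)) (expand (w y) (w y′) Q (Q * Q - Q) ⟦ y ≟V y′ ⟧)))))) ⟩
      ∑V (λ y → ∑V (λ y′ → Q * (w y * w y′) + (Q * Q - Q) * (⟦ y ≟V y′ ⟧ * (w y * w y′))))
        ≡⟨ ∑-cong P (λ y → trans (∑-+ P _ _) (cong₂ _+_ (∑-*ˡ P Q _) (trans (∑-*ˡ P (Q * Q - Q) _)
             (cong ((Q * Q - Q) *_) (trans (𝕍.∑-unique (y ≟V_) y (λ _ e → sym e) refl (λ y′ → w y * w y′)) (⟦⟧-idem (W? y))))))) ⟩
      ∑V (λ y → Q * ∑V (λ y′ → w y * w y′) + (Q * Q - Q) * w y)
        ≡⟨ trans (∑-+ P _ _) (cong₂ _+_ (trans (∑-*ˡ P Q _) (cong (Q *_) (∑-* P P w w))) (∑-*ˡ P (Q * Q - Q) w)) ⟩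
      Q * (N * N) + (Q * Q - Q) * N ∎
      where
      open ≡-Reasoning
      P = allPoints F
      expand : ∀ a b q p e → (a * b) * (q + p * e) ≡ q * (a * b) + p * (e * (a * b))
      expand = solve-∀

  -- N points are distributed over Q values of f, and Cauchy-Schwarz against the constant 1 makes an
  -- even distribution the extremal one.
  coincidences-≥ : ∀ u (f : V F → Carrier) → N * N ≤ Q * At.coincidences u f
  coincidences-≥ u f = begin
    N * N
      ≡⟨ cong₂ _*_ total total ⟩
    ∑F (λ b → 1ℤ * n b) * ∑F (λ b → 1ℤ * n b)
      ≤⟨ cauchy-schwarz elems (λ _ → 1ℤ) n ⟩
    ∑F (λ b → 1ℤ * 1ℤ) * ∑F (λ b → n b * n b)
      ≡⟨ cong₂ _*_ ∑F-one squares ⟩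
    Q * At.coincidences u f ∎
    where
    open ≤-Reasoning
    n : Carrier → ℤ
    n b = ∑V (λ y → w y * ⟦ f y ≟ b ⟧)
    total : N ≡ ∑F (λ b → 1ℤ * n b)
    total = sym (trans (∑-cong elems (λ b → *-identityˡ (n b))) (trans (∑-swap elems (allPoints F) _)
      (∑-cong (allPoints F) (λ y → trans (∑-*ˡ elems (w y) _)
        (trans (cong (w y *_) (𝔽.∑-unique₁ (f y ≟_) (f y) (λ _ e → sym e) refl)) (*-identityʳ (w y)))))))
    squares : ∑F (λ b → n b * n b) ≡ At.coincidences u f
    squares = trans
      (∑-weighted-product elems (allPoints F) (allPoints F) w (λ y b → ⟦ f y ≟ b ⟧) w (λ y b → ⟦ f y ≟ b ⟧))
      (∑-cong (allPoints F) (λ y → ∑-cong (allPoints F) (λ y′ → cong ((w y * w y′) *_)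
        (trans (𝔽.∑-unique (f y ≟_) (f y) (λ _ e → sym e) refl (λ b → ⟦ f y′ ≟ b ⟧))
               (⟦⟧-cong (f y′ ≟ f y) (f y ≟ f y′) sym sym)))))

  -- Subtracting the guaranteed minimum keeps the quantity nonnegative and makes its average small:
  -- it is 2 (Q - 1) N over the plane. Nonnegativity is what lets a selected u have large h.
  excess : V F → ℤ
  excess u = Q * (At.Sφ u + At.Sθ u) - + 2 * (N * N)

  excess-nonneg : ∀ u → 0ℤ ≤ excess u
  excess-nonneg u = ≤-by-difference ((Q * At.Sφ u - N * N) + (Q * At.Sθ u - N * N))
    (+-nonneg (difference-nonneg (coincidences-≥ u (λ y → B y u))) (difference-nonneg (coincidences-≥ u (λ x → B u x))))
    (identity Q (At.Sφ u) (At.Sθ u) (N * N))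
    where
    identity : ∀ Q S S′ m → Q * (S + S′) - + 2 * m ≡ 0ℤ + ((Q * S - m) + (Q * S′ - m))
    identity = solve-∀

  ∑-excess : ∑V excess ≡ Q * ((Q * (N * N) + (Q * Q - Q) * N) + (Q * (N * N) + (Q * Q - Q) * N)) - (Q * Q) * (+ 2 * (N * N))
  ∑-excess = trans (∑-- (allPoints F) _ _) (cong₂ _-_
    (trans (∑-*ˡ (allPoints F) Q _) (cong (Q *_) (trans (∑-+ (allPoints F) _ _) (cong₂ _+_
      (∑-coincidences (λ x y → B y x) flipped-bilinear leftRad) (∑-coincidences B bil rightRad)))))
    (trans (∑-cong (allPoints F) (λ _ → sym (*-identityˡ (+ 2 * (N * N)))))
      (trans (∑-*ʳ (allPoints F) (+ 2 * (N * N)) (λ _ → 1ℤ)) (cong (_* (+ 2 * (N * N))) ∑V-one))))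

  ∑-h : ∑V At.h ≡ Q₁ * N
  ∑-h = ∑-dilations w (⟦⟧-false (W? (0V F)) 0∉W)

  -- q² times the amount by which N² h − q·excess exceeds its average over u; a nonnegative value
  -- makes h large and the excess small at the same time.
  surplus : V F → ℤ
  surplus u = (Q * Q) * ((N * N) * At.h u - Q * excess u) - (Q₁ * N) * (N * N - + 2 * (Q * (Q * Q)))

  ∑-surplus : ∑V surplus ≡ 0ℤ
  ∑-surplus = begin
    ∑V surplus
      ≡⟨ trans (∑-- (allPoints F) _ _) (cong₂ _-_
           (trans (∑-*ˡ (allPoints F) (Q * Q) _) (cong ((Q * Q) *_) (trans (∑-- (allPoints F) _ _)
             (cong₂ _-_ (trans (∑-*ˡ (allPoints F) (N * N) At.h) (cong ((N * N) *_) ∑-h))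
                        (trans (∑-*ˡ (allPoints F) Q excess) (cong (Q *_) ∑-excess))))))
           (trans (∑-cong (allPoints F) (λ _ → sym (*-identityˡ _)))
             (trans (∑-*ʳ (allPoints F) c (λ _ → 1ℤ)) (cong (_* c) ∑V-one)))) ⟩
    (Q * Q) * ((N * N) * (Q₁ * N) - Q * (Q * ((Q * (N * N) + (Q * Q - Q) * N) + (Q * (N * N) + (Q * Q - Q) * N))
                                          - (Q * Q) * (+ 2 * (N * N))))
      - (Q * Q) * ((Q₁ * N) * (N * N - + 2 * (Q * (Q * Q))))
      ≡⟨ identity Q N ⟩
    0ℤ ∎
    where
    open ≡-Reasoning
    c : ℤ
    c = (Q₁ * N) * (N * N - + 2 * (Q * (Q * Q)))
    identity : ∀ Q N → (Q * Q) * ((N * N) * ((Q - 1ℤ) * N) - Q * (Q * ((Q * (N * N) + (Q * Q - Q) * N) + (Q * (N * N) + (Q * Q - Q) * N))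
                                          - (Q * Q) * (+ 2 * (N * N))))
      - (Q * Q) * (((Q - 1ℤ) * N) * (N * N - + 2 * (Q * (Q * Q)))) ≡ 0ℤ
    identity = solve-∀

  -- The average runs over the whole plane, including u = 0; that the chosen u is nonzero is
  -- recovered in `conclusion-from` from h ≥ 1.
  good-direction : ∃[ u ] 0ℤ ≤ surplus u
  good-direction = go (allPoints F) ∑-surplus ∑V-one-nonempty
    where
    ∑V-one-nonempty : 1ℤ ≤ ∑V (λ _ → 1ℤ)
    ∑V-one-nonempty = subst (_≤ ∑V (λ _ → 1ℤ)) (𝕍.∑-unique₁ (_≟V 0V F) (0V F) (λ _ e → e) refl)
      (∑-mono (allPoints F) (λ v → ⟦⟧-≤1 (v ≟V 0V F)))
    go : (xs : List (V F)) → ∑ xs surplus ≡ 0ℤ → 1ℤ ≤ ∑ xs (λ _ → 1ℤ) → ∃[ u ] 0ℤ ≤ surplus u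
    go [] _ (+≤+ ())
    go (x ∷ xs) e _ = ∑-pigeonhole x xs surplus (≤-reflexive (sym e))

-- Numerical inequalities behind the constants.

module Arithmetic where
  open FiniteSums using (*-nonneg; +-nonneg; square-nonneg; *-mono-≤-nonnegˡ; *-mono-≤-nonneg;
    ≤-by-difference; difference-nonneg)
  open import Data.Integer using (ℤ; +_; -[1+_]; 0ℤ; 1ℤ; _+_; _*_; _-_; _≤_; +≤+; -≤+; _≤?_)
  open import Data.Integer.Properties using (+-mono-≤; *-cancelˡ-≤-pos; *-zeroʳ; ≤-trans; ≤-refl;
    module ≤-Reasoning)
  open import Data.Integer.Tactic.RingSolver using (solve-∀)
  open import Data.Nat using (suc; z≤n; s≤s)
  open import Data.Empty using (⊥-elim)
  open import Relation.Binary.PropositionalEquality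

  cancel-≤ : ∀ {c a b} → 1ℤ ≤ c → c * a ≤ c * b → a ≤ b
  cancel-≤ {+ suc n} _ le = *-cancelˡ-≤-pos _ _ (+ suc n) le
  cancel-≤ {+ 0} (+≤+ ()) le

  1≤-* : ∀ {a b} → 1ℤ ≤ a → 1ℤ ≤ b → 1ℤ ≤ a * b
  1≤-* {a} {b} 1≤a 1≤b = *-mono-≤-nonneg {1ℤ} {a} {1ℤ} {b} (≤-trans (+≤+ z≤n) 1≤a) (+≤+ z≤n) 1≤a 1≤b

  1≤-factor : ∀ {c h} → 0ℤ ≤ c → 1ℤ ≤ c * h → 1ℤ ≤ h
  1≤-factor {c} {h} 0≤c 1≤ch with 1ℤ ≤? h
  ... | yes 1≤h = 1≤h
  ... | no h<1 = ⊥-elim (absurd (≤-trans 1≤ch (subst (c * h ≤_) (*-zeroʳ c) (*-mono-≤-nonnegˡ 0≤c h≤0))))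
    where
    absurd : ¬ 1ℤ ≤ 0ℤ
    absurd (+≤+ ())
    h≤0 : h ≤ 0ℤ
    h≤0 = nonpositive h h<1
      where
      nonpositive : ∀ h → ¬ 1ℤ ≤ h → h ≤ 0ℤ
      nonpositive (+ 0) _ = ≤-refl
      nonpositive (+ suc n) ¬1≤ = ⊥-elim (¬1≤ (+≤+ (s≤s z≤n)))
      nonpositive -[1+ n ] _ = -≤+

  module _ {Q N : ℤ} (1≤Q : 1ℤ ≤ Q) (0≤N : 0ℤ ≤ N) (N≤Q² : N ≤ Q * Q)
           (N³-large : + 125 * (Q * (Q * (Q * (Q * Q)))) ≤ N * (N * N)) where
    private
      0≤Q : 0ℤ ≤ Q
      0≤Q = ≤-trans (+≤+ z≤n) 1≤Q
      1≤Q² : 1ℤ ≤ Q * Q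
      1≤Q² = 1≤-* 1≤Q 1≤Q

    -- The bound N ≤ Q² replaces one factor N of N³ by Q². Repeating this yields `N-large` and then
    -- `Q-large`, which makes the lower-order corrections harmless.
    N²-large : + 125 * (Q * (Q * Q)) ≤ N * N
    N²-large = cancel-≤ 1≤Q² (begin
      (Q * Q) * (+ 125 * (Q * (Q * Q))) ≡⟨ rearrange Q ⟩
      + 125 * (Q * (Q * (Q * (Q * Q)))) ≤⟨ N³-large ⟩
      N * (N * N)                       ≤⟨ *-mono-≤-nonneg (≤-trans 0≤N N≤Q²) (square-nonneg N) N≤Q² ≤-refl ⟩
      (Q * Q) * (N * N)                 ∎)
      where
      open ≤-Reasoning
      rearrange : ∀ Q → (Q * Q) * (+ 125 * (Q * (Q * Q))) ≡ + 125 * (Q * (Q * (Q * (Q * Q))))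
      rearrange = solve-∀

    N-large : + 125 * Q ≤ N
    N-large = cancel-≤ 1≤Q² (begin
      (Q * Q) * (+ 125 * Q)   ≡⟨ rearrange Q ⟩
      + 125 * (Q * (Q * Q))   ≤⟨ N²-large ⟩
      N * N                   ≤⟨ *-mono-≤-nonneg (≤-trans 0≤N N≤Q²) 0≤N N≤Q² ≤-refl ⟩
      (Q * Q) * N             ∎)
      where
      open ≤-Reasoning
      rearrange : ∀ Q → (Q * Q) * (+ 125 * Q) ≡ + 125 * (Q * (Q * Q))
      rearrange = solve-∀

    Q-large : + 125 ≤ Q
    Q-large = cancel-≤ 1≤Q (begin
      Q * + 125   ≡⟨ rearrange Q ⟩
      + 125 * Q   ≤⟨ N-large ⟩
      N           ≤⟨ N≤Q² ⟩
      Q * Q       ∎)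
      where
      open ≤-Reasoning
      rearrange : ∀ Q → Q * + 125 ≡ + 125 * Q
      rearrange = solve-∀

    Q₁-positive : 1ℤ ≤ Q - 1ℤ
    Q₁-positive = ≤-by-difference ((Q - + 125) + + 123) (+-nonneg (difference-nonneg Q-large) (+≤+ z≤n)) (identity Q)
      where
      identity : ∀ Q → Q - 1ℤ ≡ 1ℤ + ((Q - + 125) + + 123)
      identity = solve-∀

    N-2Q-nonneg : 0ℤ ≤ (N - Q) - Q
    N-2Q-nonneg = ≤-by-difference ((N - + 125 * Q) + + 123 * Q)
      (+-nonneg (difference-nonneg N-large) (*-nonneg {+ 123} (+≤+ z≤n) 0≤Q)) (identity Q N)
      where
      identity : ∀ Q N → (N - Q) - Q ≡ 0ℤ + ((N - + 125 * Q) + + 123 * Q)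
      identity = solve-∀

    1≤N : 1ℤ ≤ N
    1≤N = ≤-trans 1≤Q (≤-by-difference ((N - + 125 * Q) + + 124 * Q)
      (+-nonneg (difference-nonneg N-large) (*-nonneg {+ 124} (+≤+ z≤n) 0≤Q)) (identity Q N))
      where
      identity : ∀ Q N → N ≡ Q + ((N - + 125 * Q) + + 124 * Q)
      identity = solve-∀

    private
      R : ℤ
      R = N * N - + 2 * (Q * (Q * Q))

      0≤Q₁ : 0ℤ ≤ Q - 1ℤ
      0≤Q₁ = ≤-trans (+≤+ z≤n) Q₁-positive

      0≤R : 0ℤ ≤ R
      0≤R = ≤-by-difference ((N * N - + 125 * (Q * (Q * Q))) + + 123 * (Q * (Q * Q)))
        (+-nonneg (difference-nonneg N²-large) (*-nonneg {+ 123} (+≤+ z≤n) (*-nonneg 0≤Q (*-nonneg 0≤Q 0≤Q)))) (identity Q N)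
        where
        identity : ∀ Q N → N * N - + 2 * (Q * (Q * Q)) ≡
          0ℤ + ((N * N - + 125 * (Q * (Q * Q))) + + 123 * (Q * (Q * Q)))
        identity = solve-∀

    module _ {h D : ℤ} (0≤h : 0ℤ ≤ h) (h≤Q : h ≤ Q) (0≤D : 0ℤ ≤ D)
             (selected : 0ℤ ≤ (Q * Q) * ((N * N) * h - Q * D) - ((Q - 1ℤ) * N) * R) where

      -- As D ≥ 0, the selection gives Q² N² h ≥ (Q - 1) N (N² - 2 Q³), and the right side is at
      -- least Q N³ / 2.
      h-large : N ≤ (+ 2 * Q) * h
      h-large = cancel-≤ (1≤-* 1≤Q (1≤-* 1≤N 1≤N)) (≤-by-difference
        ((+ 2 * ((Q * Q) * ((N * N) * h - Q * D) - ((Q - 1ℤ) * N) * R) + (+ 2 * (Q * (Q * Q))) * D)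
          -- This is N times (Q - 2) N² - 4 (Q - 1) Q³, expanded around N² = 125 Q³ and Q = 125: 121
          -- = 125 - 4, 14879 = 121 · 125 - 246 and 123 = 125 - 2.
          + N * ((Q * (Q * Q)) * (+ 121 * (Q - + 125) + + 14879) + ((Q - + 125) + + 123) * (N * N - + 125 * (Q * (Q * Q)))))
        (+-nonneg (+-nonneg (*-nonneg {+ 2} (+≤+ z≤n) selected)
                            (*-nonneg (*-nonneg {+ 2} (+≤+ z≤n) 0≤Q³) 0≤D))
          (*-nonneg 0≤N (+-nonneg
            (*-nonneg 0≤Q³ (+-nonneg (*-nonneg {+ 121} (+≤+ z≤n) (difference-nonneg Q-large)) (+≤+ z≤n)))
            (*-nonneg (+-nonneg (difference-nonneg Q-large) (+≤+ z≤n)) (difference-nonneg N²-large)))))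
        (identity Q N h D))
        where
        0≤Q³ : 0ℤ ≤ Q * (Q * Q)
        0≤Q³ = *-nonneg 0≤Q (*-nonneg 0≤Q 0≤Q)
        identity : ∀ Q N h D → (Q * (N * N)) * ((+ 2 * Q) * h) ≡ (Q * (N * N)) * N +
          ((+ 2 * ((Q * Q) * ((N * N) * h - Q * D) - ((Q - 1ℤ) * N) * (N * N - + 2 * (Q * (Q * Q)))) + (+ 2 * (Q * (Q * Q))) * D)
          + N * ((Q * (Q * Q)) * (+ 121 * (Q - + 125) + + 14879) + ((Q - + 125) + + 123) * (N * N - + 125 * (Q * (Q * Q)))))
        identity = solve-∀

      -- Here the average in the selection is discarded as nonnegative, and h ≤ Q gives Q³ D ≤ Q² N²
      -- h ≤ Q³ N².
      D≤N² : D ≤ N * N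
      D≤N² = cancel-≤ (1≤-* 1≤Q² 1≤Q) (≤-by-difference
        ((((Q * Q) * ((N * N) * h - Q * D) - ((Q - 1ℤ) * N) * R) + ((Q - 1ℤ) * N) * R) + ((Q * Q) * (N * N)) * (Q - h))
        (+-nonneg (+-nonneg selected (*-nonneg (*-nonneg 0≤Q₁ 0≤N) 0≤R))
                  (*-nonneg (*-nonneg (*-nonneg 0≤Q 0≤Q) (*-nonneg 0≤N 0≤N)) (difference-nonneg h≤Q)))
        (identity Q N h D R))
        where
        identity : ∀ Q N h D R → ((Q * Q) * Q) * (N * N) ≡ ((Q * Q) * Q) * D +
          ((((Q * Q) * ((N * N) * h - Q * D) - ((Q - 1ℤ) * N) * R) + ((Q - 1ℤ) * N) * R) + ((Q * Q) * (N * N)) * (Q - h))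
        identity = solve-∀

      module _ {S S′ n T : ℤ} (0≤S : 0ℤ ≤ S) (0≤S′ : 0ℤ ≤ S′) (D≡ : D ≡ Q * (S + S′) - + 2 * (N * N))
               (0≤T : 0ℤ ≤ T) (n-large : h * ((N - Q) * ((N - Q) - Q)) ≤ n)
               (bound : ((Q - 1ℤ) * (Q - 1ℤ)) * (n * n) ≤
                        T * ((+ 2 * (Q * (Q * Q))) * ((N * h) * N) + (Q - 1ℤ) * ((h * h) * (S * S′)))) where
        private
          0≤hN² : 0ℤ ≤ h * (N * N)
          0≤hN² = *-nonneg 0≤h (*-nonneg 0≤N 0≤N)

          -- Twice (N - Q)(N - 2Q) exceeds N² by N (N - 6Q) + 4 Q²; hence 119 = 125 - 6.
          hN²≤2n : h * (N * N) ≤ + 2 * n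
          hN²≤2n = ≤-trans (≤-by-difference
            (h * (N * ((N - + 125 * Q) + + 119 * Q) + + 4 * (Q * Q)))
            (*-nonneg 0≤h (+-nonneg (*-nonneg 0≤N (+-nonneg (difference-nonneg N-large) (*-nonneg {+ 119} (+≤+ z≤n) 0≤Q)))
                                    (*-nonneg {+ 4} (+≤+ z≤n) (*-nonneg 0≤Q 0≤Q))))
            (identity Q N h))
            (*-mono-≤-nonnegˡ {+ 2} (+≤+ z≤n) n-large)
            where
            identity : ∀ Q N h → + 2 * (h * ((N - Q) * ((N - Q) - Q))) ≡ h * (N * N) +
              h * (N * ((N - + 125 * Q) + + 119 * Q) + + 4 * (Q * Q))
            identity = solve-∀

          QΣ≤3N² : Q * (S + S′) ≤ + 3 * (N * N)
          QΣ≤3N² = ≤-by-difference (N * N - D) (difference-nonneg D≤N²)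
            (trans (identity (Q * (S + S′)) (N * N)) (cong (λ d → Q * (S + S′) + (N * N - d)) (sym D≡)))
            where
            identity : ∀ p m → + 3 * m ≡ p + (m - (p - + 2 * m))
            identity = solve-∀

          4Q²SS′≤9N⁴ : (+ 4 * (Q * Q)) * (S * S′) ≤ + 9 * ((N * N) * (N * N))
          4Q²SS′≤9N⁴ = begin
            (+ 4 * (Q * Q)) * (S * S′)
              ≤⟨ ≤-by-difference ((Q * (S - S′)) * (Q * (S - S′))) (square-nonneg (Q * (S - S′))) (identity Q S S′) ⟩
            (Q * (S + S′)) * (Q * (S + S′))
              ≤⟨ *-mono-≤-nonneg (≤-trans 0≤QΣ QΣ≤3N²) 0≤QΣ QΣ≤3N² QΣ≤3N² ⟩
            (+ 3 * (N * N)) * (+ 3 * (N * N))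
              ≡⟨ square (N * N) ⟩
            + 9 * ((N * N) * (N * N)) ∎
            where
            open ≤-Reasoning
            0≤QΣ : 0ℤ ≤ Q * (S + S′)
            0≤QΣ = *-nonneg 0≤Q (+-nonneg 0≤S 0≤S′)
            identity : ∀ Q S S′ → (Q * (S + S′)) * (Q * (S + S′)) ≡
              (+ 4 * (Q * Q)) * (S * S′) + (Q * (S - S′)) * (Q * (S - S′))
            identity = solve-∀
            square : ∀ m → (+ 3 * m) * (+ 3 * m) ≡ + 9 * (m * m)
            square = solve-∀

          -- The place where the exponent 5/3 is decisive: N ≤ 2 Q h turns 2 Q h N² into at least N³
          -- ≥ 125 Q⁵. The left side is 4 Q² times the 2 Q³ of the deviation bound.
          8Q⁵≤Q₁hN² : + 8 * (Q * (Q * (Q * (Q * Q)))) ≤ ((Q - 1ℤ) * h) * (N * N)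
          8Q⁵≤Q₁hN² = cancel-≤ {+ 2 * Q} (1≤-* {+ 2} (+≤+ (s≤s z≤n)) 1≤Q) (≤-by-difference
            ((((Q - 1ℤ) * (N * N)) * ((+ 2 * Q) * h - N) + (Q - 1ℤ) * (N * (N * N) - + 125 * Q⁵)) + Q⁵ * (+ 109 * (Q - + 125) + + 13500))
            (+-nonneg (+-nonneg (*-nonneg (*-nonneg 0≤Q₁ (*-nonneg 0≤N 0≤N)) (difference-nonneg h-large))
                                (*-nonneg 0≤Q₁ (difference-nonneg N³-large)))
              (*-nonneg (*-nonneg 0≤Q (*-nonneg 0≤Q (*-nonneg 0≤Q (*-nonneg 0≤Q 0≤Q))))
                        (+-nonneg (*-nonneg {+ 109} (+≤+ z≤n) (difference-nonneg Q-large)) (+≤+ z≤n))))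
            (identity Q N h))
            where
            Q⁵ = Q * (Q * (Q * (Q * Q)))
            identity : ∀ Q N h → (+ 2 * Q) * (((Q - 1ℤ) * h) * (N * N)) ≡ (+ 2 * Q) * (+ 8 * (Q * (Q * (Q * (Q * Q))))) +
              ((((Q - 1ℤ) * (N * N)) * ((+ 2 * Q) * h - N) + (Q - 1ℤ) * (N * (N * N) - + 125 * (Q * (Q * (Q * (Q * Q))))))
                + (Q * (Q * (Q * (Q * Q)))) * (+ 109 * (Q - + 125) + + 13500))
            identity = solve-∀

          E : ℤ
          E = (Q - 1ℤ) * ((h * (N * N)) * (h * (N * N)))

          -- After multiplication by 4 Q², the deviation term is at most `E` and the mean term at
          -- most 9 `E`; their sum accounts for the 10.
          Q²Q₁≤10T : (Q * Q) * (Q - 1ℤ) ≤ + 10 * T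
          Q²Q₁≤10T = cancel-≤ (1≤-* Q₁-positive (1≤-* 1≤hN² 1≤hN²)) (begin
            E * ((Q * Q) * (Q - 1ℤ))
              ≡⟨ regroup Q (h * (N * N)) ⟩
            (Q * Q) * (((Q - 1ℤ) * (Q - 1ℤ)) * ((h * (N * N)) * (h * (N * N))))
              ≤⟨ *-mono-≤-nonnegˡ (*-nonneg 0≤Q 0≤Q) (*-mono-≤-nonnegˡ (*-nonneg 0≤Q₁ 0≤Q₁)
                   (*-mono-≤-nonneg (≤-trans 0≤hN² hN²≤2n) 0≤hN² hN²≤2n hN²≤2n)) ⟩
            (Q * Q) * (((Q - 1ℤ) * (Q - 1ℤ)) * ((+ 2 * n) * (+ 2 * n)))
              ≡⟨ pull Q (Q - 1ℤ) n ⟩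
            (+ 4 * (Q * Q)) * (((Q - 1ℤ) * (Q - 1ℤ)) * (n * n))
              ≤⟨ *-mono-≤-nonnegˡ (*-nonneg {+ 4} (+≤+ z≤n) (*-nonneg 0≤Q 0≤Q)) bound ⟩
            (+ 4 * (Q * Q)) * (T * ((+ 2 * (Q * (Q * Q))) * ((N * h) * N) + (Q - 1ℤ) * ((h * h) * (S * S′))))
              ≡⟨ distribute Q N h T (S * S′) (Q - 1ℤ) ⟩
            T * ((h * (N * N)) * (+ 8 * (Q * (Q * (Q * (Q * Q))))) + ((Q - 1ℤ) * (h * h)) * ((+ 4 * (Q * Q)) * (S * S′)))
              ≤⟨ *-mono-≤-nonnegˡ 0≤T (≤-trans
                   (+-mono-≤ (*-mono-≤-nonnegˡ 0≤hN² 8Q⁵≤Q₁hN²)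
                     (*-mono-≤-nonnegˡ (*-nonneg 0≤Q₁ (*-nonneg 0≤h 0≤h)) 4Q²SS′≤9N⁴))
                   ≤-refl) ⟩
            T * ((h * (N * N)) * (((Q - 1ℤ) * h) * (N * N)) + ((Q - 1ℤ) * (h * h)) * (+ 9 * ((N * N) * (N * N))))
              ≡⟨ collect Q N h T (Q - 1ℤ) ⟩
            E * (+ 10 * T) ∎)
            where
            open ≤-Reasoning
            1≤h : 1ℤ ≤ h
            1≤h = 1≤-factor (*-nonneg {+ 2} (+≤+ z≤n) 0≤Q) (≤-trans 1≤N h-large)
            1≤hN² : 1ℤ ≤ h * (N * N)
            1≤hN² = 1≤-* 1≤h (1≤-* 1≤N 1≤N)
            regroup : ∀ Q m → ((Q - 1ℤ) * (m * m)) * ((Q * Q) * (Q - 1ℤ)) ≡ (Q * Q) * (((Q - 1ℤ) * (Q - 1ℤ)) * (m * m))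
            regroup = solve-∀
            pull : ∀ Q q n → (Q * Q) * ((q * q) * ((+ 2 * n) * (+ 2 * n))) ≡ (+ 4 * (Q * Q)) * ((q * q) * (n * n))
            pull = solve-∀
            distribute : ∀ Q N h T s q →
              (+ 4 * (Q * Q)) * (T * ((+ 2 * (Q * (Q * Q))) * ((N * h) * N) + q * ((h * h) * s))) ≡
              T * ((h * (N * N)) * (+ 8 * (Q * (Q * (Q * (Q * Q))))) + (q * (h * h)) * ((+ 4 * (Q * Q)) * s))
            distribute = solve-∀
            collect : ∀ Q N h T q →
              T * ((h * (N * N)) * ((q * h) * (N * N)) + (q * (h * h)) * (+ 9 * ((N * N) * (N * N)))) ≡
              (q * ((h * (N * N)) * (h * (N * N)))) * (+ 10 * T)
            collect = solve-∀

        -- The last factor 2 replaces Q - 1 by Q, using Q ≤ 2 (Q - 1).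
        conclusion : Q * (Q * Q) ≤ + 20 * T
        conclusion = ≤-by-difference
          ((+ 2 * (+ 10 * T - (Q * Q) * (Q - 1ℤ))) + (Q * Q) * ((Q - + 125) + + 123))
          (+-nonneg (*-nonneg {+ 2} (+≤+ z≤n) (difference-nonneg Q²Q₁≤10T))
                    (*-nonneg (*-nonneg 0≤Q 0≤Q) (+-nonneg (difference-nonneg Q-large) (+≤+ z≤n))))
          (identity Q T)
          where
          identity : ∀ Q T → + 20 * T ≡ Q * (Q * Q) +
            ((+ 2 * (+ 10 * T - (Q * Q) * (Q - 1ℤ))) + (Q * Q) * ((Q - + 125) + + 123))
          identity = solve-∀

-- Application to a given set E.

module DistanceTriples (F : FiniteField) (B : V F → V F → FiniteField.Carrier F)
                       (bil : IsBilinear F B) (nd : IsNondegenerate F B) (E : Subset² F) where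
  open FiniteSums
  open FieldSums F
  open CentredIndicators F using (Q₁)
  open VectorCorrelation F B bil nd using (Q-nonneg; _≟V_)
  open FieldAlgebra F using (Carrier; elems; size; enum; _≟_; 0#; zeroʳ)
  open Arithmetic
  open import Data.Bool using (T; T?)
  open import Data.Integer using (ℤ; +_; 0ℤ; 1ℤ; _+_; _*_; _≤_; +≤+; Positive)
  open import Data.Integer.Properties using (pos-*; *-identityˡ; ≤-trans; ≤-refl; drop‿+≤+;
    module ≤-Reasoning)
  open import Data.Integer.Tactic.RingSolver using (solve-∀)
  open import Data.List.Membership.Propositional using (_∈_; lose)
  open import Data.List.Membership.Propositional.Properties using (∈-map⁺; ∈-allFin;
    ∈-cartesianProduct⁺; ∈-filter⁺)
  open import Data.List.Relation.Unary.Any as Any using (Any)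
  open import Data.Nat as ℕ using (ℕ; zero; suc; z≤n; s≤s)
  import Data.Nat.Properties as ℕ
  open import Data.Product using (_×_; _,_; proj₁; proj₂)
  open import Function.Bundles using (Inverse)
  open import Relation.Nullary.Decidable using (¬?; _×-dec_)
  open import Relation.Binary.PropositionalEquality

  -- The origin is removed because the kernel of B(·, 0) is the whole plane, not a line, and because
  -- the averaging over dilates needs weights that vanish at 0.
  W : V F → Set
  W x = T (E x) × ¬ x ≡ 0V F

  W? : ∀ x → Dec (W x)
  W? x = T? (E x) ×-dec ¬? (x ≟V 0V F)

  0∉W : ¬ W (0V F)
  0∉W (_ , 0≢0) = 0≢0 refl

  open Selection F B bil nd W W? 0∉W

  N : ℤ
  N = ∑V (λ x → ⟦ W? x ⟧)

  Attained : Triple F → Set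
  Attained t = Any (λ x → Any (λ y → Any (λ z → t ≡ (B x y , B y z , B z x)) (elemsOf F E)) (elemsOf F E)) (elemsOf F E)

  attained? : ∀ t → Dec (Attained t)
  attained? t = Any.any? (λ x → Any.any? (λ y → Any.any? (λ z →
    _≟T_ F t (B x y , B y z , B z x)) (elemsOf F E)) (elemsOf F E)) (elemsOf F E)

  ∈-elems : ∀ a → a ∈ elems
  ∈-elems a = subst (_∈ elems) (Inverse.inverseˡ enum refl) (∈-map⁺ (Inverse.to enum) (∈-allFin (Inverse.from enum a)))

  ∈-elemsOf : ∀ {x} → W x → x ∈ elemsOf F E
  ∈-elemsOf {a , b} (Ex , _) = ∈-filter⁺ (λ x → T? (E x)) (∈-cartesianProduct⁺ (∈-elems a) (∈-elems b)) Ex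

  attained : ∀ {x y z} → W x → W y → W z → Attained (B x y , B y z , B z x)
  attained Wx Wy Wz = lose (∈-elemsOf Wx) (lose (∈-elemsOf Wy) (lose (∈-elemsOf Wz) refl))

  card≤N+1 : + card F E ≤ N + 1ℤ
  card≤N+1 = begin
    + card F E
      ≡⟨ length-filter (λ x → T? (E x)) (allPoints F) ⟩
    ∑V (λ x → ⟦ T? (E x) ⟧)
      ≤⟨ ∑-mono (allPoints F) (λ x → split (T? (E x)) (x ≟V 0V F)) ⟩
    ∑V (λ x → ⟦ W? x ⟧ + ⟦ x ≟V 0V F ⟧)
      ≡⟨ trans (∑-+ (allPoints F) _ _) (cong (_+_ N) (𝕍.∑-unique₁ (_≟V 0V F) (0V F) (λ _ e → e) refl)) ⟩
    N + 1ℤ ∎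
    where
    open ≤-Reasoning
    split : {P R : Set} (D : Dec P) (E : Dec R) → ⟦ D ⟧ ≤ ⟦ D ×-dec ¬? E ⟧ + ⟦ E ⟧
    split (yes _) (yes _) = ≤-refl
    split (yes _) (no _)  = ≤-refl
    split (no _)  (yes _) = +≤+ z≤n
    split (no _)  (no _)  = ≤-refl

  1≤Q : 1ℤ ≤ Q
  1≤Q = subst₂ _≤_ (𝔽.∑-unique₁ (_≟ 0#) 0# (λ _ e → e) refl) ∑F-one (∑-mono elems (λ a → ⟦⟧-≤1 (a ≟ 0#)))

  N-nonneg : 0ℤ ≤ N
  N-nonneg = ∑-nonneg (allPoints F) (λ x → ⟦⟧-nonneg (W? x))

  N≤Q² : N ≤ Q * Q
  N≤Q² = subst (N ≤_) ∑V-one (∑-mono (allPoints F) (λ x → ⟦⟧-≤1 (W? x)))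

  pos-³ : ∀ n → + (n ℕ.^ 3) ≡ + n * (+ n * + n)
  pos-³ n = trans (cong (λ m → + (n ℕ.* (n ℕ.* m))) (ℕ.*-identityʳ n))
    (trans (pos-* n (n ℕ.* n)) (cong (+ n *_) (pos-* n n)))

  pos-⁵ : ∀ n → + (n ℕ.^ 5) ≡ + n * (+ n * (+ n * (+ n * + n)))
  pos-⁵ n = trans (pos-* n (n ℕ.^ 4)) (cong (+ n *_) (trans (pos-* n (n ℕ.^ 3)) (cong (+ n *_) (pos-³ n))))

  module _ (large : 1 ℕ.^ 3 ℕ.* card F E ℕ.^ 3 ℕ.≥ 10 ℕ.^ 3 ℕ.* size ℕ.^ 5) where

    card³-large : + 1000 * (Q * (Q * (Q * (Q * Q)))) ≤ + card F E * (+ card F E * + card F E)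
    card³-large = subst₂ _≤_
      (trans (pos-* (10 ℕ.^ 3) (size ℕ.^ 5)) (cong (+ 1000 *_) (pos-⁵ size)))
      (trans (cong +_ (ℕ.*-identityˡ (card F E ℕ.^ 3))) (pos-³ (card F E)))
      (+≤+ large)

    1≤Q⁵ : 1ℤ ≤ Q * (Q * (Q * (Q * Q)))
    1≤Q⁵ = 1≤-* 1≤Q (1≤-* 1≤Q (1≤-* 1≤Q (1≤-* 1≤Q 1≤Q)))

    -- If card E were at most 1, its cube could not exceed 1000.
    card≤2N : + card F E ≤ + 2 * N
    card≤2N = compare (card F E) N N-nonneg card≤N+1 1000≤card³
      where
      1000≤card³ : + 1000 ≤ + card F E * (+ card F E * + card F E)
      1000≤card³ = ≤-trans (*-mono-≤-nonnegˡ {+ 1000} {1ℤ} (+≤+ z≤n) 1≤Q⁵) card³-large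
      compare : ∀ c N → 0ℤ ≤ N → + c ≤ N + 1ℤ → + 1000 ≤ + c * (+ c * + c) → + c ≤ + 2 * N
      compare c (+ suc n) _ le _ = ≤-trans le (≤-by-difference (+ n) (+≤+ z≤n) (identity (+ n)))
        where
        identity : ∀ n → + 2 * (1ℤ + n) ≡ ((1ℤ + n) + 1ℤ) + n
        identity = solve-∀
      compare zero (+ 0) _ _ _ = ≤-refl
      compare 1 (+ 0) _ _ (+≤+ (s≤s ()))
      compare (suc (suc c)) (+ 0) _ (+≤+ (s≤s ())) _

    -- Passing from the cardinality to at most 2 N costs 2³ = 8, and 10³ = 8 · 125.
    N³-large : + 125 * (Q * (Q * (Q * (Q * Q)))) ≤ N * (N * N)
    N³-large = cancel-≤ {+ 8} (+≤+ (s≤s z≤n)) (begin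
      + 8 * (+ 125 * Q⁵)                                  ≡⟨ rescale Q⁵ ⟩
      + 1000 * Q⁵                                         ≤⟨ card³-large ⟩
      + card F E * (+ card F E * + card F E)              ≤⟨ *-mono-≤-nonneg 0≤2N (*-nonneg 0≤card 0≤card) card≤2N
                                                              (*-mono-≤-nonneg 0≤2N 0≤card card≤2N card≤2N) ⟩
      (+ 2 * N) * ((+ 2 * N) * (+ 2 * N))                 ≡⟨ cube N ⟩
      + 8 * (N * (N * N))                                 ∎)
      where
      open ≤-Reasoning
      Q⁵ = Q * (Q * (Q * (Q * Q)))
      0≤card : 0ℤ ≤ + card F E
      0≤card = +≤+ z≤n
      0≤2N : 0ℤ ≤ + 2 * N
      0≤2N = *-nonneg {+ 2} (+≤+ z≤n) N-nonneg
      rescale : ∀ p → + 8 * (+ 125 * p) ≡ + 1000 * p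
      rescale = solve-∀
      cube : ∀ N → (+ 2 * N) * ((+ 2 * N) * (+ 2 * N)) ≡ + 8 * (N * (N * N))
      cube = solve-∀

    conclusion-from : ∀ u → 0ℤ ≤ surplus u → Q * (Q * Q) ≤ + 20 * + distanceTriples F B E
    conclusion-from u selected = subst (λ s → Q * (Q * Q) ≤ + 20 * s) (sym (length-filter attained? (allTriples F)))
        (conclusion 1≤Q N-nonneg N≤Q² N³-large (SM.h-nonneg) h≤Q (excess-nonneg u) selected
          (SM.coincidences-nonneg (λ y → B y u)) (SM.coincidences-nonneg (λ x → B u x)) refl
          (∑-nonneg (allTriples F) (λ s → ⟦⟧-nonneg (attained? s)))
          (AT.total-count-≥ u≢0 (N-2Q-nonneg 1≤Q N-nonneg N≤Q² N³-large))
          (AT.attained-bound attained? attained positive))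
      where
      module SM = SecondMoment F B bil nd W W? 0∉W u
      module AT = AttainedTriples F B bil nd W W? 0∉W u
      h≤Q : SM.h ≤ Q
      h≤Q = subst (SM.h ≤_) ∑F-one (∑-mono elems (λ t → ⟦⟧-≤1 (W? (t • u))))
      1≤h : 1ℤ ≤ SM.h
      1≤h = 1≤-factor (*-nonneg {+ 2} (+≤+ z≤n) Q-nonneg)
        (≤-trans (1≤N 1≤Q N-nonneg N≤Q² N³-large)
          (h-large 1≤Q N-nonneg N≤Q² N³-large SM.h-nonneg h≤Q (excess-nonneg u) selected))
      -- For u = 0 every t u is the origin, which `W` excludes, so h would be 0.
      u≢0 : ¬ u ≡ 0V F
      u≢0 u≡0 = contradiction-≤ (subst (1ℤ ≤_) h≡0 1≤h)
        where
        contradiction-≤ : ¬ 1ℤ ≤ 0ℤ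
        contradiction-≤ (+≤+ ())
        h≡0 : SM.h ≡ 0ℤ
        h≡0 = trans (∑-cong elems (λ t → ⟦⟧-false (W? (t • u))
          (λ { (_ , tu≢0) → tu≢0 (trans (cong (t •_) u≡0) (cong₂ _,_ (zeroʳ t) (zeroʳ t))) }))) (∑-zero elems)
      positive : Positive Q₁
      positive = ≥1⇒positive (Q₁-positive 1≤Q N-nonneg N≤Q² N³-large)
        where
        ≥1⇒positive : ∀ {i} → 1ℤ ≤ i → Positive i
        ≥1⇒positive (+≤+ (s≤s _)) = _

    bound : 20 ℕ.* distanceTriples F B E ℕ.≥ 1 ℕ.* size ℕ.^ 3
    bound = drop‿+≤+ (subst₂ _≤_
      (sym (trans (cong +_ (ℕ.*-identityˡ (size ℕ.^ 3))) (pos-³ size)))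
      (sym (pos-* 20 (distanceTriples F B E)))
      (conclusion-from (proj₁ good-direction) (proj₂ good-direction)))

open import Data.Nat using (ℕ; _*_; _^_; _≥_; NonZero)
open import Data.Product using (_×_; _,_; ∃-syntax)

theorem1p1 : ∃[ a ] ∃[ b ] ∃[ a′ ] ∃[ b′ ]
    (NonZero a × NonZero b × NonZero a′ × NonZero b′ ×
    ((F : FiniteField) → IsPrimePower (FiniteField.size F) →
    (B : V F → V F → FiniteField.Carrier F) →
    IsBilinear F B → IsNondegenerate F B →
    (E : Subset² F) →
    b ^ 3 * card F E ^ 3 ≥ a ^ 3 * FiniteField.size F ^ 5 →
    b′ * distanceTriples F B E ≥ a′ * FiniteField.size F ^ 3))
-- The constants are C = 10 / 1 and c = 1 / 20; the size condition is cubed, which turns q^(5/3)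
-- into the integer power q⁵.
theorem1p1 = 10 , 1 , 1 , 20 , _ , _ , _ , _ ,
  λ F _ B bil nd E large → DistanceTriples.bound F B bil nd E large
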